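{- Let $G=G_0,G_1,\dots,G_r$ be the reduction series of a graph $G$ and let $0\le i<r$, so that $G_i$ is reduced to $G_{i+1}$. Let $\Phi_i:\mathrm{Aut}(G_i)\to\mathrm{Aut}(G_{i+1})$ be the reduction epimorphism. Then $$\mathrm{Aut}(G_{i+1})\cong \mathrm{Aut}(G_i)/\mathrm{Ker}(\Phi_i).$$
   Context: GRAPHS. A graph is a tuple $(D,V,\iota,\lambda)$ with $D$ a finite set of darts, $V$ a finite set of vertices, $\iota:D\to V$ a partial function (incidence) and $\lambda:D\to D$ an involution. Edges are the orbits $\{d,\lambda d\}$ of $\lambda$ of size 2, half-edges are the orbits of size 1. An edge is standard if $\iota(d),\iota(\lambda d)$ are defined and distinct, a loop if they are defined and equal, pendant if exactly one is defined, free if none is defined. A pendant edge at $v$ is single if it is the only pendant edge attached to $v$. Edges are colored and have one of three types: halvable, undirected, directed (the latter with an orientation); pendant edges are undirected. The graph $G$ is connected, without loops and half-edges. When vertices are removed, their incident edges are kept as pendant or free edges; a free edge is a connected component. Automorphisms and isomorphisms are bijections on vertices and darts that commute with $\iota$ and $\lambda$ and preserve colors, types and orientations of edges; $\mathrm{Aut}(G)$ is the automorphism group. SEMIREGULARITY. A group of automorphisms is semiregular if stabilizers of all vertices, darts and non-halvable edges are trivial; a halvable edge may be fixed by an involution interchanging its two darts. An automorphism $\pi$ is semiregular if $\langle\pi\rangle$ is. BLOCK-TREE. An articulation is a vertex $u$ with $G\setminus u$ disconnected. Blocks are the maximal 2-connected subgraphs, where bridge-edges and pendant edges also count as blocks.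 The block-tree is the incidence graph between articulations and blocks; its center is a single vertex, called the central articulation or the central block ($K_1$, possibly with one pendant edge, is regarded as having a central articulation). The tree is rooted at its center; the rooted subtree determined by a node $x$ consists of $x$ and all nodes whose path to the center passes through $x$. ATOMS. For a subgraph $A$, $\partial A$ is the set of vertices of $A$ incident with an edge not in $A$, and $\mathring A=A\setminus\partial A$. Parts are the following subgraphs. Block part: the union $S$ of all blocks in the rooted subtree determined by a node other than the central block, where $S$ is not a single pendant edge. Proper part: given a block $B$ and a 2-cut $U=\{u,v\}$ of $B$ (i.e. $B\setminus U$ has at least two connected components containing vertices) with $u,v$ of degree at least 3 in $B$, the subgraph consisting of $u,v$ and a connected component $K$ of $G\setminus U$ that contains a component of $B\setminus U$ (with the edges joining $K$ to $U$), where $K$ is not a single free edge and $K$ does not contain all vertices of the central block or the central articulation. Dipole part (dipole): two vertices with all edges joining them, there being at least two such edges. Atoms are the inclusion-minimal parts: block atoms, proper atoms, dipoles. The boundary $\partial A$ is: the articulation at which $A$ is attached for a block atom (the center, for a star of pendant edges); $U$ for a proper atom; the two vertices for a dipole. A graph is primitive if it has no atoms. SYMMETRY TYPES. $\mathrm{Aut}_{\partial A}(A)$ is the set-wise stabilizer of $\partial A$ in $\mathrm{Aut}(A)$. A proper atom or dipole $A$ with $\partial A=\{u,v\}$ is halvable if some semiregular involution in $\mathrm{Aut}_{\partial A}(A)$ exchanges $u,v$; symmetric if it is not halvable but some element of $\mathrm{Aut}_{\partial A}(A)$ exchanges $u,v$; asymmetric otherwise. A $\partial$-isomorphism $A\to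 A'$ is an isomorphism mapping $\partial A$ onto $\partial A'$. REDUCTION. $G_{i+1}$ arises from $G_i$ by replacing simultaneously the interior of every atom $A$ of $G_i$ by an edge $e_A$, with a new color for each $\partial$-isomorphism class of atoms: a pendant edge at $u$ if $A$ is a block atom with $\partial A=\{u\}$; a halvable/undirected/directed edge $uv$ if $A$ is a halvable/symmetric/asymmetric proper atom or dipole with $\partial A=\{u,v\}$, directed edges being oriented consistently with $\partial$-isomorphisms inside each class. Atoms in all steps are taken with respect to the image of the central block/articulation of $G$. The reduction series $G=G_0,\dots,G_r$ stops when $G_r$ is primitive. REDUCTION EPIMORPHISM. For $\pi\in\mathrm{Aut}(G_i)$, $\Phi_i(\pi)$ acts as $\pi$ on common vertices, edges and darts of $G_i$ and $G_{i+1}$, and maps $e_A$ to $e_{\pi(A)}$ for each atom $A$ of $G_i$; the dart of $e_A$ at $u\in\partial A$ is mapped to the dart of $e_{\pi(A)}$ at $\pi(u)$, and the other dart to the other dart. -}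

module Defs where

open import Level using (0ℓ; _⊔_) renaming (suc to lsuc)
open import Algebra.Bundles using (Group)
open import Algebra.Morphism.Structures using (module GroupMorphisms)
import Algebra.Properties.Group as GroupProperties
open import Data.Bool.Base using (Bool; true; false; not)
open import Data.Fin.Base using (Fin; zero; suc; inject₁; fromℕ)
open import Data.Fin.Permutation as Perm
  using (Permutation′; _⟨$⟩ʳ_; _⟨$⟩ˡ_; _∘ₚ_)
open import Data.Fin.Properties using (_≟_)
open import Data.Fin.Subset
  using (Subset; ⊤; ⁅_⁆; _∈_; _∉_; _⊆_; _∩_; _∪_; _─_; ∣_∣; Nonempty; Empty)
open import Data.List.Base using (List; []; _∷_; length)
import Data.List.Membership.Propositional as List
open import Data.Maybe.Base as Maybe using (Maybe; just; nothing)
open import Data.Maybe.Properties using (≡-dec)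
open import Data.Nat.Base using (ℕ; suc; _≤_; _≥_)
open import Data.Product.Base using (Σ; Σ-syntax; ∃; ∃-syntax; ∃₂; _×_; _,_; proj₁; proj₂)
open import Data.Sum.Base using (_⊎_; inj₁; inj₂)
open import Data.Vec.Base using (lookup; tabulate)
open import Function.Base using (_∘_)
open import Function.Bundles using (_⇔_)
open import Function.Definitions using (Injective; Surjective)
open import Relation.Binary.Construct.Closure.Equivalence using (EqClosure)
open import Relation.Binary.Construct.Closure.ReflexiveTransitive
  using (Star; _◅_) renaming (ε to done)
open import Relation.Binary.PropositionalEquality
  using (_≡_; _≢_; refl; sym; trans; cong)
import Relation.Binary.Reasoning.Setoid as SetoidReasoning
open import Relation.Nullary using (¬_; does)
open import Relation.Unary using (Pred)

-- The label of a dart encodes the type of its edge and, for a directed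
-- edge, the orientation: one dart of the edge is the tail, the other one
-- the head.
data Label : Set where
  halvable undirected tail head : Label

opposite : Label → Label
opposite halvable   = halvable
opposite undirected = undirected
opposite tail       = head
opposite head       = tail

data Directed : Label → Set where
  tail : Directed tail
  head : Directed head

-- ι is the incidence, `nothing` meaning undefined; ƛ is the involution on
-- darts, whose orbits are the edges and half-edges.
record Graph : Set where
  field
    #V #D        : ℕ
    ι            : Fin #D → Maybe (Fin #V)
    ƛ            : Fin #D → Fin #D
    ƛ-involutive : ∀ d → ƛ (ƛ d) ≡ d
    colour       : Fin #D → ℕ
    colour-ƛ     : ∀ d → colour (ƛ d) ≡ colour d
    label        : Fin #D → Label
    label-ƛ      : ∀ d → label (ƛ d) ≡ opposite (label d)

  Vertex = Fin #V
  Dart   = Fin #D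

  Pendant : Dart → Vertex → Set
  Pendant d v = ι d ≡ just v × ι (ƛ d) ≡ nothing

  field
    pendant-undirected : ∀ d v → Pendant d v → label d ≡ undirected

module _ (G : Graph) where
  open Graph G

  -- A set of vertices and darts, regarded as a graph in its own right with
  -- ι undefined wherever its value lies outside `verts`.  Thus removing
  -- vertices keeps their edges as pendant or free edges.
  record Region : Set where
    constructor region
    field
      verts : Subset #V
      darts : Subset #D

  record Part : Set where
    constructor part
    field
      body     : Region
      boundary : Subset #V

module _ {G : Graph} where
  open Graph G
  open Region
  open Part

  infix 4 _⊑_
  infixl 5 _∖_

  _⊑_ : Region G → Region G → Set
  A ⊑ B = verts A ⊆ verts B × darts A ⊆ darts B

  _∖_ : Region G → Subset #V → Region G
  A ∖ X = region (verts A ─ X) (darts A)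

  interior : Part G → Region G
  interior P = body P ∖ boundary P

  -- Subgraphs in the strict sense: full edges, with all of their ends.
  IsSubgraph : Region G → Set
  IsSubgraph A =
    (∀ d → d ∈ darts A → ƛ d ∈ darts A) ×
    (∀ d v → d ∈ darts A → ι d ≡ just v → v ∈ verts A)

  edge : Dart → Subset #D
  edge d = ⁅ d ⁆ ∪ ⁅ ƛ d ⁆

  degree : Region G → Vertex → ℕ
  degree A v = ∣ darts A ∩ tabulate (λ d → does (≡-dec _≟_ (ι d) (just v))) ∣

  IsBoundary : Region G → Subset #V → Set
  IsBoundary A X =
    ∀ v → v ∈ X ⇔ (v ∈ verts A × ∃[ d ] (d ∉ darts A × ι d ≡ just v))

  Element : Set
  Element = Vertex ⊎ Dart

  infix 4 _∈ᴿ_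

  _∈ᴿ_ : Element → Region G → Set
  inj₁ v ∈ᴿ A = v ∈ verts A
  inj₂ d ∈ᴿ A = d ∈ darts A

  data Step (A : Region G) : Element → Element → Set where
    mate : ∀ {d} → d ∈ darts A → ƛ d ∈ darts A → Step A (inj₂ d) (inj₂ (ƛ d))
    end  : ∀ {d v} → d ∈ darts A → v ∈ verts A → ι d ≡ just v →
           Step A (inj₂ d) (inj₁ v)

  Linked : Region G → Element → Element → Set
  Linked A = EqClosure (Step A)

  -- The empty region is neither connected nor disconnected.
  Connected : Region G → Set
  Connected A = (∃[ x ] x ∈ᴿ A) × (∀ x y → x ∈ᴿ A → y ∈ᴿ A → Linked A x y)

  Disconnected : Region G → Set
  Disconnected A = ∃₂ λ x y → x ∈ᴿ A × y ∈ᴿ A × ¬ Linked A x y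

  IsComponent : Region G → Region G → Set
  IsComponent A K =
    K ⊑ A × Connected K × (∀ x y → x ∈ᴿ K → y ∈ᴿ A → Linked A x y → y ∈ᴿ K)

  SingleFreeEdge : Region G → Set
  SingleFreeEdge A = Empty (verts A) × ∃[ d ] darts A ≡ edge d

  SinglePendantEdge : Region G → Set
  SinglePendantEdge A = ∃₂ λ d v → Pendant d v × A ≡ region ⁅ v ⁆ (edge d)

module _ (G : Graph) where
  open Graph G
  open Region

  whole : Region G
  whole = region ⊤ ⊤

  LoopFree : Set
  LoopFree = ∀ d v → ¬ (ι d ≡ just v × ι (ƛ d) ≡ just v × ƛ d ≢ d)

  HalfEdgeFree : Set
  HalfEdgeFree = ∀ d → ƛ d ≢ d

  Articulation : Vertex → Set
  Articulation v = Disconnected (whole ∖ ⁅ v ⁆)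

  -- K₂ is 2-connected in this sense, so that the bridge-edges are blocks;
  -- an articulation of A is a vertex whose removal disconnects A itself.
  TwoConnected : Region G → Set
  TwoConnected A =
    IsSubgraph A ×
    (∃₂ λ u v → u ∈ verts A × v ∈ verts A × u ≢ v) ×
    Connected A ×
    (∀ v → v ∈ verts A → ¬ Disconnected (A ∖ ⁅ v ⁆))

  data Block (B : Region G) : Set where
    maximal : TwoConnected B → (∀ C → TwoConnected C → B ⊑ C → C ≡ B) → Block B
    pendant : SinglePendantEdge B → Block B

  data Node : Set where
    art : Vertex → Node
    blk : Region G → Node

  IsNode : Node → Set
  IsNode (art v) = Articulation v
  IsNode (blk B) = Block B

  data Adjacent : Node → Node → Set where
    down : ∀ {v B} → Articulation v → Block B → v ∈ verts B → Adjacent (art v) (blk B)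
    up   : ∀ {v B} → Articulation v → Block B → v ∈ verts B → Adjacent (blk B) (art v)

  Walk : Node → Node → Set
  Walk = Star Adjacent

  size : ∀ {x y} → Walk x y → ℕ
  size done    = 0
  size (_ ◅ w) = suc (size w)

  visited : ∀ {x y} → Walk x y → List Node
  visited {x} done    = x ∷ []
  visited {x} (_ ◅ w) = x ∷ visited w

  EccentricityAtMost : Node → ℕ → Set
  EccentricityAtMost x k = ∀ y → IsNode y → Σ[ w ∈ Walk x y ] size w ≤ k

  HasLeastEccentricity : Node → Set
  HasLeastEccentricity x =
    IsNode x × (∀ y k → IsNode y → EccentricityAtMost y k → EccentricityAtMost x k)

  -- For a connected graph without half-edges and loops this says that the
  -- graph is K₁, possibly with one pendant edge.
  TrivialTree : Set
  TrivialTree = #V ≡ 1 × #D ≤ 2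

  data IsCentre : Node → Set where
    trivial : ∀ v → TrivialTree → IsCentre (art v)
    least   : ∀ x → ¬ TrivialTree → HasLeastEccentricity x →
              (∀ y → HasLeastEccentricity y → y ≡ x) → IsCentre x

  CoversCentre : Node → Region G → Set
  CoversCentre (art v) K = v ∈ verts K
  CoversCentre (blk C) K = verts C ⊆ verts K

  module _ (c : Node) where

    -- In a tree, the path from y to c visits x if and only if every walk
    -- from y to c does.
    InSubtree : Node → Node → Set
    InSubtree x y =
      IsNode y × (y ≡ x ⊎ Walk y c × (∀ (w : Walk y c) → x List.∈ visited w))

    UnionOfSubtree : Node → Region G → Set
    UnionOfSubtree x S =
      (∀ v → v ∈ verts S ⇔ (∃[ B ] (InSubtree x (blk B) × v ∈ verts B))) ×
      (∀ d → d ∈ darts S ⇔ (∃[ B ] (InSubtree x (blk B) × d ∈ darts B)))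

    -- Away from the root the set given by `IsBoundary` consists of the articulation
    -- at which the part is attached; at a central articulation the part is
    -- the whole graph and its boundary has to be prescribed.
    data BlockPart (P : Part G) : Set where
      attached : ∀ x → IsNode x → x ≢ c →
                 UnionOfSubtree x (Part.body P) →
                 ¬ SinglePendantEdge (Part.body P) →
                 IsBoundary (Part.body P) (Part.boundary P) →
                 BlockPart P
      central  : ∀ u → IsNode (art u) → art u ≡ c →
                 UnionOfSubtree (art u) (Part.body P) →
                 ¬ SinglePendantEdge (Part.body P) →
                 Part.boundary P ≡ ⁅ u ⁆ →
                 BlockPart P

    record ProperPart (P : Part G) : Set where
      field
        B         : Region G
        u v       : Vertex
        K L₁ L₂ L : Region G
      U : Subset #V
      U = ⁅ u ⁆ ∪ ⁅ v ⁆
      field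
        block         : Block B
        u∈B           : u ∈ verts B
        v∈B           : v ∈ verts B
        u≢v           : u ≢ v
        component₁    : IsComponent (B ∖ U) L₁
        component₂    : IsComponent (B ∖ U) L₂
        different     : L₁ ≢ L₂
        vertex₁       : Nonempty (verts L₁)
        vertex₂       : Nonempty (verts L₂)
        degree-u      : degree B u ≥ 3
        degree-v      : degree B v ≥ 3
        component-K   : IsComponent (whole ∖ U) K
        component-L   : IsComponent (B ∖ U) L
        L⊑K           : L ⊑ K
        not-free-edge : ¬ SingleFreeEdge K
        not-central   : ¬ CoversCentre c K
        body≡         : Part.body P ≡ region (verts K ∪ U) (darts K)
        boundary≡     : Part.boundary P ≡ U

  Joins : Dart → Vertex → Vertex → Set
  Joins d u v = (ι d ≡ just u × ι (ƛ d) ≡ just v) ⊎ (ι d ≡ just v × ι (ƛ d) ≡ just u)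

  record Dipole (P : Part G) : Set where
    field
      u v       : Vertex
      u≢v       : u ≢ v
      verts≡    : verts (Part.body P) ≡ ⁅ u ⁆ ∪ ⁅ v ⁆
      darts⇔    : ∀ d → d ∈ darts (Part.body P) ⇔ Joins d u v
      two-edges : ∃₂ λ d e → Joins d u v × Joins e u v × e ∉ edge {G} d
      boundary≡ : Part.boundary P ≡ ⁅ u ⁆ ∪ ⁅ v ⁆

  IsPart : Node → Part G → Set
  IsPart c P = BlockPart c P ⊎ ProperPart c P ⊎ Dipole P

  -- A leaf block consisting of parallel edges only is, as a subgraph, both
  -- a block part and a dipole.  It has to be replaced once, and it counts
  -- as a dipole.
  record IsAtom (c : Node) (P : Part G) : Set where
    open Part
    field
      isPart       : IsPart c P
      minimal      : ∀ Q → IsPart c Q → body Q ⊑ body P → body Q ≡ body P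
      dipole-first : ∀ X → Dipole (part (body P) X) → X ≡ boundary P

  Primitive : Node → Set
  Primitive c = ∀ P → ¬ IsAtom c P

module _ {G : Graph} where
  open Graph G
  open Region
  open Part

  -- The four maps matter only on P and Q.  Bodies of atoms contain the ends
  -- of their edges, hence no restriction of ι is needed here.
  record ∂-Iso (P Q : Part G) : Set where
    field
      toV fromV : Vertex → Vertex
      toD fromD : Dart → Dart

      toV-∈     : ∀ {v} → v ∈ verts (body P) → toV v ∈ verts (body Q)
      fromV-∈   : ∀ {v} → v ∈ verts (body Q) → fromV v ∈ verts (body P)
      toD-∈     : ∀ {d} → d ∈ darts (body P) → toD d ∈ darts (body Q)
      fromD-∈   : ∀ {d} → d ∈ darts (body Q) → fromD d ∈ darts (body P)

      fromV∘toV : ∀ {v} → v ∈ verts (body P) → fromV (toV v) ≡ v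
      toV∘fromV : ∀ {v} → v ∈ verts (body Q) → toV (fromV v) ≡ v
      fromD∘toD : ∀ {d} → d ∈ darts (body P) → fromD (toD d) ≡ d
      toD∘fromD : ∀ {d} → d ∈ darts (body Q) → toD (fromD d) ≡ d

      ι-comm    : ∀ {d} → d ∈ darts (body P) → ι (toD d) ≡ Maybe.map toV (ι d)
      ƛ-comm    : ∀ {d} → d ∈ darts (body P) → ƛ (toD d) ≡ toD (ƛ d)
      colour≡   : ∀ {d} → d ∈ darts (body P) → colour (toD d) ≡ colour d
      label≡    : ∀ {d} → d ∈ darts (body P) → label (toD d) ≡ label d

      boundary⇔ : ∀ {v} → v ∈ verts (body P) → v ∈ boundary P ⇔ toV v ∈ boundary Q

  ∂-Aut : Part G → Set
  ∂-Aut P = ∂-Iso P P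

  iterate : ∀ {A : Set} → (A → A) → ℕ → A → A
  iterate f 0       x = x
  iterate f (suc k) x = f (iterate f k x)

  module _ {P : Part G} (τ : ∂-Aut P) where
    open ∂-Iso τ

    IdentityPower : ℕ → Set
    IdentityPower k =
      (∀ v → v ∈ verts (body P) → iterate toV k v ≡ v) ×
      (∀ d → d ∈ darts (body P) → iterate toD k d ≡ d)

    FixingPower : ℕ → Set
    FixingPower k =
      (∃[ v ] (v ∈ verts (body P) × iterate toV k v ≡ v)) ⊎
      (∃[ d ] (d ∈ darts (body P) × iterate toD k d ≡ d)) ⊎
      (∃[ d ] (d ∈ darts (body P) × label d ≢ halvable × iterate toD k d ≡ ƛ d))

    -- As P is finite, ⟨τ⟩ consists of the powers with exponent in ℕ.  An
    -- element that maps d to ƛ d for a halvable edge and whose square is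
    -- not the identity is excluded by its square fixing d.
    Semiregular : Set
    Semiregular = ∀ k → FixingPower k → IdentityPower k

    Involution : Set
    Involution = ¬ IdentityPower 1 × IdentityPower 2

    Exchanges : Vertex → Vertex → Set
    Exchanges u v = toV u ≡ v × toV v ≡ u

  module _ (P : Part G) (u v : Vertex) where

    Halvable Symmetric Asymmetric : Set
    Halvable   = Σ[ τ ∈ ∂-Aut P ] Semiregular τ × Involution τ × Exchanges τ u v
    Symmetric  = ¬ Halvable × (Σ[ τ ∈ ∂-Aut P ] Exchanges τ u v)
    Asymmetric = ¬ Halvable × ¬ Symmetric

  data Ends (X : Subset #V) : Set where
    single : ∀ u → X ≡ ⁅ u ⁆ → Ends X
    double : ∀ u v → u ≢ v → X ≡ ⁅ u ⁆ ∪ ⁅ v ⁆ → Ends X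

  -- The two darts of the edge e_A are indexed by Bool; `endAt` is their
  -- incidence.
  endAt : ∀ {X} → Ends X → Bool → Maybe Vertex
  endAt (single u _)     false = just u
  endAt (single _ _)     true  = nothing
  endAt (double u _ _ _) false = just u
  endAt (double _ v _ _) true  = just v

  LabelOfType : ∀ (P : Part G) → Ends (boundary P) → Label → Set
  LabelOfType P (single _ _)     l = l ≡ undirected
  LabelOfType P (double u v _ _) l =
    (Halvable P u v × l ≡ halvable) ⊎
    (Symmetric P u v × l ≡ undirected) ⊎
    (Asymmetric P u v × Directed l)

-- H arises from G by replacing the interiors of all atoms by edges.  The
-- vertices of H are the surviving vertices of G, and the darts of H are the
-- surviving darts of G and two darts (a , false), (a , true) for every atom a;
-- this identification is given by originV and originD.
record Reduction (G : Graph) (c : Node G) (H : Graph) : Set where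
  private
    module G = Graph G
    module H = Graph H
  open Region
  open Part

  field
    #A            : ℕ
    atom          : Fin #A → Part G
    atom-isAtom   : ∀ a → IsAtom G c (atom a)
    atom-complete : ∀ P → IsAtom G c P → ∃[ a ] atom a ≡ P
    atom-distinct : Injective _≡_ _≡_ atom
    ends          : ∀ a → Ends {G} (boundary (atom a))

  SurvivingV : G.Vertex → Set
  SurvivingV v = ∀ a → v ∉ verts (interior (atom a))

  SurvivingD : G.Dart → Set
  SurvivingD d = ∀ a → d ∉ darts (interior (atom a))

  Origin : Set
  Origin = G.Dart ⊎ (Fin #A × Bool)

  field
    originV            : H.Vertex → G.Vertex
    originV-injective  : Injective _≡_ _≡_ originV
    originV-surviving  : ∀ w → SurvivingV (originV w)
    originV-surjective : ∀ v → SurvivingV v → ∃[ w ] originV w ≡ v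

    originD            : H.Dart → Origin
    originD-injective  : Injective _≡_ _≡_ originD
    originD-surviving  : ∀ {e d} → originD e ≡ inj₁ d → SurvivingD d
    originD-surjective : ∀ d → SurvivingD d → ∃[ e ] originD e ≡ inj₁ d
    originD-new        : ∀ a b → ∃[ e ] originD e ≡ inj₂ (a , b)

    old-ι      : ∀ {e d} → originD e ≡ inj₁ d → Maybe.map originV (H.ι e) ≡ G.ι d
    old-ƛ      : ∀ {e d} → originD e ≡ inj₁ d → originD (H.ƛ e) ≡ inj₁ (G.ƛ d)
    old-colour : ∀ {e d} → originD e ≡ inj₁ d → H.colour e ≡ G.colour d
    old-label  : ∀ {e d} → originD e ≡ inj₁ d → H.label e ≡ G.label d

    new-ι      : ∀ {e a b} → originD e ≡ inj₂ (a , b) →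
                 Maybe.map originV (H.ι e) ≡ endAt (ends a) b
    new-ƛ      : ∀ {e a b} → originD e ≡ inj₂ (a , b) →
                 originD (H.ƛ e) ≡ inj₂ (a , not b)
    new-colour : ∀ {e a b} → originD e ≡ inj₂ (a , b) →
                 ∀ d → H.colour e ≢ G.colour d
    colour-iso : ∀ {e a b e′ a′ b′} →
                 originD e ≡ inj₂ (a , b) → originD e′ ≡ inj₂ (a′ , b′) →
                 H.colour e ≡ H.colour e′ ⇔ ∂-Iso (atom a) (atom a′)
    new-label  : ∀ {e a b} → originD e ≡ inj₂ (a , b) →
                 LabelOfType (atom a) (ends a) (H.label e)
    consistent : ∀ {e a b e′ a′ b′} →
                 originD e ≡ inj₂ (a , b) → originD e′ ≡ inj₂ (a′ , b′) →
                 Directed (H.label e) →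
                 (f : ∂-Iso (atom a) (atom a′)) →
                 Maybe.map (∂-Iso.toV f) (endAt (ends a) b) ≡ endAt (ends a′) b′ →
                 H.label e′ ≡ H.label e

-- An edge e_A belongs to the image of the central block C if A contains an
-- edge of C.
module _ {G H : Graph} {c : Node G} (R : Reduction G c H) where
  open Reduction R
  open Region

  OriginMeets : Region G → Origin → Set
  OriginMeets C (inj₁ d)       = d ∈ darts C
  OriginMeets C (inj₂ (a , _)) = ∃[ d ] (d ∈ darts C × d ∈ darts (Part.body (atom a)))

  data CentreImage : Node G → Node H → Set where
    art : ∀ w → CentreImage (art (originV w)) (art w)
    blk : ∀ C C′ →
          (∀ w → w ∈ verts C′ ⇔ originV w ∈ verts C) →
          (∀ e → e ∈ darts C′ ⇔ OriginMeets C (originD e)) →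
          CentreImage (blk C) (blk C′)

record ReductionSeries (G : Graph) (r : ℕ) : Set where
  field
    graph        : Fin (suc r) → Graph
    centre       : ∀ i → Node (graph i)
    starts       : graph zero ≡ G
    centre-start : IsCentre (graph zero) (centre zero)
    reduction    : ∀ (i : Fin r) →
                   Reduction (graph (inject₁ i)) (centre (inject₁ i)) (graph (suc i))
    centre-image : ∀ (i : Fin r) →
                   CentreImage (reduction i) (centre (inject₁ i)) (centre (suc i))
    continues    : ∀ (i : Fin r) →
                   ¬ Primitive (graph (inject₁ i)) (centre (inject₁ i))
    stops        : Primitive (graph (fromℕ r)) (centre (fromℕ r))

record Automorphism (G : Graph) : Set where
  open Graph G
  field
    onV     : Permutation′ #V
    onD     : Permutation′ #D
    ι-comm  : ∀ d → ι (onD ⟨$⟩ʳ d) ≡ Maybe.map (onV ⟨$⟩ʳ_) (ι d)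
    ƛ-comm  : ∀ d → ƛ (onD ⟨$⟩ʳ d) ≡ onD ⟨$⟩ʳ ƛ d
    colour≡ : ∀ d → colour (onD ⟨$⟩ʳ d) ≡ colour d
    label≡  : ∀ d → label (onD ⟨$⟩ʳ d) ≡ label d

module _ {G : Graph} where
  open Graph G
  open Automorphism

  map-id′ : ∀ {A : Set} {f : A → A} → (∀ x → f x ≡ x) → ∀ m → Maybe.map f m ≡ m
  map-id′ eq (just x) = cong just (eq x)
  map-id′ eq nothing  = refl

  map-∘′ : ∀ {A B C : Set} (g : B → C) (f : A → B) →
           ∀ m → Maybe.map g (Maybe.map f m) ≡ Maybe.map (g ∘ f) m
  map-∘′ g f (just x) = refl
  map-∘′ g f nothing  = refl

  infix 4 _≈ᴬ_

  _≈ᴬ_ : Automorphism G → Automorphism G → Set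
  π ≈ᴬ σ = (onV π Perm.≈ onV σ) × (onD π Perm.≈ onD σ)

  idᴬ : Automorphism G
  idᴬ = record
    { onV     = Perm.id
    ; onD     = Perm.id
    ; ι-comm  = λ d → sym (map-id′ (λ _ → refl) (ι d))
    ; ƛ-comm  = λ _ → refl
    ; colour≡ = λ _ → refl
    ; label≡  = λ _ → refl
    }

  _∘ᴬ_ : Automorphism G → Automorphism G → Automorphism G
  π ∘ᴬ σ = record
    { onV     = onV σ ∘ₚ onV π
    ; onD     = onD σ ∘ₚ onD π
    ; ι-comm  = λ d → trans (ι-comm π _)
                  (trans (cong (Maybe.map (onV π ⟨$⟩ʳ_)) (ι-comm σ d)) (map-∘′ _ _ (ι d)))
    ; ƛ-comm  = λ d → trans (ƛ-comm π _) (cong (onD π ⟨$⟩ʳ_) (ƛ-comm σ d))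
    ; colour≡ = λ d → trans (colour≡ π _) (colour≡ σ d)
    ; label≡  = λ d → trans (label≡ π _) (label≡ σ d)
    }

  _⁻¹ᴬ : Automorphism G → Automorphism G
  π ⁻¹ᴬ = record
    { onV     = Perm.flip (onV π)
    ; onD     = Perm.flip (onD π)
    ; ι-comm  = λ d → trans (sym (map-id′ (λ _ → Perm.inverseˡ (onV π)) (ι (onD π ⟨$⟩ˡ d))))
                  (trans (sym (map-∘′ _ _ (ι (onD π ⟨$⟩ˡ d))))
                  (cong (Maybe.map (onV π ⟨$⟩ˡ_)) (back ι (sym ∘ ι-comm π) d)))
    ; ƛ-comm  = λ d → trans (sym (Perm.inverseˡ (onD π)))
                  (cong (onD π ⟨$⟩ˡ_) (back ƛ (sym ∘ ƛ-comm π) d))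
    ; colour≡ = back colour (sym ∘ colour≡ π)
    ; label≡  = back label (sym ∘ label≡ π)
    }
    where
    back : ∀ {A : Set} {g : Dart → A} (f : Dart → A) → (∀ d → g d ≡ f (onD π ⟨$⟩ʳ d)) →
           ∀ d → g (onD π ⟨$⟩ˡ d) ≡ f d
    back f eq d = trans (eq _) (cong f (Perm.inverseʳ (onD π)))

Aut : Graph → Group 0ℓ 0ℓ
Aut G = record
  { Carrier = Automorphism G
  ; _≈_     = _≈ᴬ_
  ; _∙_     = _∘ᴬ_
  ; ε       = idᴬ
  ; _⁻¹     = _⁻¹ᴬ
  ; isGroup = record
    { isMonoid = record
      { isSemigroup = record
        { isMagma = record
          { isEquivalence = record
            { refl  = (λ _ → refl) , (λ _ → refl)
            ; sym   = λ (p , q) → (λ v → sym (p v)) , (λ d → sym (q d))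
            ; trans = λ (p , q) (p′ , q′) →
                (λ v → trans (p v) (p′ v)) , (λ d → trans (q d) (q′ d))
            }
          ; ∙-cong = λ {π} {π′} {σ} {σ′} (p , q) (p′ , q′) →
              (λ v → trans (cong (onV π ⟨$⟩ʳ_) (p′ v)) (p _)) ,
              (λ d → trans (cong (onD π ⟨$⟩ʳ_) (q′ d)) (q _))
          }
        ; assoc = λ _ _ _ → (λ _ → refl) , (λ _ → refl)
        }
      ; identity = (λ _ → (λ _ → refl) , (λ _ → refl)) , (λ _ → (λ _ → refl) , (λ _ → refl))
      }
    ; inverse = (λ π → (λ _ → Perm.inverseˡ (onV π)) , (λ _ → Perm.inverseˡ (onD π)))
              , (λ π → (λ _ → Perm.inverseʳ (onV π)) , (λ _ → Perm.inverseʳ (onD π)))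
    ; ⁻¹-cong = λ {π} {σ} (p , q) → inv (onV π) (onV σ) p , inv (onD π) (onD σ) q
    }
  }
  where
  open Automorphism
  inv : ∀ {n} (π σ : Permutation′ n) → π Perm.≈ σ → Perm.flip π Perm.≈ Perm.flip σ
  inv π σ p i = trans (cong (π ⟨$⟩ˡ_) (sym (trans (p _) (Perm.inverseʳ σ)))) (Perm.inverseˡ π)

record NormalSubgroup {c ℓ} (𝒢 : Group c ℓ) : Set (c ⊔ lsuc ℓ) where
  open Group 𝒢
  field
    Member    : Pred Carrier ℓ
    resp      : ∀ {x y} → x ≈ y → Member x → Member y
    ε-closed  : Member ε
    ∙-closed  : ∀ {x y} → Member x → Member y → Member (x ∙ y)
    ⁻¹-closed : ∀ {x} → Member x → Member (x ⁻¹)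
    normal    : ∀ g {x} → Member x → Member (g ⁻¹ ∙ x ∙ g)

-- The elements of the quotient are those of 𝒢, with x and y identified when
-- they lie in the same left coset.
_/_ : ∀ {c ℓ} (𝒢 : Group c ℓ) → NormalSubgroup 𝒢 → Group c ℓ
𝒢 / N = record
  { Carrier = Carrier
  ; _≈_     = _∼_
  ; _∙_     = _∙_
  ; ε       = ε
  ; _⁻¹     = _⁻¹
  ; isGroup = record
    { isMonoid = record
      { isSemigroup = record
        { isMagma = record
          { isEquivalence = record
            { refl  = ≈⇒∼ Eq.refl
            ; sym   = λ {x} {y} p → resp (Eq.trans (⁻¹-anti-homo-∙ (x ⁻¹) y)
                        (∙-congˡ (⁻¹-involutive x))) (⁻¹-closed p)
            ; trans = λ {x} {y} {z} p q → resp (cancel x y z) (∙-closed p q)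
            }
          ; ∙-cong = λ {x} {y} {u} {v} p q → resp (product x y u v) (∙-closed (normal u p) q)
          }
        ; assoc = λ x y z → ≈⇒∼ (assoc x y z)
        }
      ; identity = (λ x → ≈⇒∼ (identityˡ x)) , (λ x → ≈⇒∼ (identityʳ x))
      }
    ; inverse = (λ x → ≈⇒∼ (inverseˡ x)) , (λ x → ≈⇒∼ (inverseʳ x))
    ; ⁻¹-cong = λ {x} {y} p → resp (inverted x y) (normal (x ⁻¹) (⁻¹-closed p))
    }
  }
  where
  open Group 𝒢 hiding (refl; sym; trans)
  module Eq = Group 𝒢 using (refl; sym; trans)
  open GroupProperties 𝒢
  open NormalSubgroup N
  open SetoidReasoning setoid

  _∼_ : Carrier → Carrier → Set _
  x ∼ y = Member (x ⁻¹ ∙ y)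

  ≈⇒∼ : ∀ {x y} → x ≈ y → x ∼ y
  ≈⇒∼ {x} {y} p = resp (Eq.trans (Eq.sym (inverseˡ x)) (∙-congˡ p)) ε-closed

  cancel : ∀ x y z → (x ⁻¹ ∙ y) ∙ (y ⁻¹ ∙ z) ≈ x ⁻¹ ∙ z
  cancel x y z = begin
    (x ⁻¹ ∙ y) ∙ (y ⁻¹ ∙ z)  ≈⟨ assoc _ _ _ ⟩
    x ⁻¹ ∙ (y ∙ (y ⁻¹ ∙ z))  ≈⟨ ∙-congˡ (assoc _ _ _) ⟨
    x ⁻¹ ∙ ((y ∙ y ⁻¹) ∙ z)  ≈⟨ ∙-congˡ (∙-congʳ (inverseʳ y)) ⟩
    x ⁻¹ ∙ (ε ∙ z)           ≈⟨ ∙-congˡ (identityˡ z) ⟩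
    x ⁻¹ ∙ z                 ∎

  product : ∀ x y u v → (u ⁻¹ ∙ (x ⁻¹ ∙ y) ∙ u) ∙ (u ⁻¹ ∙ v) ≈ (x ∙ u) ⁻¹ ∙ (y ∙ v)
  product x y u v = begin
    (u ⁻¹ ∙ (x ⁻¹ ∙ y) ∙ u) ∙ (u ⁻¹ ∙ v)  ≈⟨ assoc _ _ _ ⟩
    (u ⁻¹ ∙ (x ⁻¹ ∙ y)) ∙ (u ∙ (u ⁻¹ ∙ v)) ≈⟨ ∙-congˡ (assoc _ _ _) ⟨
    (u ⁻¹ ∙ (x ⁻¹ ∙ y)) ∙ ((u ∙ u ⁻¹) ∙ v) ≈⟨ ∙-congˡ (∙-congʳ (inverseʳ u)) ⟩
    (u ⁻¹ ∙ (x ⁻¹ ∙ y)) ∙ (ε ∙ v)         ≈⟨ ∙-congˡ (identityˡ v) ⟩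
    (u ⁻¹ ∙ (x ⁻¹ ∙ y)) ∙ v               ≈⟨ ∙-congʳ (assoc _ _ _) ⟨
    ((u ⁻¹ ∙ x ⁻¹) ∙ y) ∙ v               ≈⟨ assoc _ _ _ ⟩
    (u ⁻¹ ∙ x ⁻¹) ∙ (y ∙ v)               ≈⟨ ∙-congʳ (⁻¹-anti-homo-∙ x u) ⟨
    (x ∙ u) ⁻¹ ∙ (y ∙ v)                  ∎

  inverted : ∀ x y → (x ⁻¹) ⁻¹ ∙ (x ⁻¹ ∙ y) ⁻¹ ∙ x ⁻¹ ≈ (x ⁻¹) ⁻¹ ∙ y ⁻¹
  inverted x y = begin
    (x ⁻¹) ⁻¹ ∙ (x ⁻¹ ∙ y) ⁻¹ ∙ x ⁻¹          ≈⟨ ∙-congʳ (∙-congˡ (⁻¹-anti-homo-∙ (x ⁻¹) y)) ⟩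
    (x ⁻¹) ⁻¹ ∙ (y ⁻¹ ∙ (x ⁻¹) ⁻¹) ∙ x ⁻¹     ≈⟨ assoc _ _ _ ⟩
    (x ⁻¹) ⁻¹ ∙ ((y ⁻¹ ∙ (x ⁻¹) ⁻¹) ∙ x ⁻¹)   ≈⟨ ∙-congˡ (assoc _ _ _) ⟩
    (x ⁻¹) ⁻¹ ∙ (y ⁻¹ ∙ ((x ⁻¹) ⁻¹ ∙ x ⁻¹))   ≈⟨ ∙-congˡ (∙-congˡ (inverseˡ (x ⁻¹))) ⟩
    (x ⁻¹) ⁻¹ ∙ (y ⁻¹ ∙ ε)                    ≈⟨ ∙-congˡ (identityʳ (y ⁻¹)) ⟩
    (x ⁻¹) ⁻¹ ∙ y ⁻¹                          ∎

module _ {c ℓ} (𝒢 ℋ : Group c ℓ) where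
  open GroupMorphisms (Group.rawGroup 𝒢) (Group.rawGroup ℋ)

  infix 4 _≅_

  _≅_ : Set (c ⊔ ℓ)
  _≅_ = ∃ IsGroupIsomorphism

  Ker : (φ : Group.Carrier 𝒢 → Group.Carrier ℋ) → IsGroupHomomorphism φ → NormalSubgroup 𝒢
  Ker φ hom = record
    { Member    = λ x → φ x ≈ ε
    ; resp      = λ p q → Eq.trans (⟦⟧-cong (Group.sym 𝒢 p)) q
    ; ε-closed  = ε-homo
    ; ∙-closed  = λ p q → Eq.trans (homo _ _) (Eq.trans (∙-cong p q) (identityˡ ε))
    ; ⁻¹-closed = λ p → Eq.trans (⁻¹-homo _) (Eq.trans (⁻¹-cong p) ε⁻¹≈ε)
    ; normal    = λ g {x} p → begin
        φ ((g 𝒢.⁻¹) 𝒢.∙ x 𝒢.∙ g)    ≈⟨ homo _ _ ⟩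
        φ ((g 𝒢.⁻¹) 𝒢.∙ x) ∙ φ g    ≈⟨ ∙-congʳ (homo _ _) ⟩
        φ (g 𝒢.⁻¹) ∙ φ x ∙ φ g      ≈⟨ ∙-congʳ (∙-cong (⁻¹-homo g) p) ⟩
        φ g ⁻¹ ∙ ε ∙ φ g            ≈⟨ ∙-congʳ (identityʳ _) ⟩
        φ g ⁻¹ ∙ φ g                ≈⟨ inverseˡ _ ⟩
        ε                           ∎
    }
    where
    module 𝒢 = Group 𝒢
    open Group ℋ hiding (refl; sym; trans)
    module Eq = Group ℋ using (refl; sym; trans)
    open GroupProperties ℋ
    open IsGroupHomomorphism hom
    open SetoidReasoning setoid

module _ {G : Graph} (π : Automorphism G) where
  open Graph G
  open Automorphism π

  imageV : Subset #V → Subset #V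
  imageV X = tabulate (λ v → lookup X (onV ⟨$⟩ˡ v))

  imageD : Subset #D → Subset #D
  imageD Y = tabulate (λ d → lookup Y (onD ⟨$⟩ˡ d))

  imagePart : Part G → Part G
  imagePart (part (region X Y) Z) = part (region (imageV X) (imageD Y)) (imageV Z)

module _ {G H : Graph} {c : Node G} (R : Reduction G c H) where
  open Reduction R
  open Automorphism

  -- φ is the automorphism of H determined by the automorphism π of G.  The
  -- equation between ends says that the dart of e_A at u is mapped to the
  -- dart of e_π(A) at π(u), and the free dart of a pendant edge to the free
  -- dart.
  record Induces (π : Automorphism G) (φ : Automorphism H) : Set where
    field
      on-vertices  : ∀ w → originV (onV φ ⟨$⟩ʳ w) ≡ onV π ⟨$⟩ʳ originV w
      on-old-darts : ∀ {e d} → originD e ≡ inj₁ d →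
                     originD (onD φ ⟨$⟩ʳ e) ≡ inj₁ (onD π ⟨$⟩ʳ d)
      on-new-darts : ∀ {e a b} → originD e ≡ inj₂ (a , b) →
                     ∃₂ λ a′ b′ →
                       originD (onD φ ⟨$⟩ʳ e) ≡ inj₂ (a′ , b′) ×
                       atom a′ ≡ imagePart π (atom a) ×
                       endAt (ends a′) b′ ≡ Maybe.map (onV π ⟨$⟩ʳ_) (endAt (ends a) b)

  open GroupMorphisms (Group.rawGroup (Aut G)) (Group.rawGroup (Aut H))

  record ReductionEpimorphism : Set where
    field
      Φ                   : Automorphism G → Automorphism H
      isGroupHomomorphism : IsGroupHomomorphism Φ
      surjective          : Surjective _≈ᴬ_ _≈ᴬ_ Φ
      induces             : ∀ π → Induces π (Φ π)

    Kernel : NormalSubgroup (Aut G)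
    Kernel = Ker (Aut G) (Aut H) Φ isGroupHomomorphism

{-# OPTIONS --safe #-}

-- The isomorphism is the first isomorphism theorem for Φᵢ; the work lies in the existence
-- of Φᵢ.  Being defined from the incidence structure and the centre alone, the atoms are
-- permuted by every automorphism fixing the centre, which yields Φᵢ, determined by its
-- action on origins.  Conversely, φ ∈ Aut(Gᵢ₊₁) permutes the edges e_A, as their colours are
-- new, and equal colours provide ∂-isomorphisms between the atoms; the edge types allow
-- to choose them compatibly with φ on the boundaries.  Since the interiors of distinct atoms
-- are disjoint, they can be glued with φ to a preimage of φ.  The preimages also show that
-- automorphisms of Gᵢ₊₁ fix the image of the centre as soon as those of Gᵢ fix the centre.
module Submission where

-- Disjointness of interiors is not derived from minimality alone. It rests on the fact that the
-- boundary of an atom never meets the interior of an atom, and this comes from the reduction: a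
-- boundary vertex is an end of a new edge, hence a surviving vertex. Given this, two overlapping
-- atoms are compared kind by kind, mostly by showing that one body contains the other. As
-- 2-connectedness is defined by a negation and subtrees by quantification over all walks, some
-- comparisons yield only a double negation; it disappears once atoms are replaced by their indices,
-- whose equality is decidable. When the interiors are glued, an isomorphism that reverses the ends
-- of an atom can be repaired unless the edge is directed, and in that case it would force a dart
-- and its mate to carry the same label. A lift uses only the data of the reduction, whether or not
-- φ fixes the image of the centre. This is what keeps the induction over the centres free of
-- circularity.

open import Defs
open import Algebra.Bundles using (Group)
open import Algebra.Morphism.Structures using (module GroupMorphisms)
import Algebra.Properties.Group as GroupProperties
open import Data.Bool.Base using (Bool; true; false; not; if_then_else_)
import Data.Bool.Properties as Bool
open import Data.Empty using (⊥; ⊥-elim)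
open import Data.Fin.Base using (Fin; zero; suc; inject₁; punchOut)
open import Data.Fin.Induction using (<-weakInduction)
open import Data.Fin.Permutation as Perm using (Permutation′; _⟨$⟩ʳ_; _⟨$⟩ˡ_; _∘ₚ_)
import Data.Fin.Properties as Fin
open import Data.Fin.Subset
  using (Subset; inside; outside; ⊤; ⁅_⁆; _∈_; _∉_; _⊆_; _∩_; _∪_; ∣_∣; _─_; Nonempty)
open import Data.Fin.Subset.Properties
  using (_∈?_; ⊆-antisym; x∈⁅x⁆; x∈⁅y⁆⇒x≡y; x∈p∪q⁺; x∈p∪q⁻; ∪-comm; p─q⊆p; x∈p∧x∉q⇒x∈p─q; ∈⊤)
open import Data.List.Base as List using ([]; _∷_)
import Data.List.Membership.DecPropositional as DecMembership
import Data.List.Membership.Propositional as List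
open import Data.List.Membership.Propositional.Properties using (∈-map⁻)
open import Data.List.Relation.Unary.Any using (here; there)
open import Data.Maybe.Base as Maybe using (Maybe; just; nothing)
open import Data.Maybe.Properties using (just-injective; ≡-dec; map-cong)
open import Data.Nat.Base using (ℕ; suc; _≤_; _≥_)
import Data.Nat.Properties as ℕ
open import Algebra.Properties.CommutativeMonoid.Sum ℕ.+-0-commutativeMonoid
  using (sum; sum-permute; sum-cong-≗)
open import Data.Product.Base using (Σ-syntax; ∃-syntax; ∃₂; _×_; _,_; proj₁; proj₂)
open import Data.Sum.Base as Sum using (_⊎_; inj₁; inj₂)
open import Data.Sum.Properties using (inj₁-injective; inj₂-injective)
open import Data.Vec.Base using ([]; _∷_; here; there; lookup; tabulate; zipWith)
open import Data.Vec.Properties using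
  ( lookup∘tabulate; tabulate∘lookup; tabulate-cong; lookup-zipWith; lookup⇒[]=; []=⇒lookup )
  renaming (≡-dec to ≡-decᵛ)
open import Function.Base using (_∘_; id)
open import Function.Bundles using (_⇔_; mk⇔; Equivalence)
open import Function.Definitions using (Injective; Surjective)
import Relation.Binary.Construct.Closure.Equivalence as Eq
open import Relation.Binary.Construct.Closure.ReflexiveTransitive using (_◅_) renaming (ε to done)
open import Relation.Binary.Construct.Closure.Symmetric using (fwd; bwd)
open import Relation.Binary.PropositionalEquality
  using (_≡_; _≢_; refl; sym; trans; cong; cong₂; subst; subst₂)
open import Relation.Nullary using (¬_; Dec; yes; no; does)
open import Relation.Nullary.Decidable using (dec-true; decidable-stable; map′; _×-dec_)
open import Relation.Nullary.Negation using (contradiction)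

open Equivalence using (to; from)
open Region
open Part

-- Subsets under permutations

x∈p─q⇒x∉q : ∀ {n} {x : Fin n} (p q : Subset n) → x ∈ p ─ q → x ∉ q
x∈p─q⇒x∉q (_ ∷ p) (outside ∷ q) (there h) (there k) = x∈p─q⇒x∉q p q h k
x∈p─q⇒x∉q (_ ∷ p) (inside  ∷ q) (there h) (there k) = x∈p─q⇒x∉q p q h k

∈-pair⁻ : ∀ {n} {x u v : Fin n} → x ∈ ⁅ u ⁆ ∪ ⁅ v ⁆ → x ≡ u ⊎ x ≡ v
∈-pair⁻ {u = u} {v} = Sum.map (x∈⁅y⁆⇒x≡y u) (x∈⁅y⁆⇒x≡y v) ∘ x∈p∪q⁻ ⁅ u ⁆ ⁅ v ⁆

∈-pairˡ : ∀ {n} (u v : Fin n) → u ∈ ⁅ u ⁆ ∪ ⁅ v ⁆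
∈-pairˡ u v = x∈p∪q⁺ {q = ⁅ v ⁆} (inj₁ (x∈⁅x⁆ u))

∈-pairʳ : ∀ {n} (u v : Fin n) → v ∈ ⁅ u ⁆ ∪ ⁅ v ⁆
∈-pairʳ u v = x∈p∪q⁺ {p = ⁅ u ⁆} (inj₂ (x∈⁅x⁆ v))

map-just⁻ : ∀ {A B : Set} {f : A → B} → Injective _≡_ _≡_ f →
            ∀ m {x} → Maybe.map f m ≡ just (f x) → m ≡ just x
map-just⁻ inj (just y) eq = cong just (inj (just-injective eq))

-- Definitionally both `imageV` and `imageD`, so that vertices and darts share one set of lemmas.
permute : ∀ {n} → Permutation′ n → Subset n → Subset n
permute ρ X = tabulate (λ v → lookup X (ρ ⟨$⟩ˡ v))

module _ {n : ℕ} (ρ : Permutation′ n) where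

  lookup-permute : ∀ X v → lookup (permute ρ X) v ≡ lookup X (ρ ⟨$⟩ˡ v)
  lookup-permute X = lookup∘tabulate (λ v → lookup X (ρ ⟨$⟩ˡ v))

  ∈-permute⁺ : ∀ {X v} → v ∈ X → ρ ⟨$⟩ʳ v ∈ permute ρ X
  ∈-permute⁺ {X} {v} v∈X = lookup⇒[]= _ _
    (trans (lookup-permute X _) (trans (cong (lookup X) (Perm.inverseˡ ρ)) ([]=⇒lookup v∈X)))

  ∈-permute⁻ : ∀ X {v} → v ∈ permute ρ X → ∃[ w ] (w ∈ X × v ≡ ρ ⟨$⟩ʳ w)
  ∈-permute⁻ X {v} v∈ = ρ ⟨$⟩ˡ v
    , lookup⇒[]= _ _ (trans (sym (lookup-permute X v)) ([]=⇒lookup v∈))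
    , sym (Perm.inverseʳ ρ)

  permute-injective : ∀ {v w} → ρ ⟨$⟩ʳ v ≡ ρ ⟨$⟩ʳ w → v ≡ w
  permute-injective eq =
    trans (sym (Perm.inverseˡ ρ)) (trans (cong (ρ ⟨$⟩ˡ_) eq) (Perm.inverseˡ ρ))

  ∈-permute⁻′ : ∀ X {v} → ρ ⟨$⟩ʳ v ∈ permute ρ X → v ∈ X
  ∈-permute⁻′ X v∈ with w , w∈ , eq ← ∈-permute⁻ X v∈ =
    subst (_∈ X) (sym (permute-injective eq)) w∈

  -- As ρ is onto, it suffices to test membership at points of the form ρ v. Most images of concrete
  -- sets are computed in this way.
  permute-unique : ∀ X Y → (∀ {v} → v ∈ X → ρ ⟨$⟩ʳ v ∈ Y) → (∀ {v} → ρ ⟨$⟩ʳ v ∈ Y → v ∈ X) →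
                   permute ρ X ≡ Y
  permute-unique X Y ⊆Y Y⊆ = ⊆-antisym forth back
    where
    forth : permute ρ X ⊆ Y
    forth v∈ with w , w∈ , refl ← ∈-permute⁻ X v∈ = ⊆Y w∈
    back : Y ⊆ permute ρ X
    back {v} v∈ = subst (_∈ permute ρ X) (Perm.inverseʳ ρ)
      (∈-permute⁺ (Y⊆ (subst (_∈ Y) (sym (Perm.inverseʳ ρ)) v∈)))

  -- Kept general in `f` because union, intersection and difference of subsets are all instances.
  permute-zipWith : ∀ f X Y → permute ρ (zipWith f X Y) ≡ zipWith f (permute ρ X) (permute ρ Y)
  permute-zipWith f X Y = trans (tabulate-cong pointwise) (tabulate∘lookup _)
    where
    pointwise : ∀ v → lookup (zipWith f X Y) (ρ ⟨$⟩ˡ v) ≡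
                      lookup (zipWith f (permute ρ X) (permute ρ Y)) v
    pointwise v = trans (lookup-zipWith f _ X Y) (sym (trans
      (lookup-zipWith f v (permute ρ X) (permute ρ Y))
      (cong₂ f (lookup-permute X v) (lookup-permute Y v))))

  permute-⁅⁆ : ∀ v → permute ρ ⁅ v ⁆ ≡ ⁅ ρ ⟨$⟩ʳ v ⁆
  permute-⁅⁆ v = permute-unique ⁅ v ⁆ _
    (λ { {w} w∈ → subst (_∈ ⁅ ρ ⟨$⟩ʳ v ⁆) (sym (cong (ρ ⟨$⟩ʳ_) (x∈⁅y⁆⇒x≡y v w∈))) (x∈⁅x⁆ _) })
    (λ { {w} w∈ → subst (_∈ ⁅ v ⁆) (sym (permute-injective (x∈⁅y⁆⇒x≡y _ w∈))) (x∈⁅x⁆ _) })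

  permute-pair : ∀ u v → permute ρ (⁅ u ⁆ ∪ ⁅ v ⁆) ≡ ⁅ ρ ⟨$⟩ʳ u ⁆ ∪ ⁅ ρ ⟨$⟩ʳ v ⁆
  permute-pair u v =
    trans (permute-zipWith _ ⁅ u ⁆ ⁅ v ⁆) (cong₂ _∪_ (permute-⁅⁆ u) (permute-⁅⁆ v))

  permute-⊤ : permute ρ ⊤ ≡ ⊤
  permute-⊤ = permute-unique ⊤ ⊤ (λ _ → ∈⊤) (λ _ → ∈⊤)

permute-flip : ∀ {n} (ρ : Permutation′ n) X → permute ρ (permute (Perm.flip ρ) X) ≡ X
permute-flip ρ X = permute-unique ρ (permute (Perm.flip ρ) X) X
  (λ {v} v∈ → let w , w∈ , eq = ∈-permute⁻ (Perm.flip ρ) X v∈ in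
    subst (_∈ X) (sym (trans (cong (ρ ⟨$⟩ʳ_) eq) (Perm.inverseʳ ρ))) w∈)
  (λ {v} v∈ → subst (_∈ permute (Perm.flip ρ) X) (Perm.inverseˡ ρ) (∈-permute⁺ (Perm.flip ρ) v∈))

-- Cardinality as a sum of indicators, to which the invariance of finite sums under permutations
-- applies.
∣∣≡sum : ∀ {n} (X : Subset n) → ∣ X ∣ ≡ sum (λ i → if lookup X i then 1 else 0)
∣∣≡sum []            = refl
∣∣≡sum (inside  ∷ X) = cong suc (∣∣≡sum X)
∣∣≡sum (outside ∷ X) = ∣∣≡sum X

∣permute∣ : ∀ {n} (ρ : Permutation′ n) X → ∣ permute ρ X ∣ ≡ ∣ X ∣
∣permute∣ ρ X = trans (∣∣≡sum (permute ρ X)) (trans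
  (sum-cong-≗ (λ i → cong (if_then 1 else 0) (lookup-permute ρ X i)))
  (sym (trans (∣∣≡sum X) (sum-permute (λ i → if lookup X i then 1 else 0) (Perm.flip ρ)))))


permute-cong : ∀ {n} {ρ σ : Permutation′ n} → ρ Perm.≈ σ → ∀ X → permute ρ X ≡ permute σ X
permute-cong {ρ = ρ} {σ} eq X = permute-unique ρ X (permute σ X)
  (λ {v} v∈ → subst (_∈ permute σ X) (sym (eq v)) (∈-permute⁺ σ v∈))
  (λ {v} v∈ → ∈-permute⁻′ σ X (subst (_∈ permute σ X) (eq v) v∈))

permute-∘ : ∀ {n} (ρ σ : Permutation′ n) X → permute (σ ∘ₚ ρ) X ≡ permute ρ (permute σ X)
permute-∘ ρ σ X = permute-unique (σ ∘ₚ ρ) X (permute ρ (permute σ X))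
  (∈-permute⁺ ρ ∘ ∈-permute⁺ σ) (∈-permute⁻′ σ X ∘ ∈-permute⁻′ ρ (permute σ X))

-- Invariance under automorphisms

imageRegion : {G : Graph} → Automorphism G → Region G → Region G
imageRegion π A = region (imageV π (verts A)) (imageD π (darts A))

module _ {G : Graph} where
  open Graph G
  open Automorphism

  infixr 8 _·ᴱ_

  _·ᴱ_ : Automorphism G → Element {G} → Element {G}
  π ·ᴱ x = Sum.map (onV π ⟨$⟩ʳ_) (onD π ⟨$⟩ʳ_) x

  imageNode : Automorphism G → Node G → Node G
  imageNode π (art v) = art (onV π ⟨$⟩ʳ v)
  imageNode π (blk B) = blk (imageRegion π B)

  region-≡ : {A B : Region G} → A ⊑ B → B ⊑ A → A ≡ B
  region-≡ (p , q) (p′ , q′) = cong₂ region (⊆-antisym p p′) (⊆-antisym q q′)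

  ⊑-trans : {A B C : Region G} → A ⊑ B → B ⊑ C → A ⊑ C
  ⊑-trans (p , q) (p′ , q′) = p′ ∘ p , q′ ∘ q

  ⊑⇒∈ : {A B : Region G} → A ⊑ B → ∀ x → x ∈ᴿ A → x ∈ᴿ B
  ⊑⇒∈ (p , q) (inj₁ v) = p
  ⊑⇒∈ (p , q) (inj₂ d) = q

  imageRegion-inverse : ∀ (π : Automorphism G) A → imageRegion π (imageRegion (π ⁻¹ᴬ) A) ≡ A
  imageRegion-inverse π A =
    cong₂ region (permute-flip (onV π) (verts A)) (permute-flip (onD π) (darts A))

  imageRegion-inverse′ : ∀ (π : Automorphism G) A → imageRegion (π ⁻¹ᴬ) (imageRegion π A) ≡ A
  imageRegion-inverse′ π A = cong₂ region
    (permute-flip (Perm.flip (onV π)) (verts A)) (permute-flip (Perm.flip (onD π)) (darts A))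

  imagePart-inverse′ : ∀ (π : Automorphism G) P → imagePart (π ⁻¹ᴬ) (imagePart π P) ≡ P
  imagePart-inverse′ π P = cong₂ part
    (imageRegion-inverse′ π (body P)) (permute-flip (Perm.flip (onV π)) (boundary P))

  imageRegion-injective : ∀ (π : Automorphism G) {A B} → imageRegion π A ≡ imageRegion π B → A ≡ B
  imageRegion-injective π {A} {B} eq = trans (sym (imageRegion-inverse′ π A))
    (trans (cong (imageRegion (π ⁻¹ᴬ)) eq) (imageRegion-inverse′ π B))

  imageNode-inverse : ∀ (π : Automorphism G) x → imageNode π (imageNode (π ⁻¹ᴬ) x) ≡ x
  imageNode-inverse π (art v) = cong art (Perm.inverseʳ (onV π))
  imageNode-inverse π (blk B) = cong blk (imageRegion-inverse π B)

  imageNode-inverse′ : ∀ (π : Automorphism G) x → imageNode (π ⁻¹ᴬ) (imageNode π x) ≡ x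
  imageNode-inverse′ π (art v) = cong art (Perm.inverseˡ (onV π))
  imageNode-inverse′ π (blk B) = cong blk (imageRegion-inverse′ π B)

  ·ᴱ-inverse′ : ∀ (π : Automorphism G) x → π ⁻¹ᴬ ·ᴱ π ·ᴱ x ≡ x
  ·ᴱ-inverse′ π (inj₁ v) = cong inj₁ (Perm.inverseˡ (onV π))
  ·ᴱ-inverse′ π (inj₂ d) = cong inj₂ (Perm.inverseˡ (onD π))

  imageRegion-∖ : ∀ (π : Automorphism G) A X → imageRegion π (A ∖ X) ≡ imageRegion π A ∖ imageV π X
  imageRegion-∖ π A X = cong (λ Y → region Y _) (permute-zipWith (onV π) _ (verts A) X)

  imageD-edge : ∀ (π : Automorphism G) d → imageD π (edge {G} d) ≡ edge {G} (onD π ⟨$⟩ʳ d)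
  imageD-edge π d = trans (permute-pair (onD π) d (ƛ d))
    (cong (λ e → ⁅ onD π ⟨$⟩ʳ d ⁆ ∪ ⁅ e ⁆) (sym (ƛ-comm π d)))

  imageRegion-whole : ∀ (π : Automorphism G) → imageRegion π (whole G) ≡ whole G
  imageRegion-whole π = cong₂ region (permute-⊤ (onV π)) (permute-⊤ (onD π))

  ∈-imageRegion⁺ : ∀ (π : Automorphism G) {A} x → x ∈ᴿ A → π ·ᴱ x ∈ᴿ imageRegion π A
  ∈-imageRegion⁺ π (inj₁ v) = ∈-permute⁺ (onV π)
  ∈-imageRegion⁺ π (inj₂ d) = ∈-permute⁺ (onD π)

  ∈-imageRegion⁻ : ∀ (π : Automorphism G) A y → y ∈ᴿ imageRegion π A → ∃[ x ] (x ∈ᴿ A × y ≡ π ·ᴱ x)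
  ∈-imageRegion⁻ π A (inj₁ v) v∈ with w , w∈ , eq ← ∈-permute⁻ (onV π) (verts A) v∈ =
    inj₁ w , w∈ , cong inj₁ eq
  ∈-imageRegion⁻ π A (inj₂ d) d∈ with e , e∈ , eq ← ∈-permute⁻ (onD π) (darts A) d∈ =
    inj₂ e , e∈ , cong inj₂ eq

  ⊑-image : ∀ (π : Automorphism G) {A B} → A ⊑ B → imageRegion π A ⊑ imageRegion π B
  ⊑-image π {A} {B} (p , q) = vs , ds
    where
    vs : verts (imageRegion π A) ⊆ verts (imageRegion π B)
    vs v∈ with w , w∈ , refl ← ∈-permute⁻ (onV π) (verts A) v∈ = ∈-permute⁺ (onV π) (p w∈)
    ds : darts (imageRegion π A) ⊆ darts (imageRegion π B)
    ds d∈ with e , e∈ , refl ← ∈-permute⁻ (onD π) (darts A) d∈ = ∈-permute⁺ (onD π) (q e∈)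

  Invariant : (Region G → Set) → Set
  Invariant P = ∀ (π : Automorphism G) A → P A → P (imageRegion π A)

  -- The inverse of π is an automorphism too, so preservation already contains reflection. Negated
  -- conditions on parts are transported by this direction.
  reflect : {P : Region G → Set} → Invariant P → ∀ (π : Automorphism G) A → P (imageRegion π A) → P A
  reflect {P} inv π A p = subst P (imageRegion-inverse′ π A) (inv (π ⁻¹ᴬ) (imageRegion π A) p)

  ι-just : ∀ (π : Automorphism G) {d v} → ι d ≡ just v → ι (onD π ⟨$⟩ʳ d) ≡ just (onV π ⟨$⟩ʳ v)
  ι-just π {d} eq = trans (ι-comm π d) (cong (Maybe.map (onV π ⟨$⟩ʳ_)) eq)

  ι-nothing : ∀ (π : Automorphism G) {d} → ι d ≡ nothing → ι (onD π ⟨$⟩ʳ d) ≡ nothing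
  ι-nothing π {d} eq = trans (ι-comm π d) (cong (Maybe.map (onV π ⟨$⟩ʳ_)) eq)

  ι-just⁻ : ∀ (π : Automorphism G) {d v} → ι (onD π ⟨$⟩ʳ d) ≡ just (onV π ⟨$⟩ʳ v) → ι d ≡ just v
  ι-just⁻ π {d} eq = map-just⁻ (permute-injective (onV π)) (ι d) (trans (sym (ι-comm π d)) eq)

  image-step : ∀ (π : Automorphism G) {A x y} → Step A x y → Step (imageRegion π A) (π ·ᴱ x) (π ·ᴱ y)
  image-step π {A} (mate {d} d∈ ƛd∈) =
    subst (λ e → Step (imageRegion π A) (inj₂ (onD π ⟨$⟩ʳ d)) (inj₂ e)) (ƛ-comm π d)
      (mate (∈-permute⁺ (onD π) d∈)
            (subst (_∈ imageD π (darts A)) (sym (ƛ-comm π d)) (∈-permute⁺ (onD π) ƛd∈)))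
  image-step π (end d∈ v∈ eq) =
    end (∈-permute⁺ (onD π) d∈) (∈-permute⁺ (onV π) v∈) (ι-just π eq)

  image-linked : ∀ (π : Automorphism G) {A x y} → Linked A x y → Linked (imageRegion π A) (π ·ᴱ x) (π ·ᴱ y)
  image-linked π = Eq.gmap (π ·ᴱ_) (image-step π)

  reflect-linked : ∀ (π : Automorphism G) A {x y} → Linked (imageRegion π A) (π ·ᴱ x) (π ·ᴱ y) → Linked A x y
  reflect-linked π A {x} {y} l = subst₂ (Linked A) (·ᴱ-inverse′ π x) (·ᴱ-inverse′ π y)
    (subst (λ B → Linked B _ _) (imageRegion-inverse′ π A) (image-linked (π ⁻¹ᴬ) l))

  image-connected : Invariant Connected
  image-connected π A ((x , x∈) , linked) = (π ·ᴱ x , ∈-imageRegion⁺ π x x∈) , linked′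
    where
    linked′ : ∀ x y → x ∈ᴿ imageRegion π A → y ∈ᴿ imageRegion π A → Linked (imageRegion π A) x y
    linked′ x y x∈ y∈
      with x′ , x′∈ , refl ← ∈-imageRegion⁻ π A x x∈
         | y′ , y′∈ , refl ← ∈-imageRegion⁻ π A y y∈ = image-linked π (linked x′ y′ x′∈ y′∈)

  image-disconnected : Invariant Disconnected
  image-disconnected π A (x , y , x∈ , y∈ , unlinked) =
    π ·ᴱ x , π ·ᴱ y , ∈-imageRegion⁺ π x x∈ , ∈-imageRegion⁺ π y y∈ , unlinked ∘ reflect-linked π A

  image-isSubgraph : Invariant IsSubgraph
  image-isSubgraph π A (ƛ-closed , ι-closed) = ƛ-closed′ , ι-closed′
    where
    ƛ-closed′ : ∀ d → d ∈ imageD π (darts A) → ƛ d ∈ imageD π (darts A)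
    ƛ-closed′ d d∈ with e , e∈ , refl ← ∈-permute⁻ (onD π) (darts A) d∈ =
      subst (_∈ imageD π (darts A)) (sym (ƛ-comm π e)) (∈-permute⁺ (onD π) (ƛ-closed e e∈))
    ι-closed′ : ∀ d v → d ∈ imageD π (darts A) → ι d ≡ just v → v ∈ imageV π (verts A)
    ι-closed′ d v d∈ eq with e , e∈ , refl ← ∈-permute⁻ (onD π) (darts A) d∈
      with ι e in ιe | trans (sym (ι-comm π e)) eq
    ... | just w | refl = ∈-permute⁺ (onV π) (ι-closed e w e∈ ιe)

  image-twoConnected : Invariant (TwoConnected G)
  image-twoConnected π A (sub , (u , v , u∈ , v∈ , u≢v) , conn , nocut) =
      image-isSubgraph π A sub
    , ( onV π ⟨$⟩ʳ u , onV π ⟨$⟩ʳ v , ∈-permute⁺ (onV π) u∈ , ∈-permute⁺ (onV π) v∈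
      , u≢v ∘ permute-injective (onV π))
    , image-connected π A conn
    , nocut′
    where
    nocut′ : ∀ v → v ∈ imageV π (verts A) → ¬ Disconnected (imageRegion π A ∖ ⁅ v ⁆)
    nocut′ v v∈ disc with w , w∈ , refl ← ∈-permute⁻ (onV π) (verts A) v∈ =
      nocut w w∈ (reflect image-disconnected π _ (subst Disconnected (sym
        (trans (imageRegion-∖ π A ⁅ w ⁆) (cong (imageRegion π A ∖_) (permute-⁅⁆ (onV π) w)))) disc))

  image-singlePendant : Invariant SinglePendantEdge
  image-singlePendant π _ (d , v , (ιd , ιƛd) , refl) =
      onD π ⟨$⟩ʳ d , onV π ⟨$⟩ʳ v
    , (ι-just π ιd , trans (cong ι (ƛ-comm π d)) (ι-nothing π ιƛd))
    , cong₂ region (permute-⁅⁆ (onV π) v) (imageD-edge π d)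

  image-singleFree : Invariant SingleFreeEdge
  image-singleFree π A (empty , d , refl) =
      (λ (v , v∈) → let w , w∈ , _ = ∈-permute⁻ (onV π) (verts A) v∈ in empty (w , w∈))
    , onD π ⟨$⟩ʳ d , imageD-edge π d

  -- Maximality speaks of all competitors `C`; a competitor of the image is pulled back by the
  -- inverse, compared with `B`, and pushed forward again.
  image-block : Invariant (Block G)
  image-block π B (maximal two max) = maximal (image-twoConnected π B two) λ C two′ B⊑C →
    trans (sym (imageRegion-inverse π C)) (cong (imageRegion π)
      (max (imageRegion (π ⁻¹ᴬ) C) (image-twoConnected (π ⁻¹ᴬ) C two′)
        (subst (_⊑ imageRegion (π ⁻¹ᴬ) C) (imageRegion-inverse′ π B) (⊑-image (π ⁻¹ᴬ) B⊑C))))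
  image-block π B (pendant p) = pendant (image-singlePendant π B p)

  image-articulation : ∀ (π : Automorphism G) {v} → Articulation G v → Articulation G (onV π ⟨$⟩ʳ v)
  image-articulation π {v} disc = subst Disconnected
    (trans (imageRegion-∖ π (whole G) ⁅ v ⁆) (cong₂ _∖_ (imageRegion-whole π) (permute-⁅⁆ (onV π) v)))
    (image-disconnected π _ disc)

  image-isNode : ∀ (π : Automorphism G) x → IsNode G x → IsNode G (imageNode π x)
  image-isNode π (art v) = image-articulation π
  image-isNode π (blk B) = image-block π B

  image-adjacent : ∀ (π : Automorphism G) {x y} → Adjacent G x y → Adjacent G (imageNode π x) (imageNode π y)
  image-adjacent π (down a b v∈) =
    down (image-articulation π a) (image-block π _ b) (∈-permute⁺ (onV π) v∈)
  image-adjacent π (up a b v∈) =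
    up (image-articulation π a) (image-block π _ b) (∈-permute⁺ (onV π) v∈)

  image-walk : ∀ (π : Automorphism G) {x y} → Walk G x y → Walk G (imageNode π x) (imageNode π y)
  image-walk π done    = done
  image-walk π (a ◅ w) = image-adjacent π a ◅ image-walk π w

  visited-image : ∀ (π : Automorphism G) {x y} (w : Walk G x y) →
                  visited G (image-walk π w) ≡ List.map (imageNode π) (visited G w)
  visited-image π done    = refl
  visited-image π (a ◅ w) = cong (_ ∷_) (visited-image π w)

  size-image : ∀ (π : Automorphism G) {x y} (w : Walk G x y) → size G (image-walk π w) ≡ size G w
  size-image π done    = refl
  size-image π (a ◅ w) = cong suc (size-image π w)

  image-eccentricity : ∀ (π : Automorphism G) {x k} → EccentricityAtMost G x k →
                       EccentricityAtMost G (imageNode π x) k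
  image-eccentricity π {x} {k} ecc y node
    with w , w≤k ← ecc (imageNode (π ⁻¹ᴬ) y) (image-isNode (π ⁻¹ᴬ) y node) =
    subst (λ z → Σ[ w ∈ Walk G (imageNode π x) z ] size G w ≤ k) (imageNode-inverse π y)
      (image-walk π w , subst (_≤ k) (sym (size-image π w)) w≤k)

  -- Automorphisms preserve eccentricities, so the image of the centre has least eccentricity as
  -- well, and `IsCentre` includes uniqueness. The trivial tree has only one vertex to map to.
  centre-fixed : ∀ (π : Automorphism G) {c} → IsCentre G c → imageNode π c ≡ c
  centre-fixed π (trivial v (one , _)) = cong art (unique one _ v)
    where
    unique : ∀ {n} → n ≡ 1 → (v w : Fin n) → v ≡ w
    unique refl zero zero = refl
  centre-fixed π (least x _ (node , ecc) unique) = unique _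
    ( image-isNode π x node
    , λ y k node′ ecc′ → image-eccentricity π (ecc (imageNode (π ⁻¹ᴬ) y) k
        (image-isNode (π ⁻¹ᴬ) y node′) (image-eccentricity (π ⁻¹ᴬ) ecc′)))

  image-isComponent : ∀ (π : Automorphism G) {A K} → IsComponent A K → IsComponent (imageRegion π A) (imageRegion π K)
  image-isComponent π {A} {K} (K⊑A , conn , closed) =
    ⊑-image π K⊑A , image-connected π K conn , closed′
    where
    closed′ : ∀ x y → x ∈ᴿ imageRegion π K → y ∈ᴿ imageRegion π A →
              Linked (imageRegion π A) x y → y ∈ᴿ imageRegion π K
    closed′ x y x∈ y∈ l
      with x′ , x′∈ , refl ← ∈-imageRegion⁻ π K x x∈
         | y′ , y′∈ , refl ← ∈-imageRegion⁻ π A y y∈ =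
      ∈-imageRegion⁺ π y′ (closed x′ y′ x′∈ y′∈ (reflect-linked π A l))

  -- The permutation carries the set of darts counted at v onto the one counted at π v, and
  -- permuting keeps cardinality.
  image-degree : ∀ (π : Automorphism G) A v → degree (imageRegion π A) (onV π ⟨$⟩ʳ v) ≡ degree A v
  image-degree π A v = trans (cong ∣_∣ (sym (trans
      (permute-zipWith (onD π) _ (darts A) (at v))
      (cong (imageD π (darts A) ∩_) (permute-unique (onD π) (at v) (at (onV π ⟨$⟩ʳ v))
        (λ d∈ → at⁺ (ι-just π (at⁻ d∈))) (λ d∈ → at⁺ (ι-just⁻ π (at⁻ d∈))))))))
    (∣permute∣ (onD π) (darts A ∩ at v))
    where
    at : Vertex → Subset #D
    at v = tabulate (λ d → does (≡-dec Fin._≟_ (ι d) (just v)))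
    at⁺ : ∀ {v d} → ι d ≡ just v → d ∈ at v
    at⁺ {v} {d} eq = lookup⇒[]= d _ (trans (lookup∘tabulate _ d) (dec-true (≡-dec Fin._≟_ (ι d) (just v)) eq))
    at⁻ : ∀ {v d} → d ∈ at v → ι d ≡ just v
    at⁻ {v} {d} d∈ with ≡-dec Fin._≟_ (ι d) (just v)
                      | trans (sym (lookup∘tabulate (λ d → does (≡-dec Fin._≟_ (ι d) (just v))) d)) ([]=⇒lookup d∈)
    ... | yes eq | _ = eq

  image-joins : ∀ (π : Automorphism G) {d u v} → Joins G d u v → Joins G (onD π ⟨$⟩ʳ d) (onV π ⟨$⟩ʳ u) (onV π ⟨$⟩ʳ v)
  image-joins π {d} = Sum.map both both
    where
    both : ∀ {u v} → ι d ≡ just u × ι (ƛ d) ≡ just v →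
           ι (onD π ⟨$⟩ʳ d) ≡ just (onV π ⟨$⟩ʳ u) × ι (ƛ (onD π ⟨$⟩ʳ d)) ≡ just (onV π ⟨$⟩ʳ v)
    both (p , q) = ι-just π p , trans (cong ι (ƛ-comm π d)) (ι-just π q)

  reflect-joins : ∀ (π : Automorphism G) {d u v} → Joins G (onD π ⟨$⟩ʳ d) (onV π ⟨$⟩ʳ u) (onV π ⟨$⟩ʳ v) → Joins G d u v
  reflect-joins π {d} = Sum.map both both
    where
    both : ∀ {u v} → ι (onD π ⟨$⟩ʳ d) ≡ just (onV π ⟨$⟩ʳ u) × ι (ƛ (onD π ⟨$⟩ʳ d)) ≡ just (onV π ⟨$⟩ʳ v) →
           ι d ≡ just u × ι (ƛ d) ≡ just v
    both (p , q) = ι-just⁻ π p , ι-just⁻ π (trans (cong ι (sym (ƛ-comm π d))) q)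

  image-isBoundary : ∀ (π : Automorphism G) {A X} → IsBoundary A X → IsBoundary (imageRegion π A) (imageV π X)
  image-isBoundary π {A} {X} bd v = mk⇔ forth back
    where
    forth : v ∈ imageV π X → v ∈ imageV π (verts A) × ∃[ d ] (d ∉ imageD π (darts A) × ι d ≡ just v)
    forth v∈ with w , w∈ , refl ← ∈-permute⁻ (onV π) X v∈
      with w∈A , d , d∉ , eq ← to (bd w) w∈ =
      ∈-permute⁺ (onV π) w∈A , onD π ⟨$⟩ʳ d , d∉ ∘ ∈-permute⁻′ (onD π) (darts A) , ι-just π eq
    back : v ∈ imageV π (verts A) × ∃[ d ] (d ∉ imageD π (darts A) × ι d ≡ just v) → v ∈ imageV π X
    back (v∈ , d , d∉ , eq) with w , w∈ , refl ← ∈-permute⁻ (onV π) (verts A) v∈ =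
      ∈-permute⁺ (onV π) (from (bd w) (w∈ , onD π ⟨$⟩ˡ d
        , (λ d∈ → d∉ (subst (_∈ imageD π (darts A)) (Perm.inverseʳ (onD π)) (∈-permute⁺ (onD π) d∈)))
        , ι-just⁻ π (trans (cong ι (Perm.inverseʳ (onD π))) eq)))

  image-coversCentre : ∀ (π : Automorphism G) c {K} → CoversCentre G c K → CoversCentre G (imageNode π c) (imageRegion π K)
  image-coversCentre π (art v) v∈ = ∈-permute⁺ (onV π) v∈
  image-coversCentre π (blk C) C⊆ v∈ with w , w∈ , refl ← ∈-permute⁻ (onV π) (verts C) v∈ =
    ∈-permute⁺ (onV π) (C⊆ w∈)

  image-dipole : ∀ (π : Automorphism G) P → Dipole G P → Dipole G (imagePart π P)
  image-dipole π P dip = record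
    { u         = onV π ⟨$⟩ʳ u
    ; v         = onV π ⟨$⟩ʳ v
    ; u≢v       = u≢v ∘ permute-injective (onV π)
    ; verts≡    = trans (cong (imageV π) verts≡) (permute-pair (onV π) u v)
    ; darts⇔    = λ d → mk⇔ (forth d) (back d)
    ; two-edges = let d , e , jd , je , e∉ = two-edges in
        onD π ⟨$⟩ʳ d , onD π ⟨$⟩ʳ e , image-joins π jd , image-joins π je
      , e∉ ∘ ∈-permute⁻′ (onD π) (edge {G} d) ∘ subst (_ ∈_) (sym (imageD-edge π d))
    ; boundary≡ = trans (cong (imageV π) boundary≡) (permute-pair (onV π) u v)
    }
    where
    open Dipole dip
    forth : ∀ d → d ∈ imageD π (darts (body P)) → Joins G d (onV π ⟨$⟩ʳ u) (onV π ⟨$⟩ʳ v)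
    forth d d∈ with e , e∈ , refl ← ∈-permute⁻ (onD π) (darts (body P)) d∈ =
      image-joins π (to (darts⇔ e) e∈)
    back : ∀ d → Joins G d (onV π ⟨$⟩ʳ u) (onV π ⟨$⟩ʳ v) → d ∈ imageD π (darts (body P))
    back d j = subst (_∈ imageD π (darts (body P))) (Perm.inverseʳ (onD π))
      (∈-permute⁺ (onD π) (from (darts⇔ _) (reflect-joins π
        (subst (λ d → Joins G d _ _) (sym (Perm.inverseʳ (onD π))) j))))

  module _ {c : Node G} where

    -- Rooted subtrees and the exclusion of the centre from proper parts refer to `c`; hence their
    -- invariance is claimed for automorphisms fixing the root.
    Fixes : Automorphism G → Set
    Fixes π = imageNode π c ≡ c

    fixes-inverse : ∀ (π : Automorphism G) → Fixes π → Fixes (π ⁻¹ᴬ)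
    fixes-inverse π fix = trans (cong (imageNode (π ⁻¹ᴬ)) (sym fix)) (imageNode-inverse′ π c)

    image-inSubtree : ∀ (π : Automorphism G) → Fixes π → ∀ {x y} → InSubtree G c x y →
                      InSubtree G c (imageNode π x) (imageNode π y)
    image-inSubtree π fix (node , inj₁ refl) = image-isNode π _ node , inj₁ refl
    image-inSubtree π fix {x} {y} (node , inj₂ (w , all)) = image-isNode π _ node ,
      inj₂ (subst (Walk G _) fix (image-walk π w) , all′)
      where
      all′ : (w : Walk G (imageNode π y) c) → imageNode π x List.∈ visited G w
      -- Pulled back by the inverse, `w` becomes a walk from y to the centre and so visits x; the
      -- node of `w` lying over x is π x.
      all′ w with z , z∈ , eq ← ∈-map⁻ (imageNode (π ⁻¹ᴬ)) (subst (x List.∈_)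
          (visited-image (π ⁻¹ᴬ) w)
          (subst₂ (λ y c → (w : Walk G y c) → x List.∈ visited G w)
            (sym (imageNode-inverse′ π y)) (sym (fixes-inverse π fix)) all (image-walk (π ⁻¹ᴬ) w)))
        = subst (List._∈ visited G w)
            (sym (trans (cong (imageNode π) eq) (imageNode-inverse π z))) z∈

    reflect-inSubtree : ∀ (π : Automorphism G) → Fixes π → ∀ {x y} → InSubtree G c (imageNode π x) (imageNode π y) →
                        InSubtree G c x y
    reflect-inSubtree π fix {x} {y} h = subst₂ (InSubtree G c)
      (imageNode-inverse′ π x) (imageNode-inverse′ π y)
      (image-inSubtree (π ⁻¹ᴬ) (fixes-inverse π fix) h)

    image-unionOfSubtree : ∀ (π : Automorphism G) → Fixes π → ∀ {x S} → UnionOfSubtree G c x S →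
                           UnionOfSubtree G c (imageNode π x) (imageRegion π S)
    image-unionOfSubtree π fix {x} {S} (vs , ds) = (λ v → mk⇔ (vs⁺ v) (vs⁻ v)) , (λ d → mk⇔ (ds⁺ d) (ds⁻ d))
      where
      sub⁻ : ∀ {B} → InSubtree G c (imageNode π x) (blk B) → InSubtree G c x (blk (imageRegion (π ⁻¹ᴬ) B))
      sub⁻ {B} s = reflect-inSubtree π fix
        (subst (λ B → InSubtree G c (imageNode π x) (blk B)) (sym (imageRegion-inverse π B)) s)
      vs⁺ : ∀ v → v ∈ imageV π (verts S) → ∃[ B ] (InSubtree G c (imageNode π x) (blk B) × v ∈ verts B)
      vs⁺ v v∈ with w , w∈ , refl ← ∈-permute⁻ (onV π) (verts S) v∈ with B , s , w∈B ← to (vs w) w∈ =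
        imageRegion π B , image-inSubtree π fix s , ∈-permute⁺ (onV π) w∈B
      vs⁻ : ∀ v → ∃[ B ] (InSubtree G c (imageNode π x) (blk B) × v ∈ verts B) → v ∈ imageV π (verts S)
      vs⁻ v (B , s , v∈) = subst (_∈ imageV π (verts S)) (Perm.inverseʳ (onV π))
        (∈-permute⁺ (onV π) (from (vs _) (_ , sub⁻ s , ∈-permute⁺ (Perm.flip (onV π)) v∈)))
      ds⁺ : ∀ d → d ∈ imageD π (darts S) → ∃[ B ] (InSubtree G c (imageNode π x) (blk B) × d ∈ darts B)
      ds⁺ d d∈ with e , e∈ , refl ← ∈-permute⁻ (onD π) (darts S) d∈ with B , s , e∈B ← to (ds e) e∈ =
        imageRegion π B , image-inSubtree π fix s , ∈-permute⁺ (onD π) e∈B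
      ds⁻ : ∀ d → ∃[ B ] (InSubtree G c (imageNode π x) (blk B) × d ∈ darts B) → d ∈ imageD π (darts S)
      ds⁻ d (B , s , d∈) = subst (_∈ imageD π (darts S)) (Perm.inverseʳ (onD π))
        (∈-permute⁺ (onD π) (from (ds _) (_ , sub⁻ s , ∈-permute⁺ (Perm.flip (onD π)) d∈)))

    image-blockPart : ∀ (π : Automorphism G) → Fixes π → ∀ {P} → BlockPart G c P → BlockPart G c (imagePart π P)
    image-blockPart π fix {P} (attached x node x≢c union ¬pendant bd) = attached (imageNode π x)
      (image-isNode π x node)
      (λ eq → x≢c (trans (sym (imageNode-inverse′ π x))
        (trans (cong (imageNode (π ⁻¹ᴬ)) eq) (fixes-inverse π fix))))
      (image-unionOfSubtree π fix union)
      (¬pendant ∘ reflect image-singlePendant π (body P))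
      (image-isBoundary π bd)
    image-blockPart π fix {P} (central u node eq union ¬pendant bd) = central (onV π ⟨$⟩ʳ u)
      (image-articulation π node)
      (trans (cong (imageNode π) eq) fix)
      (image-unionOfSubtree π fix union)
      (¬pendant ∘ reflect image-singlePendant π (body P))
      (trans (cong (imageV π) bd) (permute-⁅⁆ (onV π) u))

    image-properPart : ∀ (π : Automorphism G) → Fixes π → ∀ {P} → ProperPart G c P → ProperPart G c (imagePart π P)
    image-properPart π fix pp = record
      { B = imageRegion π B ; u = onV π ⟨$⟩ʳ u ; v = onV π ⟨$⟩ʳ v
      ; K = imageRegion π K ; L₁ = imageRegion π L₁ ; L₂ = imageRegion π L₂ ; L = imageRegion π L
      ; block         = image-block π B block
      ; u∈B           = ∈-permute⁺ (onV π) u∈B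
      ; v∈B           = ∈-permute⁺ (onV π) v∈B
      ; u≢v           = u≢v ∘ permute-injective (onV π)
      ; component₁    = component component₁
      ; component₂    = component component₂
      ; different     = different ∘ imageRegion-injective π
      ; vertex₁       = _ , ∈-permute⁺ (onV π) (proj₂ vertex₁)
      ; vertex₂       = _ , ∈-permute⁺ (onV π) (proj₂ vertex₂)
      ; degree-u      = subst (_≥ 3) (sym (image-degree π B u)) degree-u
      ; degree-v      = subst (_≥ 3) (sym (image-degree π B v)) degree-v
      ; component-K   = subst
          (λ A → IsComponent (A ∖ (⁅ onV π ⟨$⟩ʳ u ⁆ ∪ ⁅ onV π ⟨$⟩ʳ v ⁆)) (imageRegion π K))
          (imageRegion-whole π) (component component-K)
      ; component-L   = component component-L
      ; L⊑K           = ⊑-image π L⊑K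
      ; not-free-edge = not-free-edge ∘ reflect image-singleFree π K
      ; not-central   = λ covers → not-central (subst₂ (CoversCentre G) (fixes-inverse π fix)
          (imageRegion-inverse′ π K) (image-coversCentre (π ⁻¹ᴬ) c covers))
      ; body≡         = trans (cong (imageRegion π) body≡) (cong (λ X → region X (imageD π (darts K)))
          (trans (permute-zipWith (onV π) _ (verts K) U)
            (cong (imageV π (verts K) ∪_) (permute-pair (onV π) u v))))
      ; boundary≡     = trans (cong (imageV π) boundary≡) (permute-pair (onV π) u v)
      }
      where
      open ProperPart pp
      component : ∀ {A C} → IsComponent (A ∖ U) C →
                  IsComponent (imageRegion π A ∖ (⁅ onV π ⟨$⟩ʳ u ⁆ ∪ ⁅ onV π ⟨$⟩ʳ v ⁆)) (imageRegion π C)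
      component {A} {C} comp = subst (λ A′ → IsComponent A′ (imageRegion π C))
        (trans (imageRegion-∖ π A U) (cong (imageRegion π A ∖_) (permute-pair (onV π) u v)))
        (image-isComponent π comp)

    image-isPart : ∀ (π : Automorphism G) → Fixes π → ∀ {P} → IsPart G c P → IsPart G c (imagePart π P)
    image-isPart π fix {P} =
      Sum.map (image-blockPart π fix) (Sum.map (image-properPart π fix) (image-dipole π P))

    -- Minimality and the priority of dipoles quantify over other parts. These are pulled back by
    -- the inverse, which fixes the centre together with π.
    image-isAtom : ∀ (π : Automorphism G) → Fixes π → ∀ {P} → IsAtom G c P → IsAtom G c (imagePart π P)
    image-isAtom π fix {P} atom = record
      { isPart       = image-isPart π fix isPart
      ; minimal      = λ Q part Q⊑ → trans (sym (imageRegion-inverse π (body Q))) (cong (imageRegion π)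
          (minimal (imagePart (π ⁻¹ᴬ) Q) (image-isPart (π ⁻¹ᴬ) (fixes-inverse π fix) part)
            (subst (_ ⊑_) (imageRegion-inverse′ π (body P)) (⊑-image (π ⁻¹ᴬ) Q⊑))))
      ; dipole-first = λ X dip → trans (sym (permute-flip (onV π) X)) (cong (imageV π)
          (dipole-first _ (subst (λ A → Dipole G (part A _)) (imageRegion-inverse′ π (body P))
            (image-dipole (π ⁻¹ᴬ) _ dip))))
      }
      where open IsAtom atom

-- Blocks and the block-tree

module _ {G : Graph} where
  open Graph G

  step-source : {A : Region G} → ∀ {x y} → Step A x y → x ∈ᴿ A
  step-source (mate d∈ _)  = d∈
  step-source (end d∈ _ _) = d∈

  step-target : {A : Region G} → ∀ {x y} → Step A x y → y ∈ᴿ A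
  step-target (mate _ d∈)  = d∈
  step-target (end _ v∈ _) = v∈

  step-mono : {A B : Region G} → A ⊑ B → ∀ {x y} → Step A x y → Step B x y
  step-mono (p , q) (mate d∈ e∈)    = mate (q d∈) (q e∈)
  step-mono (p , q) (end d∈ v∈ eq) = end (q d∈) (p v∈) eq

  linked-mono : {A B : Region G} → A ⊑ B → ∀ {x y} → Linked A x y → Linked B x y
  linked-mono A⊑B = Eq.map (step-mono A⊑B)

  -- The induction principle behind nearly every connectivity argument below: choose `R` as
  -- membership in some region and show that no step enters or leaves it.
  linked-closed : {A : Region G} (R : Element {G} → Set) →
                  (∀ {x y} → Step A x y → R x → R y) → (∀ {x y} → Step A x y → R y → R x) →
                  ∀ {x y} → Linked A x y → R x → R y
  linked-closed R forth back done           r = r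
  linked-closed R forth back (fwd s ◅ path) r = linked-closed R forth back path (forth s r)
  linked-closed R forth back (bwd s ◅ path) r = linked-closed R forth back path (back s r)

  step⇒linked : {A : Region G} → ∀ {x y} → Step A x y → Linked A x y
  step⇒linked = Eq.return

  linked-sym : {A : Region G} → ∀ {x y} → Linked A x y → Linked A y x
  linked-sym {A} = Eq.symmetric (Step A)

  linked-trans : {A : Region G} → ∀ {x y z} → Linked A x y → Linked A y z → Linked A x z
  linked-trans {A} = Eq.transitive (Step A)

  ∈-∖⁺ : (A : Region G) (X : Subset #V) → ∀ {v} → v ∈ verts A → v ∉ X → v ∈ verts (A ∖ X)
  ∈-∖⁺ A X v∈ v∉ = x∈p∧x∉q⇒x∈p─q v∈ v∉

  ∖-⊑ : (A : Region G) (X : Subset #V) → A ∖ X ⊑ A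
  ∖-⊑ A X = p─q⊆p (verts A) X , id

  ∈-∖⁻ : (A : Region G) (X : Subset #V) → ∀ {v} → v ∈ verts (A ∖ X) → v ∉ X
  ∈-∖⁻ A X = x∈p─q⇒x∉q (verts A) X

  ∖-mono : {A B : Region G} (X : Subset #V) → A ⊑ B → A ∖ X ⊑ B ∖ X
  ∖-mono {A} {B} X (p , q) =
    (λ v∈ → ∈-∖⁺ B X (p (p─q⊆p (verts A) X v∈)) (∈-∖⁻ A X v∈)) , q

  ∈-edge⁻ : ∀ {d e} → d ∈ edge {G} e → d ≡ e ⊎ d ≡ ƛ e
  ∈-edge⁻ = ∈-pair⁻

  -- Without ends in `A`, the only step available at either dart leads to its mate.
  isolated : (A : Region G) → ∀ d → (∀ v → v ∈ verts A → ι d ≢ just v) →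
             (∀ v → v ∈ verts A → ι (ƛ d) ≢ just v) →
             ∀ {y} → Linked A (inj₂ d) y → y ≡ inj₂ d ⊎ y ≡ inj₂ (ƛ d)
  isolated A d free free′ l = linked-closed R forth back l (inj₁ refl)
    where
    R : Element {G} → Set
    R y = y ≡ inj₂ d ⊎ y ≡ inj₂ (ƛ d)
    forth : ∀ {x y} → Step A x y → R x → R y
    forth (mate _ _)     (inj₁ refl) = inj₂ refl
    forth (mate _ _)     (inj₂ refl) = inj₁ (cong inj₂ (ƛ-involutive d))
    forth (end _ v∈ eq) (inj₁ refl) = contradiction eq (free _ v∈)
    forth (end _ v∈ eq) (inj₂ refl) = contradiction eq (free′ _ v∈)
    back : ∀ {x y} → Step A x y → R y → R x
    back (mate {e} _ _) (inj₁ eq) with refl ← eq = inj₂ (cong inj₂ (sym (ƛ-involutive e)))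
    back (mate {e} _ _) (inj₂ eq) = inj₁ (cong inj₂
      (trans (sym (ƛ-involutive e)) (trans (cong ƛ (inj₂-injective eq)) (ƛ-involutive d))))

  vertex-not-dart : ∀ {w : Vertex} {d e : Dart} →
                    ¬ (_≡_ {A = Element {G}} (inj₁ w) (inj₂ d) ⊎ _≡_ {A = Element {G}} (inj₁ w) (inj₂ e))
  vertex-not-dart (inj₁ ())
  vertex-not-dart (inj₂ ())

  incident : {A : Region G} → ∀ {v y} → Linked A (inj₁ v) y → y ≢ inj₁ v →
             ∃[ d ] (d ∈ darts A × ι d ≡ just v)
  incident done                    y≢v = contradiction refl y≢v
  -- No step starts at a vertex, so a nonempty path from v begins with an `end` step traversed
  -- backwards.
  incident (bwd (end d∈ _ eq) ◅ _) _   = _ , d∈ , eq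

  other-vertex : {A : Region G} → TwoConnected G A → ∀ p → ∃[ w ] (w ∈ verts A × w ≢ p)
  other-vertex (_ , (u , v , u∈ , v∈ , u≢v) , _) p with u Fin.≟ p
  ... | no u≢p   = u , u∈ , u≢p
  ... | yes refl = v , v∈ , u≢v ∘ sym

  -- Otherwise d would be isolated after the removal of p.
  end-elsewhere : {A : Region G} → TwoConnected G A → ∀ {d p} → d ∈ darts A → p ∈ verts A →
                  ¬ ((∀ v → ι d ≡ just v → v ≡ p) × (∀ v → ι (ƛ d) ≡ just v → v ≡ p))
  end-elsewhere {A} two@(_ , _ , _ , nocut) {d} {p} d∈ p∈ (at-p , at-p′)
    with w , w∈ , w≢p ← other-vertex two p =
    nocut p p∈ (inj₂ d , inj₁ w , d∈ , ∈-∖⁺ A ⁅ p ⁆ w∈ (w≢p ∘ x∈⁅y⁆⇒x≡y p) , λ l →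
      vertex-not-dart (isolated (A ∖ ⁅ p ⁆) d (avoid at-p) (avoid at-p′) l))
    where
    avoid : ∀ {e} → (∀ v → ι e ≡ just v → v ≡ p) → ∀ v → v ∈ verts (A ∖ ⁅ p ⁆) → ι e ≢ just v
    avoid at v v∈ eq = ∈-∖⁻ A ⁅ p ⁆ v∈ (subst (_∈ ⁅ p ⁆) (sym (at v eq)) (x∈⁅x⁆ p))

  -- In every other case all ends of the edge lie at a single vertex, which `end-elsewhere` forbids.
  -- If the edge has no end at all, any vertex of `A` can play that role.
  twoConnected-ends : {A : Region G} → TwoConnected G A → ∀ {d} → d ∈ darts A →
                      ∃₂ λ p q → p ≢ q × ι d ≡ just p × ι (ƛ d) ≡ just q
  twoConnected-ends {A} two@((ƛ-closed , ι-closed) , (u , _ , u∈ , _) , _) {d} d∈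
    with ι d in eq | ι (ƛ d) in eq′
  ... | nothing | nothing = ⊥-elim (end-elsewhere two d∈ u∈
        ((λ v e → contradiction (trans (sym eq) e) λ ()) , (λ v e → contradiction (trans (sym eq′) e) λ ())))
  ... | just p  | nothing = ⊥-elim (end-elsewhere two d∈ (ι-closed d p d∈ eq)
        ((λ v e → just-injective (trans (sym e) eq)) , (λ v e → contradiction (trans (sym eq′) e) λ ())))
  ... | nothing | just q  = ⊥-elim (end-elsewhere two d∈ (ι-closed _ q (ƛ-closed d d∈) eq′)
        ((λ v e → contradiction (trans (sym eq) e) λ ()) , (λ v e → just-injective (trans (sym e) eq′))))
  ... | just p  | just q with p Fin.≟ q
  ...   | no p≢q   = p , q , p≢q , refl , refl
  ...   | yes refl = ⊥-elim (end-elsewhere two d∈ (ι-closed d p d∈ eq)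
        ((λ v e → just-injective (trans (sym e) eq)) , (λ v e → just-injective (trans (sym e) eq′))))

  infixl 6 _⊔ᴿ_

  _⊔ᴿ_ : Region G → Region G → Region G
  A ⊔ᴿ B = region (verts A ∪ verts B) (darts A ∪ darts B)

  ⊑-⊔ˡ : (A B : Region G) → A ⊑ A ⊔ᴿ B
  ⊑-⊔ˡ A B = (λ v∈ → x∈p∪q⁺ (inj₁ v∈)) , (λ d∈ → x∈p∪q⁺ (inj₁ d∈))

  ⊑-⊔ʳ : (A B : Region G) → B ⊑ A ⊔ᴿ B
  ⊑-⊔ʳ A B = (λ v∈ → x∈p∪q⁺ (inj₂ v∈)) , (λ d∈ → x∈p∪q⁺ (inj₂ d∈))

  ∈-⊔⁻ : (A B : Region G) → ∀ x → x ∈ᴿ A ⊔ᴿ B → x ∈ᴿ A ⊎ x ∈ᴿ B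
  ∈-⊔⁻ A B (inj₁ v) = x∈p∪q⁻ (verts A) (verts B)
  ∈-⊔⁻ A B (inj₂ d) = x∈p∪q⁻ (darts A) (darts B)

  ∈ᴿ-∖⁺ : (A : Region G) → ∀ {p} x → x ∈ᴿ A → x ≢ inj₁ p → x ∈ᴿ A ∖ ⁅ p ⁆
  ∈ᴿ-∖⁺ A (inj₁ v) v∈ v≢p = ∈-∖⁺ A _ v∈ (v≢p ∘ cong inj₁ ∘ x∈⁅y⁆⇒x≡y _)
  ∈ᴿ-∖⁺ A (inj₂ d) d∈ _   = d∈

  ∈ᴿ-∖⁻ : (A : Region G) → ∀ {p} x → x ∈ᴿ A ∖ ⁅ p ⁆ → x ∈ᴿ A × x ≢ inj₁ p
  ∈ᴿ-∖⁻ A {p} (inj₁ v) v∈ = p─q⊆p (verts A) ⁅ p ⁆ v∈ , λ { refl → ∈-∖⁻ A ⁅ p ⁆ v∈ (x∈⁅x⁆ p) }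
  ∈ᴿ-∖⁻ A (inj₂ d) d∈ = d∈ , λ ()

  -- The source of the double negations: `TwoConnected` only denies that the region is disconnected.
  -- If p lies outside `A`, its removal changes nothing.
  linked-without : {A : Region G} → TwoConnected G A → ∀ p {x y} → x ∈ᴿ A → y ∈ᴿ A →
                   x ≢ inj₁ p → y ≢ inj₁ p → ¬ ¬ Linked (A ∖ ⁅ p ⁆) x y
  linked-without {A} (_ , _ , (_ , linked) , nocut) p {x} {y} x∈ y∈ x≢p y≢p unlinked
    with p ∈? verts A
  ... | yes p∈ = nocut p p∈ (x , y , ∈ᴿ-∖⁺ A x x∈ x≢p , ∈ᴿ-∖⁺ A y y∈ y≢p , unlinked)
  ... | no  p∉ = unlinked (linked-mono
          ((λ v∈ → ∈-∖⁺ A ⁅ p ⁆ v∈ λ v∈p → p∉ (subst (_∈ verts A) (x∈⁅y⁆⇒x≡y p v∈p) v∈)) , id)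
          (linked x y x∈ y∈))

  -- Whatever vertex is removed, one of the two common vertices survives, and everything left of `A`
  -- and of `B` is linked to it.
  twoConnected-⊔ : (A B : Region G) → TwoConnected G A → TwoConnected G B → ∀ {p q} → p ≢ q →
                   p ∈ verts A → q ∈ verts A → p ∈ verts B → q ∈ verts B → TwoConnected G (A ⊔ᴿ B)
  twoConnected-⊔ A B
    twoA@((ƛ-closedA , ι-closedA) , (u , v , u∈ , v∈ , u≢v) , ((x , x∈) , linkedA) , _)
    twoB@((ƛ-closedB , ι-closedB) , _ , (_ , linkedB) , _) {p} {q} p≢q pA qA pB qB =
      (ƛ-closed , ι-closed)
    , (u , v , proj₁ (⊑-⊔ˡ A B) u∈ , proj₁ (⊑-⊔ˡ A B) v∈ , u≢v)
    , ((x , ⊑⇒∈ (⊑-⊔ˡ A B) x x∈) , λ x y x∈ y∈ → linked-trans (to-p x x∈) (linked-sym (to-p y y∈)))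
    , nocut
    where
    ƛ-closed : ∀ d → d ∈ darts (A ⊔ᴿ B) → ƛ d ∈ darts (A ⊔ᴿ B)
    ƛ-closed d d∈ with x∈p∪q⁻ (darts A) (darts B) d∈
    ... | inj₁ dA = proj₂ (⊑-⊔ˡ A B) (ƛ-closedA d dA)
    ... | inj₂ dB = proj₂ (⊑-⊔ʳ A B) (ƛ-closedB d dB)
    ι-closed : ∀ d v → d ∈ darts (A ⊔ᴿ B) → ι d ≡ just v → v ∈ verts (A ⊔ᴿ B)
    ι-closed d v d∈ eq with x∈p∪q⁻ (darts A) (darts B) d∈
    ... | inj₁ dA = proj₁ (⊑-⊔ˡ A B) (ι-closedA d v dA eq)
    ... | inj₂ dB = proj₁ (⊑-⊔ʳ A B) (ι-closedB d v dB eq)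
    to-p : ∀ x → x ∈ᴿ A ⊔ᴿ B → Linked (A ⊔ᴿ B) x (inj₁ p)
    to-p x x∈ with ∈-⊔⁻ A B x x∈
    ... | inj₁ xA = linked-mono (⊑-⊔ˡ A B) (linkedA x (inj₁ p) xA pA)
    ... | inj₂ xB = linked-mono (⊑-⊔ʳ A B) (linkedB x (inj₁ p) xB pB)
    surviving : ∀ w → ∃[ r ] (r ≢ w × r ∈ verts A × r ∈ verts B)
    surviving w with p Fin.≟ w
    ... | no p≢w   = p , p≢w , pA , pB
    ... | yes refl = q , p≢q ∘ sym , qA , qB
    nocut : ∀ w → w ∈ verts (A ⊔ᴿ B) → ¬ Disconnected ((A ⊔ᴿ B) ∖ ⁅ w ⁆)
    nocut w _ (x , y , x∈ , y∈ , unlinked) with r , r≢w , rA , rB ← surviving w =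
      to-r x x∈ λ lx → to-r y y∈ λ ly → unlinked (linked-trans lx (linked-sym ly))
      where
      r≢ : _≢_ {A = Element {G}} (inj₁ r) (inj₁ w)
      r≢ refl = r≢w refl
      to-r : ∀ x → x ∈ᴿ (A ⊔ᴿ B) ∖ ⁅ w ⁆ → ¬ ¬ Linked ((A ⊔ᴿ B) ∖ ⁅ w ⁆) x (inj₁ r)
      to-r x x∈ unlinked with x∈′ , x≢ ← ∈ᴿ-∖⁻ (A ⊔ᴿ B) x x∈ with ∈-⊔⁻ A B x x∈′
      ... | inj₁ xA = linked-without twoA w xA rA x≢ r≢
                        (unlinked ∘ linked-mono (∖-mono ⁅ w ⁆ (⊑-⊔ˡ A B)))
      ... | inj₂ xB = linked-without twoB w xB rB x≢ r≢
                        (unlinked ∘ linked-mono (∖-mono ⁅ w ⁆ (⊑-⊔ʳ A B)))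

  pendant⇒undefined : ∀ {d v e} → Pendant d v → e ∈ edge {G} d → ι e ≡ nothing ⊎ ι (ƛ e) ≡ nothing
  pendant⇒undefined {d} (_ , ιƛd) e∈ with ∈-edge⁻ e∈
  ... | inj₁ refl = inj₂ ιƛd
  ... | inj₂ refl = inj₁ ιƛd

  twoConnected-no-pendant : {A : Region G} → TwoConnected G A → ∀ {d v e} → Pendant d v →
                            e ∈ edge {G} d → e ∉ darts A
  twoConnected-no-pendant two pend e∈ e∈A with twoConnected-ends two e∈A | pendant⇒undefined pend e∈
  ... | _ , _ , _ , eq , _  | inj₁ none with () ← trans (sym eq) none
  ... | _ , _ , _ , _ , eq′ | inj₂ none with () ← trans (sym eq′) none

  pendant-unique : ∀ {d v d′ v′ e} → Pendant d v → Pendant d′ v′ → e ∈ edge {G} d → e ∈ edge {G} d′ →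
                   d ≡ d′
  pendant-unique {d} {d′ = d′} (ιd , ιƛd) (ιd′ , ιƛd′) e∈ e∈′ with ∈-edge⁻ e∈ | ∈-edge⁻ e∈′
  ... | inj₁ refl | inj₁ eq   = eq
  ... | inj₁ refl | inj₂ refl with () ← trans (sym ιd) ιƛd′
  ... | inj₂ refl | inj₁ refl with () ← trans (sym ιd′) ιƛd
  ... | inj₂ refl | inj₂ eq   = trans (sym (ƛ-involutive d)) (trans (cong ƛ eq) (ƛ-involutive d′))

  -- The two ends of a common dart are two common vertices, so the union of maximal blocks is
  -- 2-connected and by maximality equals both. Pendant edges lie in no 2-connected region and are
  -- determined by either of their darts.
  block-unique : ∀ {B C d} → Block G B → Block G C → d ∈ darts B → d ∈ darts C → B ≡ C
  block-unique {B} {C} {d} (maximal two max) (maximal two′ max′) d∈ d∈′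
    with p , q , p≢q , eq , eq′ ← twoConnected-ends two d∈ =
    trans (sym (max (B ⊔ᴿ C) union (⊑-⊔ˡ B C))) (max′ (B ⊔ᴿ C) union (⊑-⊔ʳ B C))
    where
    union : TwoConnected G (B ⊔ᴿ C)
    union = twoConnected-⊔ B C two two′ p≢q
      (proj₂ (proj₁ two) d p d∈ eq) (proj₂ (proj₁ two) _ q (proj₁ (proj₁ two) d d∈) eq′)
      (proj₂ (proj₁ two′) d p d∈′ eq) (proj₂ (proj₁ two′) _ q (proj₁ (proj₁ two′) d d∈′) eq′)
  block-unique (maximal two _) (pendant (d , v , pend , refl)) d∈ d∈′ =
    contradiction d∈ (twoConnected-no-pendant two pend d∈′)
  block-unique (pendant (d , v , pend , refl)) (maximal two _) d∈ d∈′ =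
    contradiction d∈′ (twoConnected-no-pendant two pend d∈)
  block-unique (pendant (d , v , pend , refl)) (pendant (d′ , v′ , pend′ , refl)) d∈ d∈′
    with refl ← pendant-unique pend pend′ d∈ d∈′
    with refl ← just-injective (trans (sym (proj₁ pend)) (proj₁ pend′)) = refl

  block-isSubgraph : ∀ {B} → Block G B → IsSubgraph B
  block-isSubgraph (maximal two _) = proj₁ two
  block-isSubgraph (pendant (d , v , (ιd , ιƛd) , refl)) = ƛ-closed , ι-closed
    where
    ƛ-closed : ∀ e → e ∈ edge {G} d → ƛ e ∈ edge {G} d
    ƛ-closed e e∈ with ∈-edge⁻ e∈
    ... | inj₁ refl = ∈-pairʳ d (ƛ d)
    ... | inj₂ refl = subst (_∈ edge {G} d) (sym (ƛ-involutive d)) (∈-pairˡ d (ƛ d))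
    ι-closed : ∀ e w → e ∈ edge {G} d → ι e ≡ just w → w ∈ ⁅ v ⁆
    ι-closed e w e∈ eq with ∈-edge⁻ e∈
    ... | inj₁ refl = subst (_∈ ⁅ v ⁆) (just-injective (trans (sym ιd) eq)) (x∈⁅x⁆ v)
    ... | inj₂ refl with () ← trans (sym eq) ιƛd

  block-linked : ∀ {B x y} → Block G B → x ∈ᴿ B → y ∈ᴿ B → Linked B x y
  block-linked (maximal (_ , _ , (_ , linked) , _) _) x∈ y∈ = linked _ _ x∈ y∈
  block-linked {x = x} {y} (pendant (d , v , (ιd , _) , refl)) x∈ y∈ =
    linked-trans (to-d x x∈) (linked-sym (to-d y y∈))
    where
    to-d : ∀ x → x ∈ᴿ region ⁅ v ⁆ (edge {G} d) → Linked (region ⁅ v ⁆ (edge {G} d)) x (inj₂ d)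
    to-d (inj₁ w) w∈ with refl ← x∈⁅y⁆⇒x≡y v w∈ =
      linked-sym (step⇒linked (end (∈-pairˡ d (ƛ d)) w∈ ιd))
    to-d (inj₂ e) e∈ with ∈-edge⁻ e∈
    ... | inj₁ refl = done
    ... | inj₂ refl = linked-sym (step⇒linked (mate (∈-pairˡ d (ƛ d)) e∈))

  -- Serves to trade a common vertex for a common dart: blocks may share vertices, but a dart
  -- determines its block.
  block-incident : ∀ {B v} → Block G B → v ∈ verts B → ∃[ d ] (d ∈ darts B × ι d ≡ just v)
  block-incident {B} {v} block@(maximal two _) v∈ with w , w∈ , w≢v ← other-vertex two v =
    incident (block-linked {x = inj₁ v} {inj₁ w} block v∈ w∈) λ { refl → w≢v refl }
  block-incident (pendant (d , v , (ιd , _) , refl)) w∈ with refl ← x∈⁅y⁆⇒x≡y v w∈ =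
    d , ∈-pairˡ d (ƛ d) , ιd

  infix 4 _≟ᴺ_

  -- Makes it decidable whether a walk visits a node, so that double negations can be removed from
  -- such claims.
  _≟ᴺ_ : (x y : Node G) → Dec (x ≡ y)
  art v ≟ᴺ art w = map′ (cong art) (λ { refl → refl }) (v Fin.≟ w)
  blk B ≟ᴺ blk C = map′ (λ (p , q) → cong blk (cong₂ region p q)) (λ { refl → refl , refl })
    (≡-decᵛ Bool._≟_ (verts B) (verts C) ×-dec ≡-decᵛ Bool._≟_ (darts B) (darts C))
  art _ ≟ᴺ blk _ = no λ ()
  blk _ ≟ᴺ art _ = no λ ()

  open DecMembership _≟ᴺ_ using () renaming (_∈?_ to _∈ᴺ?_)

  target∈visited : ∀ {x y} (w : Walk G x y) → y List.∈ visited G w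
  target∈visited done    = here refl
  target∈visited (_ ◅ w) = there (target∈visited w)

  suffix : ∀ {n c x} (w : Walk G n c) → x List.∈ visited G w →
           Σ[ w′ ∈ Walk G x c ] (∀ z → z List.∈ visited G w′ → z List.∈ visited G w)
  suffix w@done    (here refl) = w , λ _ → id
  suffix w@(_ ◅ _) (here refl) = w , λ _ → id
  suffix (_ ◅ w)   (there x∈) with w′ , w′⊆ ← suffix w x∈ = w′ , λ z → there ∘ w′⊆ z

  -- Follow w up to the first of x and y and proceed by w₁ or w₂.
  walk-avoiding : ∀ {n c x y} (w : Walk G n c) → x List.∈ visited G w →
                  (w₁ : Walk G x c) → ¬ y List.∈ visited G w₁ →
                  (w₂ : Walk G y c) → ¬ x List.∈ visited G w₂ →
                  (Σ[ w′ ∈ Walk G n c ] ¬ y List.∈ visited G w′) ⊎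
                  (Σ[ w′ ∈ Walk G n c ] ¬ x List.∈ visited G w′)
  walk-avoiding done (here refl) w₁ y∉ w₂ x∉ = inj₁ (w₁ , y∉)
  walk-avoiding {n} {x = x} {y} (a ◅ w) x∈ w₁ y∉ w₂ x∉ with n ≟ᴺ x | n ≟ᴺ y | x∈
  ... | yes refl | _        | _         = inj₁ (w₁ , y∉)
  ... | no _     | yes refl | _         = inj₂ (w₂ , x∉)
  ... | no n≢x   | no n≢y   | here refl = contradiction refl n≢x
  ... | no n≢x   | no n≢y   | there x∈′ with walk-avoiding w x∈′ w₁ y∉ w₂ x∉
  ...   | inj₁ (w′ , y∉′) = inj₁ (a ◅ w′ , λ { (here refl) → n≢y refl ; (there y∈) → y∉′ y∈ })
  ...   | inj₂ (w′ , x∉′) = inj₂ (a ◅ w′ , λ { (here refl) → n≢x refl ; (there x∈) → x∉′ x∈ })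

  inSubtree-trans : ∀ {c x y z} → InSubtree G c x y → InSubtree G c y z → InSubtree G c x z
  inSubtree-trans x≤y (_ , inj₁ refl) = x≤y
  inSubtree-trans (_ , inj₁ refl) y≤z = y≤z
  inSubtree-trans {x = x} (_ , inj₂ (_ , all)) (node , inj₂ (w , all′)) = node , inj₂ (w , λ w →
    let w′ , w′⊆ = suffix w (all′ w) in w′⊆ x (all w′))

  -- Up to ¬¬ the nodes separating n from the centre form a chain.
  inSubtree-total : ∀ {c x y n} → IsNode G x → IsNode G y → InSubtree G c x n → InSubtree G c y n →
                    ¬ ¬ (InSubtree G c x y ⊎ InSubtree G c y x)
  inSubtree-total nx ny (node , inj₁ refl) y≤n k = k (inj₂ y≤n)
  inSubtree-total nx ny x≤n (node , inj₁ refl) k = k (inj₁ x≤n)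
  inSubtree-total {x = x} {y} nx ny (_ , inj₂ (w , all)) (_ , inj₂ (_ , all′)) k =
    -- Incomparable x and y would yield a walk `w₂` from y missing x and a walk `w₁` from x missing
    -- y. Continuing a walk from n by one of them gives a walk to the centre that misses x or y,
    -- although both separate n from the centre.
    k (inj₁ (ny , inj₂ (proj₁ (suffix w (all′ w)) , λ w₂ →
      decidable-stable (x ∈ᴺ? visited G w₂) λ x∉ →
        k (inj₂ (nx , inj₂ (proj₁ (suffix w (all w)) , λ w₁ →
          decidable-stable (y ∈ᴺ? visited G w₁) λ y∉ →
            Sum.[ (λ (w′ , y∉′) → y∉′ (all′ w′)) , (λ (w′ , x∉′) → x∉′ (all w′)) ]
              (walk-avoiding w (all w) w₁ y∉ w₂ x∉)))))))

  unionOfSubtree-mono : ∀ {c x y S T} → (∀ B → InSubtree G c x (blk B) → InSubtree G c y (blk B)) →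
                        UnionOfSubtree G c x S → UnionOfSubtree G c y T → S ⊑ T
  unionOfSubtree-mono sub (vs , ds) (vs′ , ds′) =
      (λ {v} v∈ → let B , s , v∈B = to (vs v) v∈ in from (vs′ v) (B , sub B s , v∈B))
    , (λ {d} d∈ → let B , s , d∈B = to (ds d) d∈ in from (ds′ d) (B , sub B s , d∈B))

  block⊑union : ∀ {c x S B} → UnionOfSubtree G c x S → InSubtree G c x (blk B) → B ⊑ S
  block⊑union (vs , ds) s = (λ {v} v∈ → from (vs v) (_ , s , v∈)) , (λ {d} d∈ → from (ds d) (_ , s , d∈))

  union-isSubgraph : ∀ {c x S} → UnionOfSubtree G c x S → IsSubgraph S
  union-isSubgraph (vs , ds) =
      (λ d d∈ → let B , s , d∈B = to (ds d) d∈ in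
        from (ds (ƛ d)) (B , s , proj₁ (block-isSubgraph (proj₁ s)) d d∈B))
    , (λ d v d∈ eq → let B , s , d∈B = to (ds d) d∈ in
        from (vs v) (B , s , proj₂ (block-isSubgraph (proj₁ s)) d v d∈B eq))

-- Atoms have disjoint interiors

module _ {G : Graph} where
  open Graph G

  -- For the atoms of a reduction this is supplied by `atom-avoids`; in the comparisons below it is
  -- a hypothesis.
  Avoids : Part G → Part G → Set
  Avoids P Q = ∀ v → v ∈ boundary P → v ∉ verts (interior Q)

  component-step : {A K : Region G} → IsComponent A K → ∀ {x y} → Step A x y → x ∈ᴿ K → y ∈ᴿ K
  component-step (_ , _ , closed) s x∈ = closed _ _ x∈ (step-target s) (step⇒linked s)

  component-step⁻ : {A K : Region G} → IsComponent A K → ∀ {x y} → Step A x y → y ∈ᴿ K → x ∈ᴿ K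
  component-step⁻ (_ , _ , closed) s y∈ = closed _ _ y∈ (step-source s) (linked-sym (step⇒linked s))

  interior⇒body : (P : Part G) → ∀ z → z ∈ᴿ interior P → z ∈ᴿ body P
  interior⇒body P = ⊑⇒∈ (∖-⊑ (body P) (boundary P))

  -- With equal bodies, a vertex of one boundary missing from the other would be interior to the
  -- other part.
  boundary-unique : (P Q : Part G) → body P ≡ body Q → Avoids P Q → Avoids Q P →
                    boundary P ⊆ body P .verts → boundary Q ⊆ body Q .verts → P ≡ Q
  boundary-unique P Q refl P#Q Q#P P⊆ Q⊆ = cong (part (body P))
    (⊆-antisym (half P Q P#Q P⊆) (half Q P Q#P Q⊆))
    where
    half : ∀ P Q → Avoids P Q → boundary P ⊆ body Q .verts → boundary P ⊆ boundary Q
    half P Q P#Q P⊆ {v} v∈ = decidable-stable (v ∈? boundary Q) λ v∉ →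
      P#Q v v∈ (∈-∖⁺ (body Q) (boundary Q) (P⊆ v∈) v∉)

  -- The variant for a central `Q`, whose boundary is prescribed instead of being read off the body:
  -- a nonempty subset of a singleton is all of it.
  boundary-unique-singleton : (P Q : Part G) → body P ≡ body Q → Avoids P Q → Nonempty (boundary P) →
                              boundary P ⊆ body P .verts → ∀ u → boundary Q ≡ ⁅ u ⁆ → P ≡ Q
  boundary-unique-singleton P Q refl P#Q (v , v∈) P⊆ u refl = cong (part (body P))
    (⊆-antisym P⊆Q (λ w∈ → subst (_∈ boundary P)
      (trans (x∈⁅y⁆⇒x≡y u (P⊆Q v∈)) (sym (x∈⁅y⁆⇒x≡y u w∈))) v∈))
    where
    P⊆Q : boundary P ⊆ ⁅ u ⁆
    P⊆Q {v} v∈ = decidable-stable (v ∈? ⁅ u ⁆) λ v∉ →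
      P#Q v v∈ (∈-∖⁺ (body P) ⁅ u ⁆ (P⊆ v∈) v∉)

  joins-ends : ∀ {d u v w} → Joins G d u v → ι d ≡ just w → w ∈ ⁅ u ⁆ ∪ ⁅ v ⁆
  joins-ends {u = u} {v} (inj₁ (eq , _)) eq′ =
    subst (_∈ _) (just-injective (trans (sym eq) eq′)) (∈-pairˡ u v)
  joins-ends {u = u} {v} (inj₂ (eq , _)) eq′ =
    subst (_∈ _) (just-injective (trans (sym eq) eq′)) (∈-pairʳ u v)

  joins-ƛ : ∀ {d u v} → Joins G d u v → Joins G (ƛ d) u v
  joins-ƛ {d} = Sum.swap ∘ Sum.map flip flip
    where
    flip : ∀ {u v} → ι d ≡ just u × ι (ƛ d) ≡ just v → ι (ƛ d) ≡ just v × ι (ƛ (ƛ d)) ≡ just u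
    flip (p , q) = q , trans (cong ι (ƛ-involutive d)) p

  joins-end : ∀ {d u v} → Joins G d u v → ∃[ w ] (ι d ≡ just w)
  joins-end (inj₁ (eq , _)) = _ , eq
  joins-end (inj₂ (eq , _)) = _ , eq

  -- A dart and its mate determine the unordered pair of ends, hence the whole dipole; this settles
  -- the overlap of two dipoles.
  joins-agree : ∀ {d u v u′ v′} → Joins G d u v → Joins G d u′ v′ →
                (∀ e → Joins G e u v → Joins G e u′ v′) × ⁅ u ⁆ ∪ ⁅ v ⁆ ≡ ⁅ u′ ⁆ ∪ ⁅ v′ ⁆
  joins-agree {d} j j′ = helper j j′
    where
    Same : Vertex → Vertex → Vertex → Vertex → Set
    Same u v u′ v′ = (∀ e → Joins G e u v → Joins G e u′ v′) × ⁅ u ⁆ ∪ ⁅ v ⁆ ≡ ⁅ u′ ⁆ ∪ ⁅ v′ ⁆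
    straight : ∀ {u v u′ v′} → u ≡ u′ → v ≡ v′ → Same u v u′ v′
    straight refl refl = (λ _ → id) , refl
    crossed : ∀ {u v u′ v′} → u ≡ v′ → v ≡ u′ → Same u v u′ v′
    crossed {u} {v} refl refl = (λ _ → Sum.swap) , ∪-comm ⁅ u ⁆ ⁅ v ⁆
    equal : ∀ {e v w} → ι e ≡ just v → ι e ≡ just w → v ≡ w
    equal p q = just-injective (trans (sym p) q)
    helper : ∀ {u v u′ v′} → Joins G d u v → Joins G d u′ v′ → Same u v u′ v′
    helper (inj₁ (p , q)) (inj₁ (p′ , q′)) = straight (equal p p′) (equal q q′)
    helper (inj₁ (p , q)) (inj₂ (p′ , q′)) = crossed (equal p p′) (equal q q′)
    helper (inj₂ (p , q)) (inj₁ (p′ , q′)) = crossed (equal q q′) (equal p p′)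
    helper (inj₂ (p , q)) (inj₂ (p′ , q′)) = straight (equal q q′) (equal p p′)

  module _ {P : Part G} (dip : Dipole G P) where
    open Dipole dip

    dipole-boundary⊆ : boundary P ⊆ body P .verts
    dipole-boundary⊆ = subst (boundary P ⊆_) (sym verts≡) (subst (_⊆ ⁅ u ⁆ ∪ ⁅ v ⁆) (sym boundary≡) id)

    dipole-boundary : ∀ {w} → w ∈ ⁅ u ⁆ ∪ ⁅ v ⁆ → w ∈ boundary P
    dipole-boundary = subst (_ ∈_) (sym boundary≡)

    dipole-vertexless : ∀ v → v ∉ verts (interior P)
    dipole-vertexless w w∈ = ∈-∖⁻ (body P) (boundary P) w∈
      (subst (w ∈_) (trans verts≡ (sym boundary≡)) (p─q⊆p _ (boundary P) w∈))

    dipole-isSubgraph : IsSubgraph (body P)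
    dipole-isSubgraph = (λ d d∈ → from (darts⇔ (ƛ d)) (joins-ƛ (to (darts⇔ d) d∈)))
      , (λ d w d∈ eq → subst (w ∈_) (sym verts≡) (joins-ends (to (darts⇔ d) d∈) eq))

    private
      u∈ : u ∈ verts (body P)
      u∈ = subst (u ∈_) (sym verts≡) (∈-pairˡ u v)

      v∈ : v ∈ verts (body P)
      v∈ = subst (v ∈_) (sym verts≡) (∈-pairʳ u v)

      dart⇒end : ∀ {A : Region G} {d w} → (∀ {e} → Joins G e u v → e ∈ darts A) → w ∈ verts A →
                 w ∈ ⁅ u ⁆ ∪ ⁅ v ⁆ → Joins G d u v → Linked A (inj₂ d) (inj₁ w)
      dart⇒end {d = d} darts⊆ w∈ w∈U j with ∈-pair⁻ w∈U | j
      ... | inj₁ refl | inj₁ (p , q) = step⇒linked (end (darts⊆ j) w∈ p)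
      ... | inj₁ refl | inj₂ (p , q) = linked-trans (step⇒linked (mate (darts⊆ j) (darts⊆ (joins-ƛ j))))
                                         (step⇒linked (end (darts⊆ (joins-ƛ j)) w∈ q))
      ... | inj₂ refl | inj₁ (p , q) = linked-trans (step⇒linked (mate (darts⊆ j) (darts⊆ (joins-ƛ j))))
                                         (step⇒linked (end (darts⊆ (joins-ƛ j)) w∈ q))
      ... | inj₂ refl | inj₂ (p , q) = step⇒linked (end (darts⊆ j) w∈ p)

    -- Used to place a dipole inside a single block. After the removal of one end, every dart is
    -- still linked to the other end, directly or through its mate.
    dipole-twoConnected : TwoConnected G (body P)
    dipole-twoConnected = dipole-isSubgraph
      , (u , v , u∈ , v∈ , u≢v)
      , ((inj₁ u , u∈) , λ x y x∈ y∈ → linked-trans (to-u x x∈) (linked-sym (to-u y y∈)))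
      , nocut
      where
      to-u : ∀ x → x ∈ᴿ body P → Linked (body P) x (inj₁ u)
      to-u (inj₂ d) d∈ = dart⇒end (from (darts⇔ _)) u∈ (∈-pairˡ u v) (to (darts⇔ d) d∈)
      to-u (inj₁ w) w∈ with ∈-pair⁻ (subst (w ∈_) verts≡ w∈)
      ... | inj₁ refl = done
      ... | inj₂ refl with d , _ , jd , _ ← two-edges =
        linked-trans (linked-sym (dart⇒end (from (darts⇔ _)) v∈ (∈-pairʳ u v) jd))
          (dart⇒end (from (darts⇔ _)) u∈ (∈-pairˡ u v) jd)
      to-r : ∀ {w r} → r ∈ ⁅ u ⁆ ∪ ⁅ v ⁆ → r ≢ w → (∀ {x} → x ∈ ⁅ u ⁆ ∪ ⁅ v ⁆ → x ≢ w → x ≡ r) →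
             ∀ x → x ∈ᴿ body P ∖ ⁅ w ⁆ → Linked (body P ∖ ⁅ w ⁆) x (inj₁ r)
      to-r {w} {r} r∈ r≢w only (inj₁ x) x∈ with refl ← only
          (subst (x ∈_) verts≡ (p─q⊆p (verts (body P)) ⁅ w ⁆ x∈))
          (λ { refl → ∈-∖⁻ (body P) ⁅ w ⁆ x∈ (x∈⁅x⁆ w) }) = done
      to-r {w} {r} r∈ r≢w only (inj₂ d) d∈ = dart⇒end (from (darts⇔ _))
        (∈-∖⁺ (body P) ⁅ w ⁆ (subst (r ∈_) (sym verts≡) r∈) (r≢w ∘ x∈⁅y⁆⇒x≡y w)) r∈ (to (darts⇔ d) d∈)
      nocut : ∀ w → w ∈ verts (body P) → ¬ Disconnected (body P ∖ ⁅ w ⁆)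
      nocut w w∈ (x , y , x∈ , y∈ , unlinked) with ∈-pair⁻ (subst (w ∈_) verts≡ w∈)
      ... | inj₁ refl = unlinked (linked-trans (to-v x x∈) (linked-sym (to-v y y∈)))
        where
        to-v = to-r (∈-pairʳ u v) (u≢v ∘ sym) λ z∈ z≢u →
          Sum.[ (λ z≡u → contradiction z≡u z≢u) , id ] (∈-pair⁻ z∈)
      ... | inj₂ refl = unlinked (linked-trans (to-u′ x x∈) (linked-sym (to-u′ y y∈)))
        where
        to-u′ = to-r (∈-pairˡ u v) u≢v λ z∈ z≢v →
          Sum.[ id , (λ z≡v → contradiction z≡v z≢v) ] (∈-pair⁻ z∈)

  module _ {c : Node G} {P : Part G} (pp : ProperPart G c P) where
    open ProperPart pp

    private
      K⇒∉U : ∀ {w} → w ∈ verts K → w ∉ U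
      K⇒∉U w∈ = ∈-∖⁻ (whole G) U (proj₁ (proj₁ component-K) w∈)

    K⊑body : K ⊑ body P
    K⊑body = subst (K ⊑_) (sym body≡) ((λ v∈ → x∈p∪q⁺ (inj₁ v∈)) , id)

    U⊆body : U ⊆ body P .verts
    U⊆body = subst (U ⊆_) (sym (cong verts body≡)) (λ v∈ → x∈p∪q⁺ (inj₂ v∈))

    proper-boundary⊆ : boundary P ⊆ body P .verts
    proper-boundary⊆ = subst (_⊆ body P .verts) (sym boundary≡) U⊆body

    -- Together with `interior⊑K` this identifies the interior of a proper part with a component of
    -- the graph minus `U`, so overlaps become statements on components.
    K⊑interior : K ⊑ interior P
    K⊑interior = (λ v∈ → ∈-∖⁺ (body P) (boundary P) (proj₁ K⊑body v∈)
      (K⇒∉U v∈ ∘ subst (_ ∈_) boundary≡)) , proj₂ K⊑body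

    interior⊑K : interior P ⊑ K
    interior⊑K = vs , (λ d∈ → subst (_ ∈_) (cong darts body≡) d∈)
      where
      vs : verts (interior P) ⊆ verts K
      vs {v} v∈ = Sum.[ id , (λ v∈U → contradiction (subst (v ∈_) (sym boundary≡) v∈U)
                                         (∈-∖⁻ (body P) (boundary P) v∈)) ]
        (x∈p∪q⁻ (verts K) U (subst (v ∈_) (cong verts body≡) (p─q⊆p _ (boundary P) v∈)))

    K-end : ∀ {d w} → d ∈ darts K → ι d ≡ just w → w ∉ U → w ∈ verts K
    K-end d∈ eq w∉ = component-step component-K
      (end (proj₂ (proj₁ component-K) d∈) (∈-∖⁺ (whole G) U ∈⊤ w∉) eq) d∈

    K-mate : ∀ {d} → d ∈ darts K → ƛ d ∈ darts K
    K-mate d∈ = component-step component-K (mate ∈⊤ ∈⊤) d∈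

    proper-isSubgraph : IsSubgraph (body P)
    proper-isSubgraph = (λ d d∈ → proj₂ K⊑body (K-mate (proj₂ interior⊑K d∈))) , ι-closed
      where
      ι-closed : ∀ d w → d ∈ darts (body P) → ι d ≡ just w → w ∈ verts (body P)
      ι-closed d w d∈ eq with w ∈? U
      ... | yes w∈ = U⊆body w∈
      ... | no w∉  = proj₁ K⊑body (K-end (proj₂ interior⊑K d∈) eq w∉)

    -- The block B stays connected when the other vertex x of U is removed, so that L is
    -- linked to y within B, and it can only be left through U.
    attaching-dart : ∀ {x y} → y ∈ verts B → x ∈ verts B → (∀ {w} → w ∈ U → w ≡ x ⊎ w ≡ y) →
                     x ∈ U → y ∈ U → x ≢ y → ¬ ¬ (∃[ d ] (d ∈ darts K × ι d ≡ just y))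
    attaching-dart {x} {y} y∈B x∈B U⊆ x∈U y∈U x≢y none with l , l∈ ← proj₁ (proj₁ (proj₂ component-L)) =
      linked-B block λ path → y∉L (linked-closed (_∈ᴿ L) forth back path l∈)
      where
      L⊑B : L ⊑ B
      L⊑B = ⊑-trans {A = L} {B ∖ U} {B} (proj₁ component-L) (∖-⊑ B U)
      y∉L : y ∉ verts L
      y∉L y∈ = ∈-∖⁻ B U (proj₁ (proj₁ component-L) y∈) y∈U
      not-y : ∀ {w} → w ∈ verts (B ∖ ⁅ x ⁆) → w ≢ y → w ∈ verts (B ∖ U)
      not-y {w} w∈ w≢y = ∈-∖⁺ B U (p─q⊆p (verts B) ⁅ x ⁆ w∈) λ w∈U →
        Sum.[ (λ { refl → ∈-∖⁻ B ⁅ w ⁆ w∈ (x∈⁅x⁆ w) }) , w≢y ] (U⊆ w∈U)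
      forth : ∀ {z z′} → Step (B ∖ ⁅ x ⁆) z z′ → z ∈ᴿ L → z′ ∈ᴿ L
      forth (mate d∈ e∈)        z∈ = component-step component-L (mate d∈ e∈) z∈
      forth (end {v = w} d∈ w∈ eq) z∈ with w Fin.≟ y
      -- Leaving `L` for y uses a dart of `L`, hence a dart of `K` at y, the very thing assumed
      -- absent.
      ... | yes refl = contradiction (_ , proj₂ L⊑K z∈ , eq) none
      ... | no w≢y   = component-step component-L (end d∈ (not-y w∈ w≢y) eq) z∈
      back : ∀ {z z′} → Step (B ∖ ⁅ x ⁆) z z′ → z′ ∈ᴿ L → z ∈ᴿ L
      back (mate d∈ e∈)   z∈ = component-step⁻ component-L (mate d∈ e∈) z∈
      back (end d∈ _ eq) z∈ = component-step⁻ component-L (end d∈ (proj₁ (proj₁ component-L) z∈) eq) z∈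
      l≢x : ∀ l → l ∈ᴿ L → l ≢ inj₁ x
      l≢x (inj₁ w) w∈ refl = ∈-∖⁻ B U (proj₁ (proj₁ component-L) w∈) x∈U
      linked-B : Block G B → ¬ ¬ Linked (B ∖ ⁅ x ⁆) l (inj₁ y)
      linked-B (maximal two _) = linked-without two x (⊑⇒∈ L⊑B l l∈) y∈B (l≢x l l∈) λ { refl → x≢y refl }
      linked-B (pendant (_ , w , _ , refl)) =
        contradiction (trans (x∈⁅y⁆⇒x≡y w x∈B) (sym (x∈⁅y⁆⇒x≡y w y∈B))) x≢y

    -- This is why `K` determines `U`, and why a subgraph containing the darts of `K` contains `U`
    -- as well.
    attached-by : ∀ {w} → w ∈ U → ¬ ¬ (∃[ d ] (d ∈ darts K × ι d ≡ just w))
    attached-by w∈ with ∈-pair⁻ w∈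
    ... | inj₁ refl = attaching-dart u∈B v∈B (Sum.swap ∘ ∈-pair⁻) (∈-pairʳ u v) w∈ (u≢v ∘ sym)
    ... | inj₂ refl = attaching-dart v∈B u∈B ∈-pair⁻ (∈-pairˡ u v) w∈ u≢v

    K-linked : ∀ {x y} → x ∈ᴿ K → y ∈ᴿ K → Linked K x y
    K-linked x∈ y∈ = proj₂ (proj₁ (proj₂ component-K)) _ _ x∈ y∈

  dipole-dipole : ∀ {P Q z} → Dipole G P → Dipole G Q → z ∈ᴿ interior P → z ∈ᴿ interior Q → P ≡ Q
  dipole-dipole {z = inj₁ v} dipP dipQ z∈P z∈Q = contradiction z∈P (dipole-vertexless dipP v)
  dipole-dipole {P} {Q} {inj₂ d} dipP dipQ z∈P z∈Q =
    cong₂ part (region-≡ (vs , ds) (vs′ , ds′)) (trans P.boundary≡ (trans same (sym Q.boundary≡)))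
    where
    module P = Dipole dipP
    module Q = Dipole dipQ
    jP = to (P.darts⇔ d) z∈P
    jQ = to (Q.darts⇔ d) z∈Q
    same = proj₂ (joins-agree jP jQ)
    verts-same : verts (body P) ≡ verts (body Q)
    verts-same = trans P.verts≡ (trans same (sym Q.verts≡))
    vs : verts (body P) ⊆ verts (body Q)
    vs = subst (_ ∈_) verts-same
    vs′ : verts (body Q) ⊆ verts (body P)
    vs′ = subst (_ ∈_) (sym verts-same)
    ds : darts (body P) ⊆ darts (body Q)
    ds e∈ = from (Q.darts⇔ _) (proj₁ (joins-agree jP jQ) _ (to (P.darts⇔ _) e∈))
    ds′ : darts (body Q) ⊆ darts (body P)
    ds′ e∈ = from (P.darts⇔ _) (proj₁ (joins-agree jQ jP) _ (to (Q.darts⇔ _) e∈))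

  -- Dipoles have no interior vertices, so a dart is shared. Its ends are boundary vertices of `P`
  -- and thus lie outside `K`; inside `K` its edge is isolated, and `K`, being connected, would be a
  -- single free edge.
  dipole-proper : ∀ {c P Q z} → Dipole G P → ProperPart G c Q → Avoids P Q →
                  z ∈ᴿ interior P → z ∈ᴿ interior Q → ⊥
  dipole-proper {z = inj₁ v} dip pp P#Q z∈P z∈Q = dipole-vertexless dip v z∈P
  dipole-proper {P = P} {Q} {z = inj₂ d} dip pp P#Q z∈P z∈Q =
    not-free-edge ((λ (w , w∈) → vertex-not-dart {G} (path (inj₁ w) w∈)) , d , ⊆-antisym K⊆ ⊆K)
    where
    open Dipole dip using (u; v; darts⇔)
    open ProperPart pp using (K; not-free-edge)
    d∈K : d ∈ darts K
    d∈K = proj₂ (interior⊑K pp) z∈Q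
    no-end : ∀ {e} → Joins G e u v → ∀ w → w ∈ verts K → ι e ≢ just w
    no-end j w w∈ eq = P#Q w (dipole-boundary dip (joins-ends j eq)) (proj₁ (K⊑interior pp) w∈)
    j : Joins G d u v
    j = to (darts⇔ d) z∈P
    path : ∀ y → y ∈ᴿ K → y ≡ inj₂ d ⊎ y ≡ inj₂ (ƛ d)
    path y y∈ = isolated K d (no-end j) (no-end (joins-ƛ j)) (K-linked pp {inj₂ d} {y} d∈K y∈)
    K⊆ : darts K ⊆ edge {G} d
    K⊆ {e} e∈ with path (inj₂ e) e∈
    ... | inj₁ refl = ∈-pairˡ d (ƛ d)
    ... | inj₂ refl = ∈-pairʳ d (ƛ d)
    ⊆K : edge {G} d ⊆ darts K
    ⊆K e∈ with ∈-edge⁻ {G} e∈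
    ... | inj₁ refl = d∈K
    ... | inj₂ refl = K-mate pp d∈K

  -- The cut of `Q` misses the interior of `P`, so the first component stays connected in the graph
  -- minus that cut and is absorbed by the component of `Q` containing `z`.
  K-contained : ∀ {c P Q z} (ppP : ProperPart G c P) (ppQ : ProperPart G c Q) → Avoids Q P →
                z ∈ᴿ interior P → z ∈ᴿ interior Q → ProperPart.K ppP ⊑ ProperPart.K ppQ
  K-contained {P = P} {z = z} ppP ppQ Q#P z∈P z∈Q =
    (λ {w} w∈ → absorb (inj₁ w) w∈) , (λ {d} d∈ → absorb (inj₂ d) d∈)
    where
    module P = ProperPart ppP
    module Q = ProperPart ppQ
    outside-U : P.K ⊑ whole G ∖ Q.U
    outside-U = (λ {w} w∈ → ∈-∖⁺ (whole G) Q.U ∈⊤ λ w∈U →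
      Q#P w (subst (w ∈_) (sym Q.boundary≡) w∈U) (proj₁ (K⊑interior ppP) w∈)) , λ _ → ∈⊤
    absorb : ∀ y → y ∈ᴿ P.K → y ∈ᴿ Q.K
    absorb y y∈ = proj₂ (proj₂ Q.component-K) z y (⊑⇒∈ (interior⊑K ppQ) z z∈Q)
      (⊑⇒∈ outside-U y y∈)
      (linked-mono outside-U (K-linked ppP {z} {y} (⊑⇒∈ (interior⊑K ppP) z z∈P) y∈))

  -- A dart of the common component leads to each vertex of the first cut; outside the second cut,
  -- that vertex would belong to the component itself.
  U-determined : ∀ {c P Q} (ppP : ProperPart G c P) (ppQ : ProperPart G c Q) →
                 ProperPart.K ppP ≡ ProperPart.K ppQ → ProperPart.U ppP ⊆ ProperPart.U ppQ
  U-determined ppP ppQ eq {w} w∈ = decidable-stable (w ∈? ProperPart.U ppQ) λ w∉ →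
    attached-by ppP w∈ λ (d , d∈ , ιd) →
      ∈-∖⁻ (whole G) (ProperPart.U ppP) (proj₁ (proj₁ (ProperPart.component-K ppP))
        (subst (λ K → w ∈ verts K) (sym eq) (K-end ppQ (subst (λ K → d ∈ darts K) eq d∈) ιd w∉))) w∈

  proper-proper : ∀ {c P Q z} → ProperPart G c P → ProperPart G c Q → Avoids P Q → Avoids Q P →
                  z ∈ᴿ interior P → z ∈ᴿ interior Q → P ≡ Q
  proper-proper {P = P} {Q} {z} ppP ppQ P#Q Q#P z∈P z∈Q =
    trans (part≡ ppP) (trans (cong₂ assemble K≡ U≡) (sym (part≡ ppQ)))
    where
    assemble : Region G → Subset #V → Part G
    assemble K U = part (region (verts K ∪ U) (darts K)) U
    part≡ : ∀ {c P} (pp : ProperPart G c P) → P ≡ assemble (ProperPart.K pp) (ProperPart.U pp)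
    part≡ pp = cong₂ part (ProperPart.body≡ pp) (ProperPart.boundary≡ pp)
    K≡ : ProperPart.K ppP ≡ ProperPart.K ppQ
    K≡ = region-≡ (K-contained {z = z} ppP ppQ Q#P z∈P z∈Q) (K-contained {z = z} ppQ ppP P#Q z∈Q z∈P)
    U≡ : ProperPart.U ppP ≡ ProperPart.U ppQ
    U≡ = ⊆-antisym (U-determined ppP ppQ K≡) (U-determined ppQ ppP (sym K≡))

  -- The shared dart lies in a block of `Q`, and this block swallows the whole dipole by maximality.
  -- Minimality of `Q` then makes the bodies equal, and `dipole-first` fixes the boundary.
  dipole-union : ∀ {c P Q x z} → Dipole G P → IsPart G c P → IsAtom G c Q →
                 UnionOfSubtree G c x (body Q) → z ∈ᴿ interior P → z ∈ᴿ interior Q → P ≡ Q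
  dipole-union {z = inj₁ v} dip part-P atom-Q union z∈P z∈Q = contradiction z∈P (dipole-vertexless dip v)
  dipole-union {P = P} {Q} {z = inj₂ d} dip part-P atom-Q union z∈P z∈Q =
    cong₂ part body≡ (dipole-first (boundary P) (subst (λ A → Dipole G (part A (boundary P))) body≡ dip))
    where
    open Dipole dip
    open IsAtom atom-Q
    j : Joins G d u v
    j = to (darts⇔ d) z∈P
    dipole⊑ : ∀ {Y} → Block G Y → d ∈ darts Y → body P ⊑ Y
    dipole⊑ {Y} (maximal two@((ƛ-closed , ι-closed) , _) max) d∈Y =
      subst (body P ⊑_) (max (Y ⊔ᴿ body P)
        (twoConnected-⊔ Y (body P) two (dipole-twoConnected dip) u≢v (proj₁ (ends-in j)) (proj₂ (ends-in j))
          (subst (u ∈_) (sym verts≡) (∈-pairˡ u v)) (subst (v ∈_) (sym verts≡) (∈-pairʳ u v)))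
        (⊑-⊔ˡ Y (body P)))
        (⊑-⊔ʳ Y (body P))
      where
      ends-in : Joins G d u v → u ∈ verts Y × v ∈ verts Y
      ends-in (inj₁ (p , q)) = ι-closed d u d∈Y p , ι-closed (ƛ d) v (ƛ-closed d d∈Y) q
      ends-in (inj₂ (p , q)) = ι-closed (ƛ d) u (ƛ-closed d d∈Y) q , ι-closed d v d∈Y p
    dipole⊑ (pendant (e , w , pend , refl)) d∈Y with pendant⇒undefined {G} pend d∈Y
    ... | inj₁ none with () ← trans (sym (proj₂ (joins-end j))) none
    ... | inj₂ none with () ← trans (sym (proj₂ (joins-end (joins-ƛ j)))) none
    body≡ : body P ≡ body Q
    body≡ = let Y , s , d∈Y = to (proj₂ union d) z∈Q in
      minimal P part-P (⊑-trans {A = body P} {Y} {body Q} (dipole⊑ (proj₁ s) d∈Y) (block⊑union union s))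

  attached-boundary⊆ : {P : Part G} → IsBoundary (body P) (boundary P) → boundary P ⊆ body P .verts
  attached-boundary⊆ bd v∈ = proj₁ (to (bd _) v∈)

  interior-incident : {P : Part G} → ∀ {v d} → IsBoundary (body P) (boundary P) → v ∈ verts (interior P) →
                      ι d ≡ just v → d ∈ darts (body P)
  interior-incident {P} {v} {d} bd v∈ eq = decidable-stable (d ∈? darts (body P)) λ d∉ →
    ∈-∖⁻ (body P) (boundary P) v∈ (from (bd v) (p─q⊆p _ (boundary P) v∈ , d , d∉ , eq))

  -- The connected region `K` can leave the interior of `Q` only through the boundary of `Q`, which
  -- avoids it. So `K` lies in `Q`, the cut follows by `attached-by`, and minimality of `Q` gives
  -- equal bodies.
  proper-attached : ∀ {c P Q x z} → ProperPart G c P → IsAtom G c Q →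
                    UnionOfSubtree G c x (body Q) → IsBoundary (body Q) (boundary Q) →
                    Avoids P Q → Avoids Q P → z ∈ᴿ interior P → z ∈ᴿ interior Q → P ≡ Q
  proper-attached {P = P} {Q} {z = z} pp atom-Q union bd P#Q Q#P z∈P z∈Q =
    boundary-unique P Q (IsAtom.minimal atom-Q P (inj₂ (inj₁ pp)) body⊑) P#Q Q#P
      (proper-boundary⊆ pp) (attached-boundary⊆ {Q} bd)
    where
    open ProperPart pp
    subgraph : IsSubgraph (body Q)
    subgraph = union-isSubgraph union
    forth : ∀ {x y} → Step K x y → x ∈ᴿ interior Q → y ∈ᴿ interior Q
    forth (mate {d} _ _)    d∈ = proj₁ subgraph d d∈
    forth (end _ w∈ eq) d∈ = ∈-∖⁺ (body Q) (boundary Q) (proj₂ subgraph _ _ d∈ eq)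
      λ w∈∂ → Q#P _ w∈∂ (proj₁ (K⊑interior pp) w∈)
    back : ∀ {x y} → Step K x y → y ∈ᴿ interior Q → x ∈ᴿ interior Q
    back (mate {d} _ _)    d∈ = subst (_∈ darts (body Q)) (ƛ-involutive d) (proj₁ subgraph (ƛ d) d∈)
    back (end _ _ eq) w∈ = interior-incident {Q} bd w∈ eq
    absorb : ∀ y → y ∈ᴿ K → y ∈ᴿ interior Q
    absorb y y∈ = linked-closed (_∈ᴿ interior Q) forth back
      (K-linked pp {z} {y} (⊑⇒∈ (interior⊑K pp) z z∈P) y∈) z∈Q
    body⊑ : body P ⊑ body Q
    body⊑ = subst (_⊑ body Q) (sym body≡) (vs , λ {d} d∈ → absorb (inj₂ d) d∈)
      where
      vs : verts K ∪ U ⊆ verts (body Q)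
      vs {w} w∈ with x∈p∪q⁻ (verts K) U w∈
      ... | inj₁ w∈K = interior⇒body Q (inj₁ w) (absorb (inj₁ w) w∈K)
      ... | inj₂ w∈U = decidable-stable (w ∈? verts (body Q)) λ w∉ →
        attached-by pp w∈U λ (d , d∈ , eq) → w∉ (proj₂ subgraph d w (absorb (inj₂ d) d∈) eq)

  module _ {o : Vertex} {S : Region G} (union : UnionOfSubtree G (art o) (art o) S) where

    walk⊑union : ∀ {B} → Block G B → Walk G (blk B) (art o) → B ⊑ S
    walk⊑union block w = block⊑union union (block , inj₂ (w , target∈visited))

    -- A walk in the block-tree becomes a link in `S`, as consecutive blocks share the articulation
    -- between them.
    linked-art : ∀ {v} → Walk G (art v) (art o) → Linked S (inj₁ v) (inj₁ o)
    linked-blk : ∀ {B z} → Walk G (blk B) (art o) → z ∈ᴿ B → Linked S z (inj₁ o)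
    linked-art done = done
    linked-art {v} (down _ _ v∈ ◅ w) = linked-blk {z = inj₁ v} w v∈
    linked-blk {z = z} path@(up {v} a block v∈ ◅ w) z∈ = linked-trans
      (linked-mono (walk⊑union block path) (block-linked {x = z} {inj₁ v} block z∈ v∈)) (linked-art w)

  -- If `o` is not in the cut, then the cut misses all of `Q`, and `K` extends from `z` through `Q`
  -- up to `o`, against `not-central`. If `o` is in the cut, the block `B` is adjacent to the centre
  -- and hence contained in `Q`; a cut vertex other than `o` would be interior to `Q`, so both cut
  -- vertices equal `o`.
  proper-central : ∀ {o P Q z} → ProperPart G (art o) P → Articulation G o →
                   UnionOfSubtree G (art o) (art o) (body Q) → boundary Q ≡ ⁅ o ⁆ →
                   Avoids P Q → z ∈ᴿ interior P → z ∈ᴿ interior Q → ⊥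
  proper-central {o} {P} {Q} {z} pp art-o union bd P#Q z∈P z∈Q with o ∈? ProperPart.U pp
  ... | no o∉ = not-central (linked-closed (_∈ᴿ K) forth back (to-o z (interior⇒body Q z z∈Q))
                  (⊑⇒∈ (interior⊑K pp) z z∈P))
    where
    open ProperPart pp
    to-o : ∀ z → z ∈ᴿ body Q → Linked (body Q) z (inj₁ o)
    to-o (inj₁ v) v∈ with to (proj₁ union v) v∈
    ... | _ , (_ , inj₂ (w , _)) , v∈B = linked-blk union {z = inj₁ v} w v∈B
    to-o (inj₂ d) d∈ with to (proj₂ union d) d∈
    ... | _ , (_ , inj₂ (w , _)) , d∈B = linked-blk union {z = inj₂ d} w d∈B
    outside-U : body Q ⊑ whole G ∖ U
    outside-U = (λ {w} w∈ → ∈-∖⁺ (whole G) U ∈⊤ λ w∈U →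
        P#Q w (subst (w ∈_) (sym boundary≡) w∈U) (∈-∖⁺ (body Q) (boundary Q) w∈ λ w∈∂ →
          o∉ (subst (_∈ U) (x∈⁅y⁆⇒x≡y o (subst (w ∈_) bd w∈∂)) w∈U)))
      , λ _ → ∈⊤
    forth : ∀ {x y} → Step (body Q) x y → x ∈ᴿ K → y ∈ᴿ K
    forth s = component-step component-K (step-mono outside-U s)
    back : ∀ {x y} → Step (body Q) x y → y ∈ᴿ K → x ∈ᴿ K
    back s = component-step⁻ component-K (step-mono outside-U s)
  ... | yes o∈ = both-o (is-o u∈B (∈-pairˡ u v)) (is-o v∈B (∈-pairʳ u v))
    where
    open ProperPart pp
    o∈B : o ∈ verts B
    o∈B with ∈-pair⁻ o∈
    ... | inj₁ refl = u∈B
    ... | inj₂ refl = v∈B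
    is-o : ∀ {w} → w ∈ verts B → w ∈ U → w ≡ o
    is-o {w} w∈B w∈U = decidable-stable (w Fin.≟ o) λ w≢o →
      P#Q w (subst (w ∈_) (sym boundary≡) w∈U)
        (∈-∖⁺ (body Q) (boundary Q) (proj₁ (walk⊑union union block (up art-o block o∈B ◅ done)) w∈B)
          (w≢o ∘ x∈⁅y⁆⇒x≡y o ∘ subst (w ∈_) bd))
    both-o : u ≡ o → v ≡ o → ⊥
    both-o p q = u≢v (trans p (sym q))

  data Boundary (c : Node G) (x : Node G) (P : Part G) : Set where
    attached : IsBoundary (body P) (boundary P) → Boundary c x P
    central  : ∀ u → art u ≡ c → x ≡ c → boundary P ≡ ⁅ u ⁆ → Boundary c x P

  blockPart-boundary : ∀ {c P} → BlockPart G c P →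
                       ∃[ x ] (IsNode G x × UnionOfSubtree G c x (body P) × Boundary c x P)
  blockPart-boundary (attached x node _ union _ bd)     = x , node , union , attached bd
  blockPart-boundary (central u node eq union _ bd) = art u , node , union , central u eq eq bd

  -- A vertex interior to `P` has all its darts in `P`, and one of them belongs to the block of `Q`
  -- that contains the vertex.
  shared-dart : ∀ {c x P Q z y} → UnionOfSubtree G c x (body P) → UnionOfSubtree G c y (body Q) →
                IsBoundary (body P) (boundary P) → z ∈ᴿ interior P → z ∈ᴿ interior Q →
                ∃[ d ] (d ∈ darts (body P) × d ∈ darts (body Q))
  shared-dart {z = inj₂ d} _ _ _ d∈P d∈Q = d , d∈P , d∈Q
  shared-dart {P = P} {Q} {z = inj₁ v} _ union bd v∈P v∈Q
    with Y , s , v∈Y ← to (proj₁ union v) (p─q⊆p _ (boundary Q) v∈Q)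
    with d , d∈Y , eq ← block-incident (proj₁ s) v∈Y =
    d , interior-incident {P} bd v∈P eq , proj₂ (block⊑union union s) d∈Y

  -- The shared dart singles out one block below both x and y. Hence x and y are comparable in the
  -- tree, one union contains the other, and minimality of the larger makes them equal.
  union-body : ∀ {c x y P Q d} → IsAtom G c P → IsAtom G c Q → IsNode G x → IsNode G y →
               BlockPart G c P → BlockPart G c Q →
               UnionOfSubtree G c x (body P) → UnionOfSubtree G c y (body Q) →
               d ∈ darts (body P) → d ∈ darts (body Q) → ¬ ¬ (body P ≡ body Q)
  union-body {d = d} atom-P atom-Q nx ny part-P part-Q union-P union-Q d∈P d∈Q k
    with Y , s , d∈Y ← to (proj₂ union-P d) d∈P
       | Z , t , d∈Z ← to (proj₂ union-Q d) d∈Q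
    with refl ← block-unique (proj₁ s) (proj₁ t) d∈Y d∈Z =
    inSubtree-total nx ny s t λ where
      (inj₁ x≤y) → k (sym (IsAtom.minimal atom-P _ (inj₁ part-Q)
        (unionOfSubtree-mono (λ _ → inSubtree-trans x≤y) union-Q union-P)))
      (inj₂ y≤x) → k (IsAtom.minimal atom-Q _ (inj₁ part-P)
        (unionOfSubtree-mono (λ _ → inSubtree-trans y≤x) union-P union-Q))

  block-block : ∀ {c P Q z} → IsAtom G c P → IsAtom G c Q → BlockPart G c P → BlockPart G c Q →
                Avoids P Q → Avoids Q P → Nonempty (boundary P) → Nonempty (boundary Q) →
                z ∈ᴿ interior P → z ∈ᴿ interior Q → ¬ ¬ (P ≡ Q)
  block-block {P = P} {Q} {z} atom-P atom-Q part-P part-Q P#Q Q#P ∂P ∂Q z∈P z∈Q k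
    with x , nx , union-P , bP ← blockPart-boundary part-P
       | y , ny , union-Q , bQ ← blockPart-boundary part-Q
    with bP | bQ
  ... | attached bdP | attached bdQ
      with d , d∈P , d∈Q ← shared-dart {P = P} {Q} {z} union-P union-Q bdP z∈P z∈Q =
        union-body {P = P} {Q} atom-P atom-Q nx ny part-P part-Q union-P union-Q d∈P d∈Q λ eq →
          k (boundary-unique P Q eq P#Q Q#P (attached-boundary⊆ {P} bdP) (attached-boundary⊆ {Q} bdQ))
  ... | attached bdP | central o _ _ bdQ
      with d , d∈P , d∈Q ← shared-dart {P = P} {Q} {z} union-P union-Q bdP z∈P z∈Q =
        union-body {P = P} {Q} atom-P atom-Q nx ny part-P part-Q union-P union-Q d∈P d∈Q λ eq →
          k (boundary-unique-singleton P Q eq P#Q ∂P (attached-boundary⊆ {P} bdP) o bdQ)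
  ... | central o _ _ bdP | attached bdQ
      with d , d∈Q , d∈P ← shared-dart {P = Q} {P} {z} union-Q union-P bdQ z∈Q z∈P =
        union-body {P = P} {Q} atom-P atom-Q nx ny part-P part-Q union-P union-Q d∈P d∈Q λ eq →
          k (sym (boundary-unique-singleton Q P (sym eq) Q#P ∂Q (attached-boundary⊆ {Q} bdQ) o bdP))
  ... | central o refl refl bdP | central .o refl refl bdQ =
        k (cong₂ part (region-≡ (unionOfSubtree-mono (λ _ → id) union-P union-Q)
                                (unionOfSubtree-mono (λ _ → id) union-Q union-P)) (trans bdP (sym bdQ)))

  proper-block : ∀ {c P Q z} → ProperPart G c P → IsAtom G c Q → BlockPart G c Q →
                 Avoids P Q → Avoids Q P → z ∈ᴿ interior P → z ∈ᴿ interior Q → P ≡ Q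
  proper-block {P = P} {Q} {z} pp atom-Q (attached _ _ _ union _ bd) P#Q Q#P z∈P z∈Q =
    proper-attached {P = P} {Q} {z = z} pp atom-Q union bd P#Q Q#P z∈P z∈Q
  proper-block {P = P} {Q} {z} pp atom-Q (central o node refl union _ bd) P#Q Q#P z∈P z∈Q =
    ⊥-elim (proper-central {P = P} {Q} {z} pp node union bd P#Q z∈P z∈Q)

  -- Doubly negated because two block atoms are compared through `inSubtree-total`;
  -- `interiors-disjoint` removes this.
  atoms-disjoint : ∀ {c P Q z} → IsAtom G c P → IsAtom G c Q → Avoids P Q → Avoids Q P →
                   Nonempty (boundary P) → Nonempty (boundary Q) →
                   z ∈ᴿ interior P → z ∈ᴿ interior Q → ¬ ¬ (P ≡ Q)
  atoms-disjoint {P = P} {Q} {z} atom-P atom-Q P#Q Q#P ∂P ∂Q z∈P z∈Q k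
    with IsAtom.isPart atom-P | IsAtom.isPart atom-Q
  ... | inj₁ bP        | inj₁ bQ        = block-block {z = z} atom-P atom-Q bP bQ P#Q Q#P ∂P ∂Q z∈P z∈Q k
  ... | inj₁ bP        | inj₂ (inj₁ pQ) = k (sym (proper-block {z = z} pQ atom-P bP Q#P P#Q z∈Q z∈P))
  ... | inj₁ bP        | inj₂ (inj₂ dQ) with _ , _ , union , _ ← blockPart-boundary bP =
        k (sym (dipole-union {z = z} dQ (inj₂ (inj₂ dQ)) atom-P union z∈Q z∈P))
  ... | inj₂ (inj₁ pP) | inj₁ bQ        = k (proper-block {z = z} pP atom-Q bQ P#Q Q#P z∈P z∈Q)
  ... | inj₂ (inj₁ pP) | inj₂ (inj₁ pQ) = k (proper-proper {z = z} pP pQ P#Q Q#P z∈P z∈Q)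
  ... | inj₂ (inj₁ pP) | inj₂ (inj₂ dQ) = dipole-proper {z = z} dQ pP Q#P z∈Q z∈P
  ... | inj₂ (inj₂ dP) | inj₁ bQ        with _ , _ , union , _ ← blockPart-boundary bQ =
        k (dipole-union {z = z} dP (inj₂ (inj₂ dP)) atom-Q union z∈P z∈Q)
  ... | inj₂ (inj₂ dP) | inj₂ (inj₁ pQ) = dipole-proper {z = z} dP pQ P#Q z∈P z∈Q
  ... | inj₂ (inj₂ dP) | inj₂ (inj₂ dQ) = k (dipole-dipole {z = z} dP dQ z∈P z∈Q)

-- Edge types under automorphisms

module _ {G : Graph} where
  open Graph G
  open Automorphism

  imagePart-cong : ∀ {π σ : Automorphism G} → π ≈ᴬ σ → ∀ P → imagePart π P ≡ imagePart σ P
  imagePart-cong {π} {σ} (eqV , eqD) P = cong₂ part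
    (cong₂ region (permute-cong {ρ = onV π} {onV σ} eqV (verts (body P)))
                  (permute-cong {ρ = onD π} {onD σ} eqD (darts (body P))))
    (permute-cong {ρ = onV π} {onV σ} eqV (boundary P))

  imagePart-∘ : ∀ (π σ : Automorphism G) P → imagePart (π ∘ᴬ σ) P ≡ imagePart π (imagePart σ P)
  imagePart-∘ π σ P = cong₂ part
    (cong₂ region (permute-∘ (onV π) (onV σ) (verts (body P))) (permute-∘ (onD π) (onD σ) (darts (body P))))
    (permute-∘ (onV π) (onV σ) (boundary P))

  imagePart-id : ∀ P → imagePart (idᴬ {G}) P ≡ P
  imagePart-id P = cong₂ (part {G})
    (cong₂ (region {G}) (tabulate∘lookup (verts (body P))) (tabulate∘lookup (darts (body P))))
    (tabulate∘lookup (boundary P))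

  interior-image : ∀ (π : Automorphism G) P → interior (imagePart π P) ≡ imageRegion π (interior P)
  interior-image π P = sym (imageRegion-∖ π (body P) (boundary P))

  ∂-iso-image : ∀ (π : Automorphism G) P → ∂-Iso P (imagePart π P)
  ∂-iso-image π P = record
    { toV       = onV π ⟨$⟩ʳ_
    ; fromV     = onV π ⟨$⟩ˡ_
    ; toD       = onD π ⟨$⟩ʳ_
    ; fromD     = onD π ⟨$⟩ˡ_
    ; toV-∈     = ∈-permute⁺ (onV π)
    ; fromV-∈   = back (onV π) (verts (body P))
    ; toD-∈     = ∈-permute⁺ (onD π)
    ; fromD-∈   = back (onD π) (darts (body P))
    ; fromV∘toV = λ _ → Perm.inverseˡ (onV π)
    ; toV∘fromV = λ _ → Perm.inverseʳ (onV π)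
    ; fromD∘toD = λ _ → Perm.inverseˡ (onD π)
    ; toD∘fromD = λ _ → Perm.inverseʳ (onD π)
    ; ι-comm    = λ _ → ι-comm π _
    ; ƛ-comm    = λ _ → ƛ-comm π _
    ; colour≡   = λ _ → colour≡ π _
    ; label≡    = λ _ → label≡ π _
    ; boundary⇔ = λ _ → mk⇔ (∈-permute⁺ (onV π)) (∈-permute⁻′ (onV π) (boundary P))
    }
    where
    back : ∀ {n} (ρ : Permutation′ n) X {v} → v ∈ permute ρ X → ρ ⟨$⟩ˡ v ∈ X
    back ρ X v∈ with w , w∈ , refl ← ∈-permute⁻ ρ X v∈ = subst (_∈ X) (sym (Perm.inverseˡ ρ)) w∈

  ∂-iso-∘ : ∀ {P Q R : Part G} → ∂-Iso Q R → ∂-Iso P Q → ∂-Iso P R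
  ∂-iso-∘ g f = record
    { toV       = g.toV ∘ f.toV
    ; fromV     = f.fromV ∘ g.fromV
    ; toD       = g.toD ∘ f.toD
    ; fromD     = f.fromD ∘ g.fromD
    ; toV-∈     = g.toV-∈ ∘ f.toV-∈
    ; fromV-∈   = f.fromV-∈ ∘ g.fromV-∈
    ; toD-∈     = g.toD-∈ ∘ f.toD-∈
    ; fromD-∈   = f.fromD-∈ ∘ g.fromD-∈
    ; fromV∘toV = λ v∈ → trans (cong f.fromV (g.fromV∘toV (f.toV-∈ v∈))) (f.fromV∘toV v∈)
    ; toV∘fromV = λ v∈ → trans (cong g.toV (f.toV∘fromV (g.fromV-∈ v∈))) (g.toV∘fromV v∈)
    ; fromD∘toD = λ d∈ → trans (cong f.fromD (g.fromD∘toD (f.toD-∈ d∈))) (f.fromD∘toD d∈)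
    ; toD∘fromD = λ d∈ → trans (cong g.toD (f.toD∘fromD (g.fromD-∈ d∈))) (g.toD∘fromD d∈)
    ; ι-comm    = λ {d} d∈ → trans (g.ι-comm (f.toD-∈ d∈))
                    (trans (cong (Maybe.map g.toV) (f.ι-comm d∈)) (map-∘′ {G} g.toV f.toV (ι d)))
    ; ƛ-comm    = λ d∈ → trans (g.ƛ-comm (f.toD-∈ d∈)) (cong g.toD (f.ƛ-comm d∈))
    ; colour≡   = λ d∈ → trans (g.colour≡ (f.toD-∈ d∈)) (f.colour≡ d∈)
    ; label≡    = λ d∈ → trans (g.label≡ (f.toD-∈ d∈)) (f.label≡ d∈)
    ; boundary⇔ = λ v∈ → mk⇔ (to (g.boundary⇔ (f.toV-∈ v∈)) ∘ to (f.boundary⇔ v∈))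
                             (from (f.boundary⇔ v∈) ∘ from (g.boundary⇔ (f.toV-∈ v∈)))
    }
    where
    module f = ∂-Iso f
    module g = ∂-Iso g

  ∂-iso-image⁻ : ∀ (π : Automorphism G) P → ∂-Iso (imagePart π P) P
  ∂-iso-image⁻ π P =
    subst (∂-Iso (imagePart π P)) (imagePart-inverse′ π P) (∂-iso-image (π ⁻¹ᴬ) (imagePart π P))

  conjugate : ∀ (π : Automorphism G) {P} → ∂-Aut P → ∂-Aut (imagePart π P)
  conjugate π {P} τ = ∂-iso-∘ (∂-iso-image π P) (∂-iso-∘ τ (∂-iso-image⁻ π P))

  module _ (π : Automorphism G) {P : Part G} (τ : ∂-Aut P) where
    open ∂-Iso τ

    private
      τ′ = conjugate π τ

    conjugate-V : ∀ v → ∂-Iso.toV τ′ (onV π ⟨$⟩ʳ v) ≡ onV π ⟨$⟩ʳ toV v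
    conjugate-V v = cong (λ v → onV π ⟨$⟩ʳ toV v)
      (trans (image⁻-V (imagePart-inverse′ π P)) (Perm.inverseˡ (onV π)))
      where
      -- `∂-iso-image⁻` is a transport along an equality of parts; the transport leaves the
      -- underlying maps unchanged.
      image⁻-V : ∀ {Q R S} {f : ∂-Iso Q R} (eq : R ≡ S) {v} →
                 ∂-Iso.toV (subst (∂-Iso Q) eq f) v ≡ ∂-Iso.toV f v
      image⁻-V refl = refl

    conjugate-D : ∀ d → ∂-Iso.toD τ′ (onD π ⟨$⟩ʳ d) ≡ onD π ⟨$⟩ʳ toD d
    conjugate-D d = cong (λ d → onD π ⟨$⟩ʳ toD d)
      (trans (image⁻-D (imagePart-inverse′ π P)) (Perm.inverseˡ (onD π)))
      where
      image⁻-D : ∀ {Q R S} {f : ∂-Iso Q R} (eq : R ≡ S) {d} →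
                 ∂-Iso.toD (subst (∂-Iso Q) eq f) d ≡ ∂-Iso.toD f d
      image⁻-D refl = refl

    iterate-V : ∀ k v → iterate {G} (∂-Iso.toV τ′) k (onV π ⟨$⟩ʳ v) ≡ onV π ⟨$⟩ʳ iterate {G} toV k v
    iterate-V 0       v = refl
    iterate-V (suc k) v = trans (cong (∂-Iso.toV τ′) (iterate-V k v)) (conjugate-V _)

    iterate-D : ∀ k d → iterate {G} (∂-Iso.toD τ′) k (onD π ⟨$⟩ʳ d) ≡ onD π ⟨$⟩ʳ iterate {G} toD k d
    iterate-D 0       d = refl
    iterate-D (suc k) d = trans (cong (∂-Iso.toD τ′) (iterate-D k d)) (conjugate-D _)

    identityPower-conjugate : ∀ k → IdentityPower τ k → IdentityPower τ′ k
    identityPower-conjugate k (idV , idD) = idV′ , idD′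
      where
      idV′ : ∀ v → v ∈ imageV π (verts (body P)) → iterate {G} (∂-Iso.toV τ′) k v ≡ v
      idV′ v v∈ with w , w∈ , refl ← ∈-permute⁻ (onV π) (verts (body P)) v∈ =
        trans (iterate-V k w) (cong (onV π ⟨$⟩ʳ_) (idV w w∈))
      idD′ : ∀ d → d ∈ imageD π (darts (body P)) → iterate {G} (∂-Iso.toD τ′) k d ≡ d
      idD′ d d∈ with e , e∈ , refl ← ∈-permute⁻ (onD π) (darts (body P)) d∈ =
        trans (iterate-D k e) (cong (onD π ⟨$⟩ʳ_) (idD e e∈))

    identityPower-reflect : ∀ k → IdentityPower τ′ k → IdentityPower τ k
    identityPower-reflect k (idV , idD) =
        (λ v v∈ → permute-injective (onV π) (trans (sym (iterate-V k v)) (idV _ (∈-permute⁺ (onV π) v∈))))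
      , (λ d d∈ → permute-injective (onD π) (trans (sym (iterate-D k d)) (idD _ (∈-permute⁺ (onD π) d∈))))

    fixingPower-reflect : ∀ k → FixingPower τ′ k → FixingPower τ k
    fixingPower-reflect k (inj₁ (v , v∈ , eq))
      with w , w∈ , refl ← ∈-permute⁻ (onV π) (verts (body P)) v∈ =
      inj₁ (w , w∈ , permute-injective (onV π) (trans (sym (iterate-V k w)) eq))
    fixingPower-reflect k (inj₂ (inj₁ (d , d∈ , eq)))
      with e , e∈ , refl ← ∈-permute⁻ (onD π) (darts (body P)) d∈ =
      inj₂ (inj₁ (e , e∈ , permute-injective (onD π) (trans (sym (iterate-D k e)) eq)))
    fixingPower-reflect k (inj₂ (inj₂ (d , d∈ , ≢halvable , eq)))
      with e , e∈ , refl ← ∈-permute⁻ (onD π) (darts (body P)) d∈ =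
      inj₂ (inj₂ (e , e∈ , ≢halvable ∘ trans (label≡ π e)
        , permute-injective (onD π) (trans (sym (iterate-D k e)) (trans eq (Automorphism.ƛ-comm π e)))))

    -- A fixed element is carried back to `P`, where semiregularity of τ makes the power trivial,
    -- and triviality is carried forward again.
    semiregular-conjugate : Semiregular τ → Semiregular τ′
    semiregular-conjugate semi k = identityPower-conjugate k ∘ semi k ∘ fixingPower-reflect k

    exchanges-conjugate : ∀ {u v} → Exchanges τ u v → Exchanges τ′ (onV π ⟨$⟩ʳ u) (onV π ⟨$⟩ʳ v)
    exchanges-conjugate (p , q) =
        trans (conjugate-V _) (cong (onV π ⟨$⟩ʳ_) p) , trans (conjugate-V _) (cong (onV π ⟨$⟩ʳ_) q)

  halvable-image : ∀ (π : Automorphism G) {P u v} → Halvable P u v →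
                   Halvable (imagePart π P) (onV π ⟨$⟩ʳ u) (onV π ⟨$⟩ʳ v)
  halvable-image π (τ , semi , (nontrivial , square) , exchanges) =
    conjugate π τ , semiregular-conjugate π τ semi ,
    (nontrivial ∘ identityPower-reflect π τ 1 , identityPower-conjugate π τ 2 square) ,
    exchanges-conjugate π τ exchanges

  halvable-swap : ∀ {P : Part G} {u v} → Halvable P u v → Halvable P v u
  halvable-swap (τ , semi , inv , p , q) = τ , semi , inv , q , p

  symmetric-swap : ∀ {P : Part G} {u v} → Symmetric P u v → Symmetric P v u
  symmetric-swap (¬h , τ , p , q) = ¬h ∘ halvable-swap , τ , q , p

  pair-≡ : ∀ {n} {u v u′ v′ : Fin n} → u ≢ v → ⁅ u ⁆ ∪ ⁅ v ⁆ ≡ ⁅ u′ ⁆ ∪ ⁅ v′ ⁆ →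
           (u ≡ u′ × v ≡ v′) ⊎ (u ≡ v′ × v ≡ u′)
  pair-≡ {u = u} {v} u≢v eq
    with ∈-pair⁻ (subst (u ∈_) eq (∈-pairˡ u v)) | ∈-pair⁻ (subst (v ∈_) eq (∈-pairʳ u v))
  ... | inj₁ refl | inj₁ refl = contradiction refl u≢v
  ... | inj₁ refl | inj₂ refl = inj₁ (refl , refl)
  ... | inj₂ refl | inj₁ refl = inj₂ (refl , refl)
  ... | inj₂ refl | inj₂ refl = contradiction refl u≢v

  halvable-reflect : ∀ (π : Automorphism G) {P u v} →
                     Halvable (imagePart π P) (onV π ⟨$⟩ʳ u) (onV π ⟨$⟩ʳ v) → Halvable P u v
  halvable-reflect π {P} {u} {v} h =
    subst₂ (λ u v → Halvable P u v) (Perm.inverseˡ (onV π)) (Perm.inverseˡ (onV π))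
      (subst (λ Q → Halvable Q (onV π ⟨$⟩ˡ (onV π ⟨$⟩ʳ u)) (onV π ⟨$⟩ˡ (onV π ⟨$⟩ʳ v)))
        (imagePart-inverse′ π P) (halvable-image (π ⁻¹ᴬ) h))

  symmetric-image : ∀ (π : Automorphism G) {P u v} → Symmetric P u v →
                    Symmetric (imagePart π P) (onV π ⟨$⟩ʳ u) (onV π ⟨$⟩ʳ v)
  symmetric-image π (¬h , τ , exchanges) =
    ¬h ∘ halvable-reflect π , conjugate π τ , exchanges-conjugate π τ exchanges

  -- The `double` case of `LabelOfType` with the ends as arguments, so that they can be
  -- interchanged.
  EdgeType : Part G → Vertex → Vertex → Label → Set
  EdgeType P u v l = (Halvable P u v × l ≡ halvable) ⊎ (Symmetric P u v × l ≡ undirected) ⊎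
                 (Asymmetric P u v × Directed l)

  type-swap : ∀ {P u v l} → EdgeType P u v l → EdgeType P v u l
  type-swap = Sum.map (λ (h , eq) → halvable-swap h , eq) (Sum.map
    (λ (s , eq) → symmetric-swap s , eq)
    (λ ((¬h , ¬s) , dir) → (¬h ∘ halvable-swap , ¬s ∘ symmetric-swap) , dir))

  -- Halvable and symmetric atoms leave only one label, and unequal types contradict conjugation by
  -- π or its inverse. A directed edge admits two labels; the last hypothesis decides between them
  -- and is discharged by `consistent`.
  type-image : ∀ (π : Automorphism G) {P u v l l′} → EdgeType P u v l →
               EdgeType (imagePart π P) (onV π ⟨$⟩ʳ u) (onV π ⟨$⟩ʳ v) l′ → (Directed l → l′ ≡ l) → l′ ≡ l
  type-image π (inj₁ (h , refl))         (inj₁ (_ , eq))                _ = eq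
  type-image π (inj₁ (h , _))            (inj₂ (inj₁ ((¬h , _) , _)))   _ = contradiction (halvable-image π h) ¬h
  type-image π (inj₁ (h , _))            (inj₂ (inj₂ ((¬h , _) , _)))   _ = contradiction (halvable-image π h) ¬h
  type-image π (inj₂ (inj₁ ((¬h , _) , _))) (inj₁ (h , _))              _ = contradiction (halvable-reflect π h) ¬h
  type-image π (inj₂ (inj₁ (_ , refl)))  (inj₂ (inj₁ (_ , eq)))         _ = eq
  type-image π (inj₂ (inj₁ (s , _)))     (inj₂ (inj₂ ((_ , ¬s) , _)))   _ = contradiction (symmetric-image π s) ¬s
  type-image π (inj₂ (inj₂ (_ , dir)))   _                        directed = directed dir

  -- The ends of the image atom were chosen independently, so they may come in the opposite order; a
  -- mixture of one and two ends is excluded by injectivity of π.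
  labelOfType-image : ∀ (π : Automorphism G) {P P′ l l′} → P′ ≡ imagePart π P →
                      (e : Ends (boundary P)) (e′ : Ends (boundary P′)) →
                      LabelOfType P e l → LabelOfType P′ e′ l′ → (Directed l → l′ ≡ l) → l′ ≡ l
  labelOfType-image π refl (single _ _) (single _ _) eq eq′ _ = trans eq′ (sym eq)
  labelOfType-image π refl (single u eq) (double u′ v′ u′≢v′ eq′) _ _ _ =
    contradiction (trans (only (∈-pairˡ u′ v′)) (sym (only (∈-pairʳ u′ v′)))) u′≢v′
    where
    only : ∀ {w} → w ∈ ⁅ u′ ⁆ ∪ ⁅ v′ ⁆ → w ≡ onV π ⟨$⟩ʳ u
    only {w} w∈ = x∈⁅y⁆⇒x≡y _ (subst (w ∈_)
      (trans (sym eq′) (trans (cong (imageV π) eq) (permute-⁅⁆ (onV π) u))) w∈)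
  labelOfType-image π refl (double u v u≢v eq) (single u′ eq′) _ _ _ =
    contradiction (permute-injective (onV π) (trans (only (∈-pairˡ _ _)) (sym (only (∈-pairʳ _ _))))) u≢v
    where
    only : ∀ {w} → w ∈ ⁅ onV π ⟨$⟩ʳ u ⁆ ∪ ⁅ onV π ⟨$⟩ʳ v ⁆ → w ≡ u′
    only {w} w∈ = x∈⁅y⁆⇒x≡y _ (subst (w ∈_)
      (trans (sym (permute-pair (onV π) u v)) (trans (sym (cong (imageV π) eq)) eq′)) w∈)
  labelOfType-image π {P} refl (double u v u≢v eq) (double u′ v′ _ eq′) type type′ directed
    with pair-≡ (u≢v ∘ permute-injective (onV π))
      (trans (sym (permute-pair (onV π) u v)) (trans (sym (cong (imageV π) eq)) eq′))
  ... | inj₁ (refl , refl) = type-image π {P} type type′ directed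
  ... | inj₂ (refl , refl) = type-image π {P} type (type-swap {imagePart π P} type′) directed

-- The induced automorphism

map-injective : ∀ {V W : Set} {f : V → W} → Injective _≡_ _≡_ f → ∀ m n →
                Maybe.map f m ≡ Maybe.map f n → m ≡ n
map-injective inj (just x) (just y) eq = cong just (inj (just-injective eq))
map-injective inj nothing  nothing  eq = refl

map-just⁻¹ : ∀ {V W : Set} {f : V → W} m {w} → Maybe.map f m ≡ just w → ∃[ v ] (m ≡ just v × f v ≡ w)
map-just⁻¹ (just v) refl = v , refl , refl

≢⇒≡not : ∀ {b b′} → b ≢ b′ → b′ ≡ not b
≢⇒≡not {false} {false} b≢b = contradiction refl b≢b
≢⇒≡not {false} {true}  _   = refl
≢⇒≡not {true}  {false} _   = refl
≢⇒≡not {true}  {true}  b≢b = contradiction refl b≢b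

b≢not : ∀ {b} → b ≢ not b
b≢not {false} ()
b≢not {true}  ()

module _ {G : Graph} where
  open Graph G
  open Automorphism

  endAt-injective : ∀ {X} (e : Ends {G} X) {b b′} → endAt e b ≡ endAt e b′ → b ≡ b′
  endAt-injective _                  {false} {false} _  = refl
  endAt-injective _                  {true}  {true}  _  = refl
  endAt-injective (double _ _ u≢v _) {false} {true}  eq = contradiction (just-injective eq) u≢v
  endAt-injective (double _ _ u≢v _) {true}  {false} eq = contradiction (sym (just-injective eq)) u≢v

  endAt⇒∈ : ∀ {X} (e : Ends {G} X) b {v} → endAt e b ≡ just v → v ∈ X
  endAt⇒∈ (single u refl)       false refl = x∈⁅x⁆ u
  endAt⇒∈ (double u v _ refl)   false refl = ∈-pairˡ u v
  endAt⇒∈ (double u v _ refl)   true  refl = ∈-pairʳ u v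

  ∈⇒endAt : ∀ {X} (e : Ends {G} X) {v} → v ∈ X → ∃[ b ] (endAt e b ≡ just v)
  ∈⇒endAt (single u refl) v∈ = false , cong just (sym (x∈⁅y⁆⇒x≡y u v∈))
  ∈⇒endAt (double u v _ refl) w∈ with ∈-pair⁻ w∈
  ... | inj₁ refl = false , refl
  ... | inj₂ refl = true , refl

  ends-nonempty : ∀ {X} → Ends {G} X → Nonempty X
  ends-nonempty (single u refl)     = u , x∈⁅x⁆ u
  ends-nonempty (double u v _ refl) = u , ∈-pairˡ u v

  ends-image : ∀ (π : Automorphism G) {X Y} → Y ≡ imageV π X → (e : Ends {G} X) (e′ : Ends {G} Y) →
               ∀ b → ∃[ b′ ] (endAt e′ b′ ≡ Maybe.map (onV π ⟨$⟩ʳ_) (endAt e b))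
  ends-image π {X} refl e e′ b with endAt e b in eq
  ... | just v  = ∈⇒endAt e′ (∈-permute⁺ (onV π) (endAt⇒∈ e b eq))
  ... | nothing = end-free e e′ b eq
    where
    end-free : ∀ {X} (e : Ends {G} X) (e′ : Ends {G} (imageV π X)) b →
               endAt e b ≡ nothing → ∃[ b′ ] (endAt e′ b′ ≡ nothing)
    end-free (single _ _)     _            false ()
    end-free (double _ _ _ _) _            true  ()
    end-free (single u refl) (single _ _) true _ = true , refl
    end-free (single u refl) (double u′ v′ u′≢v′ eq) true _ =
      contradiction (trans (only (∈-pairˡ u′ v′)) (sym (only (∈-pairʳ u′ v′)))) u′≢v′
      where
      only : ∀ {w} → w ∈ ⁅ u′ ⁆ ∪ ⁅ v′ ⁆ → w ≡ onV π ⟨$⟩ʳ u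
      only {w} w∈ = x∈⁅y⁆⇒x≡y _ (subst (w ∈_) (trans (sym eq) (permute-⁅⁆ (onV π) u)) w∈)

  -- The mate has some image, which differs from that of the dart because ends are distinct; with
  -- two darts only one choice remains. Hence the induced map commutes with ƛ on new edges.
  ends-image-not : ∀ (π : Automorphism G) {X Y} → Y ≡ imageV π X → (e : Ends {G} X) (e′ : Ends {G} Y) →
                   ∀ {b b′} → endAt e′ b′ ≡ Maybe.map (onV π ⟨$⟩ʳ_) (endAt e b) →
                   endAt e′ (not b′) ≡ Maybe.map (onV π ⟨$⟩ʳ_) (endAt e (not b))
  ends-image-not π Y≡ e e′ {b} {b′} eq with b″ , eq″ ← ends-image π Y≡ e e′ (not b) =
    subst (λ b → endAt e′ b ≡ _) (≢⇒≡not λ { refl → b≢not (endAt-injective e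
      (map-injective (permute-injective (onV π)) _ _ (trans (sym eq) eq″))) }) eq″

module _ {G H : Graph} {c : Node G} (R : Reduction G c H) where
  private
    module G = Graph G
    module H = Graph H
  open Reduction R
  open Automorphism

  -- The dart clauses of `Induces` for one dart, as a relation. It is total by `dartImage` and
  -- single-valued by `dartImage-unique`, so composition, inverses and commutation with ƛ reduce to
  -- comparing two images of one dart.
  record DartImage (π : Automorphism G) (e e′ : H.Dart) : Set where
    field
      old : ∀ {d} → originD e ≡ inj₁ d → originD e′ ≡ inj₁ (onD π ⟨$⟩ʳ d)
      new : ∀ {a b} → originD e ≡ inj₂ (a , b) → ∃₂ λ a′ b′ →
            originD e′ ≡ inj₂ (a′ , b′) × atom a′ ≡ imagePart π (atom a) ×
            endAt (ends a′) b′ ≡ Maybe.map (onV π ⟨$⟩ʳ_) (endAt (ends a) b)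
  open DartImage

  oldImage : ∀ {π e e′ d} → originD e ≡ inj₁ d → originD e′ ≡ inj₁ (onD π ⟨$⟩ʳ d) → DartImage π e e′
  oldImage {π} {e} {e′} eq eq′ = record
    { old = λ eq″ → subst (λ d → originD e′ ≡ inj₁ (onD π ⟨$⟩ʳ d)) (inj₁-injective (trans (sym eq) eq″)) eq′
    ; new = λ eq″ → contradiction (trans (sym eq) eq″) λ ()
    }

  newImage : ∀ {π e e′ a b a′ b′} → originD e ≡ inj₂ (a , b) → originD e′ ≡ inj₂ (a′ , b′) →
             atom a′ ≡ imagePart π (atom a) →
             endAt (ends a′) b′ ≡ Maybe.map (onV π ⟨$⟩ʳ_) (endAt (ends a) b) → DartImage π e e′
  newImage {π} {e} {e′} eq eq′ atom≡ end≡ = record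
    { old = λ eq″ → contradiction (trans (sym eq) eq″) λ ()
    ; new = λ eq″ → new′ (trans (sym eq) eq″)
    }
    where
    new′ : ∀ {a b} → inj₂ (_ , _) ≡ inj₂ (a , b) → ∃₂ λ a′ b′ →
           originD e′ ≡ inj₂ (a′ , b′) × atom a′ ≡ imagePart π (atom a) ×
           endAt (ends a′) b′ ≡ Maybe.map (onV π ⟨$⟩ʳ_) (endAt (ends a) b)
    new′ refl = _ , _ , eq′ , atom≡ , end≡

  dartImage-unique : ∀ {π e e′ e″} → DartImage π e e′ → DartImage π e e″ → e′ ≡ e″
  dartImage-unique {e = e} i j with originD e in eq
  ... | inj₁ d = originD-injective (trans (old i eq) (sym (old j eq)))
  ... | inj₂ (a , b)
      with a′ , b′ , eq′ , atom≡ , end≡ ← new i eq | a″ , b″ , eq″ , atom≡′ , end≡′ ← new j eq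
      with refl ← atom-distinct (trans atom≡ (sym atom≡′))
      with refl ← endAt-injective (ends a′) (trans end≡ (sym end≡′)) =
        originD-injective (trans eq′ (sym eq″))

  dartImage-id : ∀ e → DartImage idᴬ e e
  dartImage-id e with originD e in eq
  ... | inj₁ d       = oldImage eq eq
  ... | inj₂ (a , b) =
    newImage eq eq (sym (imagePart-id (atom a))) (sym (map-id′ {G} (λ _ → refl) (endAt (ends a) b)))

  dartImage-∘ : ∀ {π σ e e′ e″} → DartImage σ e e′ → DartImage π e′ e″ → DartImage (π ∘ᴬ σ) e e″
  dartImage-∘ {π} {σ} {e} i j with originD e in eq
  ... | inj₁ d = oldImage eq (old j (old i eq))
  ... | inj₂ (a , b)
      with a′ , b′ , eq′ , atom≡ , end≡ ← new i eq
      with a″ , b″ , eq″ , atom≡′ , end≡′ ← new j eq′ =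
        newImage eq eq″
          (trans atom≡′ (trans (cong (imagePart π) atom≡) (sym (imagePart-∘ π σ (atom a)))))
          (trans end≡′ (trans (cong (Maybe.map (onV π ⟨$⟩ʳ_)) end≡) (map-∘′ {G} _ _ (endAt (ends a) b))))

  dartImage-≈ : ∀ {π σ e e′} → π ≈ᴬ σ → DartImage π e e′ → DartImage σ e e′
  dartImage-≈ {π} {σ} {e} {e′} π≈σ@(eqV , eqD) i with originD e in eq
  ... | inj₁ d = oldImage eq (trans (old i eq) (cong inj₁ (eqD d)))
  ... | inj₂ (a , b) with a′ , b′ , eq′ , atom≡ , end≡ ← new i eq =
        newImage eq eq′ (trans atom≡ (imagePart-cong {π = π} {σ} π≈σ (atom a)))
          (trans end≡ (map-cong eqV (endAt (ends a) b)))

  dartImage-ƛ : ∀ {π e e′} → DartImage π e e′ → DartImage π (H.ƛ e) (H.ƛ e′)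
  dartImage-ƛ {π} {e} {e′} i with originD e in eq
  ... | inj₁ d = oldImage (old-ƛ eq) (trans (old-ƛ (old i eq)) (cong inj₁ (ƛ-comm π d)))
  ... | inj₂ (a , b) with a′ , b′ , eq′ , atom≡ , end≡ ← new i eq =
        newImage (new-ƛ eq) (new-ƛ eq′) atom≡
          (ends-image-not π (cong boundary atom≡) (ends a) (ends a′) end≡)

  module _ (π : Automorphism G) (fix : imageNode π c ≡ c) where

    atom-image : ∀ a → ∃[ a′ ] (atom a′ ≡ imagePart π (atom a))
    atom-image a = atom-complete (imagePart π (atom a)) (image-isAtom π fix (atom-isAtom a))

    interior-atom-image : ∀ a → ∃[ a′ ] (∀ x → x ∈ᴿ interior (atom a) → π ·ᴱ x ∈ᴿ interior (atom a′))
    interior-atom-image a with a′ , eq ← atom-image a = a′ , λ x x∈ →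
      subst (λ A → π ·ᴱ x ∈ᴿ A) (sym (trans (cong interior eq) (interior-image π (atom a))))
        (∈-imageRegion⁺ π x x∈)

  -- If the image lay inside an atom, the inverse would carry that atom to one with x in its
  -- interior.
  surviving-image : ∀ (π : Automorphism G) → imageNode π c ≡ c → ∀ x →
                    (∀ a → ¬ x ∈ᴿ interior (atom a)) → ∀ a → ¬ π ·ᴱ x ∈ᴿ interior (atom a)
  surviving-image π fix x surviving a πx∈
    with a′ , ∈a′ ← interior-atom-image (π ⁻¹ᴬ) (fixes-inverse π fix) a =
    surviving a′ (subst (_∈ᴿ interior (atom a′)) (·ᴱ-inverse′ π x) (∈a′ (π ·ᴱ x) πx∈))

  module _ (π : Automorphism G) (fix : imageNode π c ≡ c) where

    vertexImage : ∀ w → ∃[ w′ ] (originV w′ ≡ onV π ⟨$⟩ʳ originV w)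
    vertexImage w = originV-surjective _ (surviving-image π fix (inj₁ _) (originV-surviving w))

    dartImage : ∀ e → ∃[ e′ ] DartImage π e e′
    dartImage e with originD e in eq
    ... | inj₁ d with e′ , eq′ ← originD-surjective (onD π ⟨$⟩ʳ d)
                                   (surviving-image π fix (inj₂ d) (originD-surviving eq)) =
          e′ , oldImage eq eq′
    ... | inj₂ (a , b)
        with a′ , atom≡ ← atom-image π fix a
        with b′ , end≡ ← ends-image π (cong boundary atom≡) (ends a) (ends a′) b
        with e′ , eq′ ← originD-new a′ b′ = e′ , newImage eq eq′ atom≡ end≡

  private
    toV : ∀ π → imageNode π c ≡ c → H.Vertex → H.Vertex
    toV π fix w = proj₁ (vertexImage π fix w)

    toD : ∀ π → imageNode π c ≡ c → H.Dart → H.Dart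
    toD π fix e = proj₁ (dartImage π fix e)

    inverseV : ∀ π σ fix fix′ → π ∘ᴬ σ ≈ᴬ idᴬ → ∀ w → toV π fix (toV σ fix′ w) ≡ w
    inverseV π σ fix fix′ (eqV , _) w = originV-injective (trans (proj₂ (vertexImage π fix _))
      (trans (cong (onV π ⟨$⟩ʳ_) (proj₂ (vertexImage σ fix′ w))) (eqV (originV w))))

    inverseD : ∀ π σ fix fix′ → π ∘ᴬ σ ≈ᴬ idᴬ → ∀ e → toD π fix (toD σ fix′ e) ≡ e
    inverseD π σ fix fix′ eq e = dartImage-unique {idᴬ}
      (dartImage-≈ {π ∘ᴬ σ} eq (dartImage-∘ (proj₂ (dartImage σ fix′ e)) (proj₂ (dartImage π fix _))))
      (dartImage-id e)

  module _ (π : Automorphism G) (fix : imageNode π c ≡ c) where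

    image-ι : ∀ {e e′} → DartImage π e e′ →
              Maybe.map originV (H.ι e′) ≡ Maybe.map (onV π ⟨$⟩ʳ_) (Maybe.map originV (H.ι e))
    image-ι {e} i with originD e in eq
    ... | inj₁ d = trans (old-ι (old i eq))
                     (trans (ι-comm π d) (cong (Maybe.map (onV π ⟨$⟩ʳ_)) (sym (old-ι eq))))
    ... | inj₂ (a , b) with a′ , b′ , eq′ , atom≡ , end≡ ← new i eq =
          trans (new-ι eq′) (trans end≡ (cong (Maybe.map (onV π ⟨$⟩ʳ_)) (sym (new-ι eq))))

    image-colour : ∀ {e e′} → DartImage π e e′ → H.colour e′ ≡ H.colour e
    image-colour {e} i with originD e in eq
    ... | inj₁ d = trans (old-colour (old i eq)) (trans (colour≡ π d) (sym (old-colour eq)))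
    ... | inj₂ (a , b) with a′ , b′ , eq′ , atom≡ , end≡ ← new i eq =
          sym (from (colour-iso eq eq′) (subst (∂-Iso (atom a)) (sym atom≡) (∂-iso-image π (atom a))))

    image-label : ∀ {e e′} → DartImage π e e′ → H.label e′ ≡ H.label e
    image-label {e} {e′} i with originD e in eq
    ... | inj₁ d = trans (old-label (old i eq)) (trans (label≡ π d) (sym (old-label eq)))
    ... | inj₂ (a , b) with a′ , b′ , eq′ , atom≡ , end≡ ← new i eq =
          -- The restriction of π is itself the ∂-isomorphism along which `consistent` compares the
          -- two orientations.
          labelOfType-image π atom≡ (ends a) (ends a′) (new-label eq) (new-label eq′) λ dir →
            consistent eq eq′ dir (iso atom≡) (trans (iso-end atom≡) (sym end≡))
      where
      -- Abstracting the image atom as `P` allows matching on the equality, after which the map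
      -- visibly acts as π on the ends.
      iso : ∀ {P} → P ≡ imagePart π (atom a) → ∂-Iso (atom a) P
      iso refl = ∂-iso-image π (atom a)
      iso-end : ∀ {P} (eq : P ≡ imagePart π (atom a)) → Maybe.map (∂-Iso.toV (iso eq)) (endAt (ends a) b) ≡
                Maybe.map (onV π ⟨$⟩ʳ_) (endAt (ends a) b)
      iso-end refl = refl

    induced : Automorphism H
    induced = record
      { onV     = Perm.permutation (toV π fix) (toV (π ⁻¹ᴬ) fix⁻¹)
                    (inverseV π (π ⁻¹ᴬ) fix fix⁻¹ π∘π⁻¹) (inverseV (π ⁻¹ᴬ) π fix⁻¹ fix π⁻¹∘π)
      ; onD     = Perm.permutation (toD π fix) (toD (π ⁻¹ᴬ) fix⁻¹)
                    (inverseD π (π ⁻¹ᴬ) fix fix⁻¹ π∘π⁻¹) (inverseD (π ⁻¹ᴬ) π fix⁻¹ fix π⁻¹∘π)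
      ; ι-comm  = λ e → map-injective originV-injective _ _ (trans (image-ι (proj₂ (dartImage π fix e)))
                    (trans (map-∘′ {G} _ _ (H.ι e)) (trans
                      (map-cong (λ w → sym (proj₂ (vertexImage π fix w))) (H.ι e))
                      (sym (map-∘′ {G} _ _ (H.ι e))))))
      ; ƛ-comm  = λ e → dartImage-unique {π} (dartImage-ƛ (proj₂ (dartImage π fix e)))
                    (proj₂ (dartImage π fix (H.ƛ e)))
      ; colour≡ = λ e → image-colour (proj₂ (dartImage π fix e))
      ; label≡  = λ e → image-label (proj₂ (dartImage π fix e))
      }
      where
      fix⁻¹ = fixes-inverse π fix
      π∘π⁻¹ : π ∘ᴬ (π ⁻¹ᴬ) ≈ᴬ idᴬ
      π∘π⁻¹ = (λ _ → Perm.inverseʳ (onV π)) , (λ _ → Perm.inverseʳ (onD π))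
      π⁻¹∘π : (π ⁻¹ᴬ) ∘ᴬ π ≈ᴬ idᴬ
      π⁻¹∘π = (λ _ → Perm.inverseˡ (onV π)) , (λ _ → Perm.inverseˡ (onD π))

    induces-induced : Induces R π induced
    induces-induced = record
      { on-vertices  = λ w → proj₂ (vertexImage π fix w)
      ; on-old-darts = λ {e} → old (proj₂ (dartImage π fix e))
      ; on-new-darts = λ {e} → new (proj₂ (dartImage π fix e))
      }

  induces⇒dartImage : ∀ {π φ} → Induces R π φ → ∀ e → DartImage π e (onD φ ⟨$⟩ʳ e)
  induces⇒dartImage i e = record { old = Induces.on-old-darts i ; new = Induces.on-new-darts i }

  induces-unique : ∀ {π φ ψ} → Induces R π φ → Induces R π ψ → φ ≈ᴬ ψ
  induces-unique {π} {φ} {ψ} i j =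
      (λ w → originV-injective (trans (Induces.on-vertices i w) (sym (Induces.on-vertices j w))))
    , (λ e → dartImage-unique {π} (induces⇒dartImage {φ = φ} i e) (induces⇒dartImage {φ = ψ} j e))

  dartImage⇒induces : ∀ {π} {φ : Automorphism H} → (∀ w → originV (onV φ ⟨$⟩ʳ w) ≡ onV π ⟨$⟩ʳ originV w) →
                      (∀ e → DartImage π e (onD φ ⟨$⟩ʳ e)) → Induces R π φ
  dartImage⇒induces v d = record
    { on-vertices = v ; on-old-darts = λ {e} → old (d e) ; on-new-darts = λ {e} → new (d e) }

  induces-≈ : ∀ {π σ φ} → π ≈ᴬ σ → Induces R π φ → Induces R σ φ
  induces-≈ {π} {σ} {φ} π≈σ i = dartImage⇒induces {σ} {φ}
    (λ w → trans (Induces.on-vertices i w) (proj₁ π≈σ (originV w)))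
    (λ e → dartImage-≈ {π} {σ} π≈σ (induces⇒dartImage {φ = φ} i e))

  induces-∘ : ∀ {π σ φ ψ} → Induces R π φ → Induces R σ ψ → Induces R (π ∘ᴬ σ) (φ ∘ᴬ ψ)
  induces-∘ {π} {σ} {φ} {ψ} i j = dartImage⇒induces {π ∘ᴬ σ} {φ ∘ᴬ ψ}
    (λ w → trans (Induces.on-vertices i _) (cong (onV π ⟨$⟩ʳ_) (Induces.on-vertices j w)))
    (λ e → dartImage-∘ {π} {σ} (induces⇒dartImage {φ = ψ} j e) (induces⇒dartImage {φ = φ} i _))

  induces-id : Induces R idᴬ idᴬ
  induces-id = dartImage⇒induces {idᴬ} {idᴬ} (λ _ → refl) dartImage-id

  -- For products and the identity, both sides are induced by the same automorphism of G and so
  -- coincide.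
  induced-homomorphism : (fix : ∀ π → imageNode π c ≡ c) →
    GroupMorphisms.IsGroupHomomorphism (Group.rawGroup (Aut G)) (Group.rawGroup (Aut H))
      (λ π → induced π (fix π))
  induced-homomorphism fix = record
    { isMonoidHomomorphism = record
      { isMagmaHomomorphism = record
        { isRelHomomorphism = record
          { cong = λ {π} {σ} π≈σ → induces-unique {σ} {induced π (fix π)} {induced σ (fix σ)}
              (induces-≈ {π} {σ} {induced π (fix π)} π≈σ (induces-induced π (fix π)))
              (induces-induced σ (fix σ)) }
        ; homo = homo
        }
      ; ε-homo = induces-unique {idᴬ} {induced idᴬ (fix idᴬ)} {idᴬ} (induces-induced idᴬ (fix idᴬ)) induces-id
      }
    -- The two sides involve different proofs that the inverse fixes the centre; they are compared
    -- by cancelling `φ`.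
    ; ⁻¹-homo = λ π →
        let φ = induced π (fix π)
            π∘π⁻¹ = (λ _ → Perm.inverseʳ (onV π)) , (λ _ → Perm.inverseʳ (onD π)) in
          (λ w → trans (sym (Perm.inverseˡ (onV φ))) (cong (onV φ ⟨$⟩ˡ_)
            (inverseV π (π ⁻¹ᴬ) (fix π) (fix (π ⁻¹ᴬ)) π∘π⁻¹ w)))
        , (λ e → trans (sym (Perm.inverseˡ (onD φ))) (cong (onD φ ⟨$⟩ˡ_)
            (inverseD π (π ⁻¹ᴬ) (fix π) (fix (π ⁻¹ᴬ)) π∘π⁻¹ e)))
    }
    where
    homo : ∀ π σ → induced (π ∘ᴬ σ) (fix (π ∘ᴬ σ)) ≈ᴬ induced π (fix π) ∘ᴬ induced σ (fix σ)
    homo π σ = induces-unique {π ∘ᴬ σ} {induced (π ∘ᴬ σ) (fix (π ∘ᴬ σ))} {induced π (fix π) ∘ᴬ induced σ (fix σ)}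
      (induces-induced (π ∘ᴬ σ) (fix (π ∘ᴬ σ)))
      (induces-∘ {π} {σ} {induced π (fix π)} {induced σ (fix σ)}
        (induces-induced π (fix π)) (induces-induced σ (fix σ)))

-- Lifting automorphisms along a reduction

injective⇒surjective : ∀ {n} {f : Fin n → Fin n} → Injective _≡_ _≡_ f → ∀ y → ∃[ x ] (f x ≡ y)
injective⇒surjective {suc n} {f} inj y with Fin.any? (λ x → f x Fin.≟ y)
... | yes found = found
... | no missed = contradiction
  (Fin.injective⇒≤ {f = λ x → punchOut (y≢ x)} λ {x} {x′} eq →
    inj (Fin.punchOut-injective (y≢ x) (y≢ x′) eq))
  ℕ.1+n≰n
  where
  y≢ : ∀ x → y ≢ f x
  y≢ x eq = missed (x , sym eq)

-- By finiteness the glued maps need only be shown injective, which spares them an explicit inverse.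
injective⇒permutation : ∀ {n} (f : Fin n → Fin n) → Injective _≡_ _≡_ f → Permutation′ n
injective⇒permutation f inj = Perm.permutation f
  (λ y → proj₁ (injective⇒surjective inj y))
  (λ y → proj₂ (injective⇒surjective inj y))
  (λ x → inj (proj₂ (injective⇒surjective inj (f x))))

not-directed : ∀ {l} → Directed l → opposite l ≢ l
not-directed tail ()
not-directed head ()

module _ {G : Graph} where
  open Graph G

  -- The inclusion serves to move two distinct ends by an isomorphism of bodies. A central block
  -- part gives a singleton instead, which rules out two ends.
  atom-boundary : ∀ {c P} → IsAtom G c P →
                  boundary P ⊆ verts (body P) ⊎ (∃[ u ] boundary P ≡ ⁅ u ⁆)
  atom-boundary {P = P} atom with IsAtom.isPart atom
  ... | inj₂ (inj₁ pp)  = inj₁ (proper-boundary⊆ pp)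
  ... | inj₂ (inj₂ dip) = inj₁ (dipole-boundary⊆ dip)
  ... | inj₁ (attached _ _ _ _ _ bd) = inj₁ (attached-boundary⊆ {P = P} bd)
  ... | inj₁ (central u _ _ _ _ bd)  = inj₂ (u , bd)

  atom-isSubgraph : ∀ {c P} → IsAtom G c P → IsSubgraph (body P)
  atom-isSubgraph atom with IsAtom.isPart atom
  ... | inj₂ (inj₁ pp)  = proper-isSubgraph pp
  ... | inj₂ (inj₂ dip) = dipole-isSubgraph dip
  ... | inj₁ bp        with _ , _ , union , _ ← blockPart-boundary bp = union-isSubgraph union

  flip-ends : {P : Part G} → ∀ {u v l} → EdgeType P u v l → ¬ Directed l → Σ[ τ ∈ ∂-Aut P ] Exchanges τ u v
  flip-ends (inj₁ ((τ , _ , _ , exchanges) , _))      _    = τ , exchanges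
  flip-ends (inj₂ (inj₁ ((_ , τ , exchanges) , _)))   _    = τ , exchanges
  flip-ends (inj₂ (inj₂ (_ , dir)))                   ¬dir = contradiction dir ¬dir

  -- If f maps the ends the wrong way round, it is corrected by an automorphism exchanging them.
  matching-iso : {P Q : Part G} (eP : Ends {G} (boundary P)) (eQ : Ends {G} (boundary Q)) {l : Label} →
    boundary P ⊆ verts (body P) ⊎ (∃[ u ] boundary P ≡ ⁅ u ⁆) →
    (β : Bool → Bool) → β true ≡ not (β false) →
    (g : Vertex → Vertex) → (∀ b → endAt eQ (β b) ≡ Maybe.map g (endAt eP b)) →
    (f : ∂-Iso P Q) → LabelOfType P eP l →
    (Directed l → Maybe.map (∂-Iso.toV f) (endAt eP false) ≢ endAt eQ (β true)) →
    Σ[ f ∈ ∂-Iso P Q ] (∀ {v} → v ∈ boundary P → v ∈ verts (body P) → ∂-Iso.toV f v ≡ g v)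
  matching-iso {P} {Q} eP@(single u ∂P≡) eQ _ β _ g match f _ _ = f , agree eQ match
    where
    agree : (eQ : Ends {G} (boundary Q)) → (∀ b → endAt eQ (β b) ≡ Maybe.map g (endAt eP b)) →
            ∀ {v} → v ∈ boundary P → v ∈ verts (body P) → ∂-Iso.toV f v ≡ g v
    agree (single u′ eq′) match v∈ v∈P with refl ← x∈⁅y⁆⇒x≡y u (subst (_ ∈_) ∂P≡ v∈) = trans
      (x∈⁅y⁆⇒x≡y u′ (subst (_ ∈_) eq′ (to (∂-Iso.boundary⇔ f v∈P) v∈)))
      (sym (x∈⁅y⁆⇒x≡y u′ (subst (_ ∈_) eq′ (endAt⇒∈ (single u′ eq′) (β false) (match false)))))
    -- The free dart of a pendant edge cannot be matched here, as both darts of a double edge have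
    -- an end.
    agree (double _ _ _ _) match with β true | match true
    ... | false | ()
    ... | true  | ()
  matching-iso {P} {Q} (double u v u≢v ∂P≡) eQ status β β-not g match f type no-flip =
    finish pairing
    where
    u∈ : u ∈ boundary P
    u∈ = subst (u ∈_) (sym ∂P≡) (∈-pairˡ u v)
    v∈ : v ∈ boundary P
    v∈ = subst (v ∈_) (sym ∂P≡) (∈-pairʳ u v)
    ⊆body : boundary P ⊆ verts (body P)
    ⊆body x∈ = Sum.[ (λ ⊆P → ⊆P x∈) , (λ (x , eq) → contradiction
        (trans (x∈⁅y⁆⇒x≡y x (subst (u ∈_) eq u∈))
          (sym (x∈⁅y⁆⇒x≡y x (subst (v ∈_) eq v∈)))) u≢v) ]
      status
    f-boundary : ∀ {x} → x ∈ boundary P → ∂-Iso.toV f x ∈ boundary Q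
    f-boundary x∈ = to (∂-Iso.boundary⇔ f (⊆body x∈)) x∈
    f-injective : ∂-Iso.toV f u ≢ ∂-Iso.toV f v
    f-injective eq = u≢v (trans (sym (∂-Iso.fromV∘toV f (⊆body u∈)))
      (trans (cong (∂-Iso.fromV f) eq) (∂-Iso.fromV∘toV f (⊆body v∈))))
    values : ∀ {x} → x ∈ boundary Q → x ≡ g u ⊎ x ≡ g v
    values {x} x∈ with b , eq ← ∈⇒endAt eQ x∈ with b Bool.≟ β false
    ... | yes refl = inj₁ (just-injective (trans (sym eq) (match false)))
    ... | no b≢    = inj₂ (just-injective (trans (sym eq) (trans
            (cong (endAt eQ) (trans (≢⇒≡not (b≢ ∘ sym)) (sym β-not))) (match true))))
    pairing : (∂-Iso.toV f u ≡ g u × ∂-Iso.toV f v ≡ g v) ⊎ (∂-Iso.toV f u ≡ g v × ∂-Iso.toV f v ≡ g u)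
    pairing with values (f-boundary u∈) | values (f-boundary v∈)
    ... | inj₁ p | inj₁ q = contradiction (trans p (sym q)) f-injective
    ... | inj₁ p | inj₂ q = inj₁ (p , q)
    ... | inj₂ p | inj₁ q = inj₂ (p , q)
    ... | inj₂ p | inj₂ q = contradiction (trans p (sym q)) f-injective
    on-ends : (h : ∂-Iso P Q) → ∂-Iso.toV h u ≡ g u → ∂-Iso.toV h v ≡ g v →
              ∀ {x} → x ∈ boundary P → x ∈ verts (body P) → ∂-Iso.toV h x ≡ g x
    on-ends h p q x∈ _ = Sum.[ (λ { refl → p }) , (λ { refl → q }) ] (∈-pair⁻ (subst (_ ∈_) ∂P≡ x∈))
    finish : (∂-Iso.toV f u ≡ g u × ∂-Iso.toV f v ≡ g v) ⊎ (∂-Iso.toV f u ≡ g v × ∂-Iso.toV f v ≡ g u) →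
             Σ[ f ∈ ∂-Iso P Q ] (∀ {v} → v ∈ boundary P → v ∈ verts (body P) → ∂-Iso.toV f v ≡ g v)
    finish (inj₁ (p , q)) = f , on-ends f p q
    finish (inj₂ (p , q)) =
      -- Here `f` sends the first end to the partner of the second dart, so by `no-flip` the edge is
      -- not directed and an automorphism exchanging the ends exists.
      let τ , τu , τv = flip-ends {P} type (λ dir → no-flip dir (trans (cong just p) (sym (match true)))) in
      ∂-iso-∘ f τ , on-ends (∂-iso-∘ f τ) (trans (cong (∂-Iso.toV f) τu) q) (trans (cong (∂-Iso.toV f) τv) p)

module _ {G H : Graph} {c : Node G} (R : Reduction G c H) where
  private
    module G = Graph G
    module H = Graph H
  open Reduction R
  open Automorphism

  end-survives : ∀ a b {v} → endAt (ends a) b ≡ just v →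
                 ∃₂ λ e w → originD e ≡ inj₂ (a , b) × H.ι e ≡ just w × originV w ≡ v
  end-survives a b eq with e , eq′ ← originD-new a b
    with w , ιe , origin ← map-just⁻¹ (H.ι e) (trans (new-ι eq′) eq) = e , w , eq′ , ιe , origin

  boundary-survives : ∀ a {v} → v ∈ boundary (atom a) → ∃[ w ] (originV w ≡ v)
  boundary-survives a v∈ with b , eq ← ∈⇒endAt (ends a) v∈
    with _ , w , _ , _ , origin ← end-survives a b eq = w , origin

  -- Every boundary vertex is an end of a new edge and therefore the origin of a vertex of H.
  atom-avoids : ∀ a a′ → Avoids (atom a) (atom a′)
  atom-avoids a a′ v v∈ v∈a′ with w , refl ← boundary-survives a v∈ = originV-surviving w a′ v∈a′

  -- Equality of indices is decidable, so the doubly negated equality of atoms suffices.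
  interiors-disjoint : ∀ {a a′} x → x ∈ᴿ interior (atom a) → x ∈ᴿ interior (atom a′) → a ≡ a′
  interiors-disjoint {a} {a′} x x∈ x∈′ = decidable-stable (a Fin.≟ a′) λ a≢a′ →
    atoms-disjoint {z = x} (atom-isAtom a) (atom-isAtom a′) (atom-avoids a a′) (atom-avoids a′ a)
      (ends-nonempty (ends a)) (ends-nonempty (ends a′)) x∈ x∈′ (a≢a′ ∘ atom-distinct)

  module Lift (φ : Automorphism H) where

    φV : H.Vertex → H.Vertex
    φV = onV φ ⟨$⟩ʳ_

    φD : H.Dart → H.Dart
    φD = onD φ ⟨$⟩ʳ_

    φ-new : ∀ {e a b} → originD e ≡ inj₂ (a , b) → ∃[ o ] (originD (φD e) ≡ inj₂ o)
    φ-new {e} eq with originD (φD e) in eq′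
    ... | inj₁ d = contradiction (trans (sym (colour≡ φ e)) (old-colour eq′)) (new-colour eq d)
    ... | inj₂ o = o , refl

    φ-old : ∀ {e d} → originD e ≡ inj₁ d → ∃[ d′ ] (originD (φD e) ≡ inj₁ d′)
    φ-old {e} {d} eq with originD (φD e) in eq′
    ... | inj₁ d′ = d′ , refl
    ... | inj₂ o  = contradiction (trans (colour≡ φ e) (old-colour eq)) (new-colour eq′ d)

    first : ∀ a → ∃[ o ] (originD (φD (proj₁ (originD-new a false))) ≡ inj₂ o)
    first a = φ-new (proj₂ (originD-new a false))

    α : Fin #A → Fin #A
    α a = proj₁ (proj₁ (first a))

    β : Fin #A → Bool → Bool
    β a false = proj₂ (proj₁ (first a))
    β a true  = not (β a false)

    φ-dart : ∀ {e} a b → originD e ≡ inj₂ (a , b) → originD (φD e) ≡ inj₂ (α a , β a b)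
    φ-dart {e} a false eq = subst (λ e → originD (φD e) ≡ inj₂ (α a , β a false))
      (originD-injective (trans (proj₂ (originD-new a false)) (sym eq))) (proj₂ (first a))
    φ-dart {e} a true eq = subst (λ e → originD e ≡ inj₂ (α a , β a true))
      (trans (ƛ-comm φ e₀) (cong φD (originD-injective (trans (new-ƛ (proj₂ (originD-new a false))) (sym eq)))))
      (new-ƛ (proj₂ (first a)))
      where
      e₀ = proj₁ (originD-new a false)

    β-surjective : ∀ a b′ → ∃[ b ] (β a b ≡ b′)
    β-surjective a b′ with β a false Bool.≟ b′
    ... | yes eq = false , eq
    ... | no neq = true , sym (≢⇒≡not neq)

    α-injective : ∀ {a a′} → α a ≡ α a′ → a ≡ a′
    α-injective {a} {a′} eq =
      let b , β≡ = β-surjective a′ (β a false)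
          e , origin = originD-new a false
          e′ , origin′ = originD-new a′ b
          φe≡φe′ = originD-injective (trans (φ-dart a false origin)
            (trans (cong₂ (λ x y → inj₂ (x , y)) eq (sym β≡)) (sym (φ-dart a′ b origin′)))) in
      cong proj₁ (inj₂-injective (trans (sym origin)
        (trans (cong originD (permute-injective (onD φ) φe≡φe′)) origin′)))

    σ : G.Vertex → G.Vertex
    σ v with Fin.any? (λ w → originV w Fin.≟ v)
    ... | yes (w , _) = originV (φV w)
    ... | no _        = v

    σ-origin : ∀ w → σ (originV w) ≡ originV (φV w)
    σ-origin w with Fin.any? (λ w′ → originV w′ Fin.≟ originV w)
    ... | yes (w′ , eq) = cong (originV ∘ φV) (originV-injective eq)
    ... | no none       = contradiction (w , refl) none

    σ-ι : ∀ {e} → Maybe.map originV (H.ι (φD e)) ≡ Maybe.map σ (Maybe.map originV (H.ι e))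
    σ-ι {e} = trans (cong (Maybe.map originV) (ι-comm φ e)) (trans (map-∘′ {G} _ _ (H.ι e))
      (trans (map-cong (sym ∘ σ-origin) (H.ι e)) (sym (map-∘′ {G} _ _ (H.ι e)))))

    σ-ends : ∀ a b → endAt (ends (α a)) (β a b) ≡ Maybe.map σ (endAt (ends a) b)
    σ-ends a b with e , origin ← originD-new a b =
      trans (sym (new-ι (φ-dart a b origin))) (trans (σ-ι {e}) (cong (Maybe.map σ) (new-ι origin)))

    atom-iso : ∀ a → Σ[ f ∈ ∂-Iso (atom a) (atom (α a)) ]
               (∀ {v} → v ∈ boundary (atom a) → v ∈ verts (body (atom a)) → ∂-Iso.toV f v ≡ σ v)
    atom-iso a = matching-iso (ends a) (ends (α a)) (atom-boundary (atom-isAtom a)) (β a) refl σ (σ-ends a)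
      f₀ (new-label origin) λ dir eq → not-directed dir (trans (sym (H.label-ƛ e))
        (trans (sym (label≡ φ (H.ƛ e))) (consistent origin (φ-dart a true (new-ƛ origin)) dir f₀ eq)))
      where
      e : H.Dart
      e = proj₁ (originD-new a false)
      origin : originD e ≡ inj₂ (a , false)
      origin = proj₂ (originD-new a false)
      f₀ : ∂-Iso (atom a) (atom (α a))
      f₀ = to (colour-iso origin (φ-dart a false origin)) (sym (colour≡ φ e))

    module f a = ∂-Iso (proj₁ (atom-iso a))

    within : ∀ x → Dec (∃[ a ] (x ∈ᴿ interior (atom a)))
    within (inj₁ v) = Fin.any? λ a → v ∈? verts (interior (atom a))
    within (inj₂ d) = Fin.any? λ a → d ∈? darts (body (atom a))

    surviving : ∀ x → ¬ (∃[ a ] (x ∈ᴿ interior (atom a))) → ∀ a → ¬ x ∈ᴿ interior (atom a)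
    surviving x none a x∈ = none (a , x∈)

    πV : G.Vertex → G.Vertex
    πV v with within (inj₁ v)
    ... | yes (a , _) = f.toV a v
    ... | no _        = σ v

    πD : G.Dart → G.Dart
    πD d with within (inj₂ d)
    ... | yes (a , _) = f.toD a d
    ... | no none     = proj₁ (φ-old (proj₂ (originD-surjective d (surviving (inj₂ d) none))))

    πV-interior : ∀ {a v} → v ∈ verts (interior (atom a)) → πV v ≡ f.toV a v
    πV-interior {a} {v} v∈ with within (inj₁ v)
    ... | yes (a′ , v∈′) = cong (λ a → f.toV a v) (interiors-disjoint (inj₁ v) v∈′ v∈)
    ... | no none        = contradiction (a , v∈) none

    πV-origin : ∀ w → πV (originV w) ≡ originV (φV w)
    πV-origin w with within (inj₁ (originV w))
    ... | yes (a , w∈) = contradiction w∈ (originV-surviving w a)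
    ... | no _         = σ-origin w

    πD-atom : ∀ {a d} → d ∈ darts (body (atom a)) → πD d ≡ f.toD a d
    πD-atom {a} {d} d∈ with within (inj₂ d)
    ... | yes (a′ , d∈′) = cong (λ a → f.toD a d) (interiors-disjoint (inj₂ d) d∈′ d∈)
    ... | no none        = contradiction (a , d∈) none

    πD-old : ∀ {e d} → originD e ≡ inj₁ d → originD (φD e) ≡ inj₁ (πD d)
    πD-old {e} {d} eq with within (inj₂ d)
    ... | yes (a , d∈) = contradiction d∈ (originD-surviving eq a)
    ... | no none with e′ , eq′ ← originD-surjective d (surviving (inj₂ d) none) =
          trans (cong (originD ∘ φD) (originD-injective (trans eq (sym eq′)))) (proj₂ (φ-old eq′))

    πV-boundary : ∀ a {v} → v ∈ boundary (atom a) → πV v ≡ σ v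
    πV-boundary a v∈ with w , refl ← boundary-survives a v∈ = trans (πV-origin w) (sym (σ-origin w))

    πV-body : ∀ a {v} → v ∈ verts (body (atom a)) → πV v ≡ f.toV a v
    πV-body a {v} v∈ with v ∈? boundary (atom a)
    ... | yes v∈∂ = trans (πV-boundary a v∈∂) (sym (proj₂ (atom-iso a) v∈∂ v∈))
    ... | no v∉∂  = πV-interior (∈-∖⁺ (body (atom a)) (boundary (atom a)) v∈ v∉∂)

    πV-interior-∈ : ∀ a {v} → v ∈ verts (interior (atom a)) → πV v ∈ verts (interior (atom (α a)))
    πV-interior-∈ a {v} v∈ = subst (_∈ verts (interior (atom (α a)))) (sym (πV-interior v∈))
      (∈-∖⁺ (body (atom (α a))) (boundary (atom (α a))) (f.toV-∈ a v∈body)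
        (∈-∖⁻ (body (atom a)) (boundary (atom a)) v∈ ∘ from (f.boundary⇔ a v∈body)))
      where
      v∈body : v ∈ verts (body (atom a))
      v∈body = p─q⊆p _ (boundary (atom a)) v∈

    πV-ends : ∀ a b → endAt (ends (α a)) (β a b) ≡ Maybe.map πV (endAt (ends a) b)
    πV-ends a b with endAt (ends a) b in eq | σ-ends a b
    ... | nothing | eq′ = eq′
    ... | just v  | eq′ = trans eq′ (cong just (sym (πV-boundary a (endAt⇒∈ (ends a) b eq))))

    data VertexView : G.Vertex → Set where
      inner : ∀ a {v} → v ∈ verts (interior (atom a)) → VertexView v
      outer : ∀ w → VertexView (originV w)

    vertexView : ∀ v → VertexView v
    vertexView v with within (inj₁ v)
    ... | yes (a , v∈) = inner a v∈
    ... | no none with w , refl ← originV-surjective v (surviving (inj₁ v) none) = outer w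

    data DartView (d : G.Dart) : Set where
      inner : ∀ a → d ∈ darts (body (atom a)) → DartView d
      outer : ∀ e → originD e ≡ inj₁ d → DartView d

    dartView : ∀ d → DartView d
    dartView d with within (inj₂ d)
    ... | yes (a , d∈) = inner a d∈
    ... | no none with e , eq ← originD-surjective d (surviving (inj₂ d) none) = outer e eq

    πV-injective : ∀ {v v′} → πV v ≡ πV v′ → v ≡ v′
    πV-injective {v} {v′} eq with vertexView v | vertexView v′
    ... | outer w | outer w′ = cong originV (permute-injective (onV φ) (originV-injective
          (trans (sym (πV-origin w)) (trans eq (πV-origin w′)))))
    ... | outer w | inner a v∈ = contradiction (πV-interior-∈ a v∈)
          (subst (_∉ _) (trans (sym (πV-origin w)) eq) (originV-surviving (φV w) (α a)))
    ... | inner a v∈ | outer w = contradiction (πV-interior-∈ a v∈)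
          (subst (_∉ _) (trans (sym (πV-origin w)) (sym eq)) (originV-surviving (φV w) (α a)))
    ... | inner a v∈ | inner a′ v∈′
        with refl ← α-injective (interiors-disjoint (inj₁ (πV v′))
          (subst (_∈ verts (interior (atom (α a)))) eq (πV-interior-∈ a v∈)) (πV-interior-∈ a′ v∈′)) =
        trans (sym (f.fromV∘toV a (p─q⊆p _ (boundary (atom a)) v∈)))
          (trans (cong (f.fromV a) (trans (sym (πV-interior v∈)) (trans eq (πV-interior v∈′))))
            (f.fromV∘toV a (p─q⊆p _ (boundary (atom a)) v∈′)))

    πD-∈ : ∀ a {d} → d ∈ darts (body (atom a)) → πD d ∈ darts (body (atom (α a)))
    πD-∈ a d∈ = subst (_∈ darts (body (atom (α a)))) (sym (πD-atom d∈)) (f.toD-∈ a d∈)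

    πD-injective : ∀ {d d′} → πD d ≡ πD d′ → d ≡ d′
    πD-injective {d} {d′} eq with dartView d | dartView d′
    ... | outer e o | outer e′ o′ = inj₁-injective (trans (sym o) (trans (cong originD
          (permute-injective (onD φ) (originD-injective
            (trans (πD-old o) (trans (cong inj₁ eq) (sym (πD-old o′))))))) o′))
    ... | outer e o | inner a d∈ = contradiction (πD-∈ a d∈)
          (originD-surviving (trans (πD-old o) (cong inj₁ eq)) (α a))
    ... | inner a d∈ | outer e o = contradiction (πD-∈ a d∈)
          (originD-surviving (trans (πD-old o) (cong inj₁ (sym eq))) (α a))
    ... | inner a d∈ | inner a′ d∈′
        with refl ← α-injective (interiors-disjoint (inj₂ (πD d′))
          (subst (_∈ darts (body (atom (α a)))) eq (πD-∈ a d∈)) (πD-∈ a′ d∈′)) =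
        trans (sym (f.fromD∘toD a d∈))
          (trans (cong (f.fromD a) (trans (sym (πD-atom d∈)) (trans eq (πD-atom d∈′)))) (f.fromD∘toD a d∈′))

    lift-ι : ∀ d → G.ι (πD d) ≡ Maybe.map πV (G.ι d)
    lift-ι d with dartView d
    ... | inner a d∈ = trans (cong G.ι (πD-atom d∈)) (trans (f.ι-comm a d∈) agree)
      where
      agree : Maybe.map (f.toV a) (G.ι d) ≡ Maybe.map πV (G.ι d)
      agree with G.ι d in eq
      ... | nothing = refl
      ... | just v  = cong just (sym (πV-body a (proj₂ (atom-isSubgraph (atom-isAtom a)) d v d∈ eq)))
    ... | outer e o = trans (sym (old-ι (πD-old o))) (trans (cong (Maybe.map originV) (ι-comm φ e))
          (trans (map-∘′ {G} _ _ (H.ι e)) (trans (map-cong (sym ∘ πV-origin) (H.ι e))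
            (trans (sym (map-∘′ {G} _ _ (H.ι e))) (cong (Maybe.map πV) (old-ι o))))))

    lift-ƛ : ∀ d → G.ƛ (πD d) ≡ πD (G.ƛ d)
    lift-ƛ d with dartView d
    ... | inner a d∈ = trans (cong G.ƛ (πD-atom d∈)) (trans (f.ƛ-comm a d∈)
          (sym (πD-atom (proj₁ (atom-isSubgraph (atom-isAtom a)) d d∈))))
    ... | outer e o = inj₁-injective (trans (sym (old-ƛ (πD-old o)))
          (trans (cong originD (ƛ-comm φ e)) (πD-old (old-ƛ o))))

    lift-colour : ∀ d → G.colour (πD d) ≡ G.colour d
    lift-colour d with dartView d
    ... | inner a d∈ = trans (cong G.colour (πD-atom d∈)) (f.colour≡ a d∈)
    ... | outer e o  = trans (sym (old-colour (πD-old o))) (trans (colour≡ φ e) (old-colour o))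

    lift-label : ∀ d → G.label (πD d) ≡ G.label d
    lift-label d with dartView d
    ... | inner a d∈ = trans (cong G.label (πD-atom d∈)) (f.label≡ a d∈)
    ... | outer e o  = trans (sym (old-label (πD-old o))) (trans (label≡ φ e) (old-label o))

    lift : Automorphism G
    lift = record
      { onV     = injective⇒permutation πV πV-injective
      ; onD     = injective⇒permutation πD πD-injective
      ; ι-comm  = lift-ι
      ; ƛ-comm  = lift-ƛ
      ; colour≡ = lift-colour
      ; label≡  = lift-label
      }

    lift-atom : ∀ a → atom (α a) ≡ imagePart lift (atom a)
    lift-atom a = sym (cong₂ part (cong₂ region
      (permute-unique (onV lift) (verts (body (atom a))) (verts (body (atom (α a)))) verts⁺ verts⁻)
      (permute-unique (onD lift) (darts (body (atom a))) (darts (body (atom (α a)))) (πD-∈ a) darts⁻))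
      (permute-unique (onV lift) (boundary (atom a)) (boundary (atom (α a))) boundary⁺ boundary⁻))
      where
      verts⁺ : ∀ {v} → v ∈ verts (body (atom a)) → πV v ∈ verts (body (atom (α a)))
      verts⁺ v∈ = subst (_∈ verts (body (atom (α a)))) (sym (πV-body a v∈)) (f.toV-∈ a v∈)
      verts⁻ : ∀ {v} → πV v ∈ verts (body (atom (α a))) → v ∈ verts (body (atom a))
      verts⁻ v∈ = subst (_∈ verts (body (atom a)))
        (πV-injective (trans (πV-body a (f.fromV-∈ a v∈)) (f.toV∘fromV a v∈))) (f.fromV-∈ a v∈)
      darts⁻ : ∀ {d} → πD d ∈ darts (body (atom (α a))) → d ∈ darts (body (atom a))
      darts⁻ d∈ = subst (_∈ darts (body (atom a)))
        (πD-injective (trans (πD-atom (f.fromD-∈ a d∈)) (f.toD∘fromD a d∈))) (f.fromD-∈ a d∈)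
      boundary⁺ : ∀ {v} → v ∈ boundary (atom a) → πV v ∈ boundary (atom (α a))
      boundary⁺ v∈ with b , eq ← ∈⇒endAt (ends a) v∈ =
        endAt⇒∈ (ends (α a)) (β a b) (trans (πV-ends a b) (cong (Maybe.map πV) eq))
      boundary⁻ : ∀ {v} → πV v ∈ boundary (atom (α a)) → v ∈ boundary (atom a)
      boundary⁻ v∈ with b′ , eq ← ∈⇒endAt (ends (α a)) v∈ with b , refl ← β-surjective a b′ =
        endAt⇒∈ (ends a) b (map-just⁻ πV-injective (endAt (ends a) b) (trans (sym (πV-ends a b)) eq))

    lift-induces : Induces R lift φ
    lift-induces = record
      { on-vertices  = λ w → sym (πV-origin w)
      ; on-old-darts = πD-old
      ; on-new-darts = λ {e} {a} {b} origin → α a , β a b , φ-dart a b origin , lift-atom a , πV-ends a b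
      }

  epimorphism : (∀ π → imageNode π c ≡ c) → ReductionEpimorphism R
  epimorphism fix = record
    { Φ                   = λ π → induced R π (fix π)
    ; isGroupHomomorphism = induced-homomorphism R fix
    ; surjective          = λ φ → Lift.lift φ , λ {π} π≈lift →
        induces-unique R {Lift.lift φ} {induced R π (fix π)} {φ}
          (induces-≈ R {π} {Lift.lift φ} {induced R π (fix π)} π≈lift (induces-induced R π (fix π)))
          (Lift.lift-induces φ)
    ; induces             = λ π → induces-induced R π (fix π)
    }

  centreImage-fixed : ∀ {x c′} → (∀ π → imageNode π x ≡ x) → CentreImage R x c′ →
                      ∀ φ → imageNode φ c′ ≡ c′
  centreImage-fixed fix (art w) φ = cong art (originV-injective
    (trans (Induces.on-vertices (Lift.lift-induces φ) w) (art-injective (fix (Lift.lift φ)))))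
    where
    art-injective : ∀ {v w} → _≡_ {A = Node G} (art v) (art w) → v ≡ w
    art-injective refl = refl
  centreImage-fixed fix (blk C C′ verts⇔ darts⇔) φ = cong blk (cong₂ region
    (permute-unique (onV φ) (verts C′) (verts C′) (verts⁺ φ) λ w∈ →
      subst (_∈ verts C′) (Perm.inverseˡ (onV φ)) (verts⁺ (φ ⁻¹ᴬ) w∈))
    (permute-unique (onD φ) (darts C′) (darts C′) (darts⁺ φ) λ e∈ →
      subst (_∈ darts C′) (Perm.inverseˡ (onD φ)) (darts⁺ (φ ⁻¹ᴬ) e∈)))
    where
    blk-injective : ∀ {B D} → _≡_ {A = Node G} (blk B) (blk D) → B ≡ D
    blk-injective refl = refl
    C-fixed : ∀ π → imageRegion π C ≡ C
    C-fixed π = blk-injective (fix π)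
    verts⁺ : ∀ ψ {w} → w ∈ verts C′ → onV ψ ⟨$⟩ʳ w ∈ verts C′
    verts⁺ ψ {w} w∈ = from (verts⇔ _) (subst₂ (λ v A → v ∈ verts A)
      (sym (Induces.on-vertices (Lift.lift-induces ψ) w)) (C-fixed (Lift.lift ψ))
      (∈-permute⁺ (onV (Lift.lift ψ)) (to (verts⇔ w) w∈)))
    darts⁺ : ∀ ψ {e} → e ∈ darts C′ → onD ψ ⟨$⟩ʳ e ∈ darts C′
    darts⁺ ψ {e} e∈ = from (darts⇔ _) (meets (originD e) refl (to (darts⇔ e) e∈))
      where
      π : Automorphism G
      π = Lift.lift ψ
      C⁺ : ∀ {d} → d ∈ darts C → onD π ⟨$⟩ʳ d ∈ darts C
      C⁺ d∈ = subst (λ A → _ ∈ darts A) (C-fixed π) (∈-permute⁺ (onD π) d∈)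
      meets : ∀ o → originD e ≡ o → OriginMeets R C o → OriginMeets R C (originD (onD ψ ⟨$⟩ʳ e))
      meets (inj₁ d) eq d∈ =
        subst (OriginMeets R C) (sym (Induces.on-old-darts (Lift.lift-induces ψ) eq)) (C⁺ d∈)
      meets (inj₂ (a , b)) eq (d , d∈C , d∈a)
        with a′ , b′ , eq′ , atom≡ , _ ← Induces.on-new-darts (Lift.lift-induces ψ) eq =
        subst (OriginMeets R C) (sym eq′) (onD π ⟨$⟩ʳ d , C⁺ d∈C
          , subst (λ P → onD π ⟨$⟩ʳ d ∈ darts (body P)) (sym atom≡) (∈-permute⁺ (onD π) d∈a))

-- Quotients

module _ {c ℓ} {𝒢 ℋ : Group c ℓ} where
  private
    module 𝒢 = Group 𝒢
    module ℋ = Group ℋ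
  open GroupMorphisms using (IsGroupHomomorphism)

  first-isomorphism : (φ : 𝒢.Carrier → ℋ.Carrier)
                      (hom : IsGroupHomomorphism 𝒢.rawGroup ℋ.rawGroup φ) →
                      Surjective 𝒢._≈_ ℋ._≈_ φ → ℋ ≅ (𝒢 / Ker 𝒢 ℋ φ hom)
  first-isomorphism φ hom surj = ψ , record
    { isGroupMonomorphism = record
      { isGroupHomomorphism = record
        { isMonoidHomomorphism = record
          { isMagmaHomomorphism = record
            { isRelHomomorphism = record
              { cong = λ {x} {y} x≈y → kernel⁺ (ℋ.trans (φψ x) (ℋ.trans x≈y (ℋ.sym (φψ y)))) }
            ; homo = λ x y → kernel⁺ (ℋ.trans (φψ (x ℋ.∙ y))
                (ℋ.sym (ℋ.trans (homo (ψ x) (ψ y)) (ℋ.∙-cong (φψ x) (φψ y)))))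
            }
          ; ε-homo = kernel⁺ (ℋ.trans (φψ ℋ.ε) (ℋ.sym ε-homo))
          }
        ; ⁻¹-homo = λ x → kernel⁺ (ℋ.trans (φψ (x ℋ.⁻¹))
            (ℋ.sym (ℋ.trans (⁻¹-homo (ψ x)) (ℋ.⁻¹-cong (φψ x)))))
        }
      ; injective = λ {x} {y} x∼y → ℋ.trans (ℋ.sym (φψ x)) (ℋ.trans (kernel⁻ x∼y) (φψ y))
      }
    ; surjective = λ g → φ g , λ {h} h≈φg → kernel⁺ (ℋ.trans (φψ h) h≈φg)
    }
    where
    open IsGroupHomomorphism hom
    ψ : ℋ.Carrier → 𝒢.Carrier
    ψ h = proj₁ (surj h)
    φψ : ∀ h → φ (ψ h) ℋ.≈ h
    φψ h = proj₂ (surj h) 𝒢.refl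
    quotient : ∀ x y → φ (x 𝒢.⁻¹ 𝒢.∙ y) ℋ.≈ φ x ℋ.⁻¹ ℋ.∙ φ y
    quotient x y = ℋ.trans (homo (x 𝒢.⁻¹) y) (ℋ.∙-congʳ (⁻¹-homo x))
    kernel⁺ : ∀ {x y} → φ x ℋ.≈ φ y → φ (x 𝒢.⁻¹ 𝒢.∙ y) ℋ.≈ ℋ.ε
    kernel⁺ {x} {y} eq = ℋ.trans (quotient x y) (ℋ.trans (ℋ.∙-congˡ (ℋ.sym eq)) (ℋ.inverseˡ (φ x)))
    kernel⁻ : ∀ {x y} → φ (x 𝒢.⁻¹ 𝒢.∙ y) ℋ.≈ ℋ.ε → φ x ℋ.≈ φ y
    kernel⁻ {x} {y} eq = ℋ.trans (ℋ.sym (GroupProperties.⁻¹-involutive ℋ (φ x)))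
      (ℋ.sym (GroupProperties.inverseʳ-unique ℋ (φ x ℋ.⁻¹) (φ y) (ℋ.trans (ℋ.sym (quotient x y)) eq)))

centres-fixed : ∀ {G r} (S : ReductionSeries G r) → let open ReductionSeries S in
                ∀ i (π : Automorphism (graph i)) → imageNode π (centre i) ≡ centre i
centres-fixed S = <-weakInduction (λ i → ∀ (π : Automorphism (graph i)) → imageNode π (centre i) ≡ centre i)
  (λ π → centre-fixed π centre-start)
  (λ i fix → centreImage-fixed (reduction i) fix (centre-image i))
  where open ReductionSeries S

proposition1p1 : (G : Graph) → Connected (whole G) → LoopFree G → HalfEdgeFree G →
    (r : ℕ) (S : ReductionSeries G r) → let open ReductionSeries S in
    (i : Fin r) →
    ReductionEpimorphism (reduction i) ×
    ((Φᵢ : ReductionEpimorphism (reduction i)) →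
    Aut (graph (suc i)) ≅ (Aut (graph (inject₁ i)) / ReductionEpimorphism.Kernel Φᵢ))
proposition1p1 G _ _ _ r S i =
    epimorphism (reduction i) (centres-fixed S (inject₁ i))
  , λ Φᵢ → let open ReductionEpimorphism Φᵢ in
      first-isomorphism {𝒢 = Aut (graph (inject₁ i))} {Aut (graph (suc i))} Φ isGroupHomomorphism surjective
  where open ReductionSeries S
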